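{- For every integer $m\ge3$ there is a polynomial $E(w)\in\mathbb Q[w]$ such that $$D(w)=\begin{cases}E(w)^3, & 3\nmid m,\\ \big(w^2-\tfrac{27}{4}\big)E(w)^3, & 3\mid m.\end{cases}$$ As such, $\deg E=(m-1)(m-2)/3$ if $3\nmid m$ and $\deg E=((m-1)(m-2)-2)/3$ if $3\mid m$.
   Context: For an integer $m\ge3$, set $Q(u):=u^m-i^m$ and $W(u,v,w):=iu^2v^2+u^2v+uv^2-2wuv+u+v-i$ with $i=\sqrt{ -1}$, and $$D(w)=\frac{1}{2^{m^2}w^{3m-2}}\operatorname{Res}_u\Big(Q(u),\ \operatorname{Res}_v\big(Q(v),\,W(u,v,w)\big)\Big),$$ where $\operatorname{Res}_x$ is the resultant (Sylvester determinant) with respect to $x$. Equivalently, $D$ is the spectral determinant polynomial $$D(w)=\prod_{(a,b)}(w-r_{a,b}),\qquad r_{a,b}=-\sin\tfrac{2\pi a}{m}-\sin\tfrac{2\pi b}{m}+\sin\tfrac{2\pi(a+b)}{m},$$ the product running over all $(a,b)\in(\mathbb Z/m\mathbb Z)^2$ with $a\ne0$, $b\neq0$ and $a+b\not\equiv0\bmod m$; it is monic of degree $(m-1)(m-2)$. -}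

module Defs where

open import Level using (0ℓ)
open import Algebra.Bundles.Raw using (RawRing)
import Algebra.Definitions.RawSemiring as RawSemiringDefs
open import Data.Bool.Base using (if_then_else_)
open import Data.Fin.Base as Fin using (Fin; toℕ; punchIn; splitAt)
open import Data.Integer.Base as ℤ using (+_)
open import Data.List.Base using (List; []; _∷_; map)
open import Data.Nat.Base as ℕ using (ℕ; zero; suc; _∸_; _≤ᵇ_)
open import Data.Product.Base using (_×_; _,_; proj₁; proj₂)
open import Data.Rational.Base as ℚ using (ℚ; 0ℚ; 1ℚ; ½)
import Data.Rational.Properties as ℚ
open import Data.Sum.Base using ([_,_]′)
open import Function.Base using (_∘_)
open import Relation.Binary.Core using (Rel)
open import Relation.Binary.Definitions using (Decidable; DecidableEquality)
open import Relation.Binary.Structures using (IsDecEquivalence)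
open import Relation.Binary.PropositionalEquality.Core using (_≡_; cong; cong₂)
open import Relation.Binary.PropositionalEquality.Properties as ≡ using ()
open import Relation.Nullary.Decidable using (does; yes; no; map′; _×-dec_)

-- Decidability is needed to read off the degree of a polynomial.
record DecRawRing : Set₁ where
  field
    rawRing          : RawRing 0ℓ 0ℓ
    isDecEquivalence : IsDecEquivalence (RawRing._≈_ rawRing)

  open RawRing rawRing public
  open RawSemiringDefs rawSemiring public using (_^_; sum)

-- Polynomials are lists of coefficients, constant term first.  Trailing zeros
-- are allowed; equality is equality of all coefficients.
module Polynomial (R : DecRawRing) where
  open DecRawRing R
  private module ≈ = IsDecEquivalence isDecEquivalence

  Poly : Set
  Poly = List Carrier

  coeff : Poly → ℕ → Carrier
  coeff []      _         = 0#
  coeff (a ∷ p) zero      = a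
  coeff (a ∷ p) (suc k) = coeff p k

  infix 4 _≋_ _≋?_

  _≋_ : Rel Poly 0ℓ
  p ≋ q = ∀ k → coeff p k ≈ coeff q k

  _≋?_ : Decidable _≋_
  []      ≋? []      = yes λ _ → ≈.refl
  []      ≋? (b ∷ q) = map′ (λ { (h , t) zero → h ; (h , t) (suc k) → t k })
                            (λ e → e 0 , e ∘ suc) ((0# ≈.≟ b) ×-dec ([] ≋? q))
  (a ∷ p) ≋? []      = map′ (λ { (h , t) zero → h ; (h , t) (suc k) → t k })
                            (λ e → e 0 , e ∘ suc) ((a ≈.≟ 0#) ×-dec (p ≋? []))
  (a ∷ p) ≋? (b ∷ q) = map′ (λ { (h , t) zero → h ; (h , t) (suc k) → t k })
                            (λ e → e 0 , e ∘ suc) ((a ≈.≟ b) ×-dec (p ≋? q))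

  infixl 6 _⊕_
  infixl 7 _⊛_

  _⊕_ : Poly → Poly → Poly
  []      ⊕ q       = q
  (a ∷ p) ⊕ []      = a ∷ p
  (a ∷ p) ⊕ (b ∷ q) = a + b ∷ p ⊕ q

  _⊛_ : Poly → Poly → Poly
  []      ⊛ q = []
  (a ∷ p) ⊛ q = map (a *_) q ⊕ (0# ∷ p ⊛ q)

  const : Carrier → Poly
  const a = a ∷ []

  X : Poly
  X = 0# ∷ 1# ∷ []

  -- The zero polynomial has degree 0 by convention.
  deg : Poly → ℕ
  deg []      = 0
  deg (a ∷ p) = if does (p ≋? []) then 0 else suc (deg p)

  infix 8 _[X]

  _[X] : DecRawRing
  _[X] = record
    { rawRing = record
      { Carrier = Poly
      ; _≈_ = _≋_
      ; _+_ = _⊕_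
      ; _*_ = _⊛_
      ; -_  = map -_
      ; 0#  = []
      ; 1#  = const 1#
      }
    ; isDecEquivalence = record
      { isEquivalence = record
        { refl  = λ _ → ≈.refl
        ; sym   = λ e k → ≈.sym (e k)
        ; trans = λ e f k → ≈.trans (e k) (f k)
        }
      ; _≟_ = _≋?_
      }
    }

  Matrix : ℕ → Set
  Matrix n = Fin n → Fin n → Carrier

  -- Laplace expansion along the first row.
  det : ∀ {n} → Matrix n → Carrier
  det {zero}    M = 1#
  det {suc n}  M = sum λ j →
    (- 1#) ^ toℕ j * M Fin.zero j * det (λ i k → M (Fin.suc i) (punchIn j k))

  -- Row i of the band of a degree-d polynomial p is
  --   0 … 0 p_d p_(d-1) … p_0 0 … 0   with i leading zeros;
  -- these leading zeros are the coefficients of p beyond its degree.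
  band : Poly → ℕ → ℕ → Carrier
  band p i j = if j ≤ᵇ deg p ℕ.+ i then coeff p (deg p ℕ.+ i ∸ j) else 0#

  -- deg q rows of coefficients of p, followed by deg p rows of those of q.
  sylvester : (p q : Poly) → Matrix (deg q ℕ.+ deg p)
  sylvester p q i j =
    [ (λ r → band p (toℕ r) (toℕ j)) , (λ r → band q (toℕ r) (toℕ j)) ]′
      (splitAt (deg q) i)

  Res : Poly → Poly → Carrier
  Res p q = det (sylvester p q)

open Polynomial public using (_[X])

ℚ-ring : DecRawRing
ℚ-ring = record
  { rawRing = ℚ.+-*-rawRing ; isDecEquivalence = ≡.isDecEquivalence ℚ._≟_ }

record ℚ⟨i⟩ : Set where
  constructor _+i_
  field
    re im : ℚ

_≟ᵢ_ : DecidableEquality ℚ⟨i⟩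
(a +i b) ≟ᵢ (c +i d) =
  map′ (λ e → cong₂ _+i_ (proj₁ e) (proj₂ e))
       (λ e → cong ℚ⟨i⟩.re e , cong ℚ⟨i⟩.im e)
       ((a ℚ.≟ c) ×-dec (b ℚ.≟ d))

ℚ⟨i⟩-ring : DecRawRing
ℚ⟨i⟩-ring = record
  { rawRing = record
    { Carrier = ℚ⟨i⟩
    ; _≈_ = _≡_
    ; _+_ = λ { (a +i b) (c +i d) → (a ℚ.+ c) +i (b ℚ.+ d) }
    ; _*_ = λ { (a +i b) (c +i d) →
                (a ℚ.* c ℚ.- b ℚ.* d) +i (a ℚ.* d ℚ.+ b ℚ.* c) }
    ; -_  = λ { (a +i b) → (ℚ.- a) +i (ℚ.- b) }
    ; 0#  = 0ℚ +i 0ℚ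
    ; 1#  = 1ℚ +i 0ℚ
    }
  ; isDecEquivalence = ≡.isDecEquivalence _≟ᵢ_
  }

embed : ℚ → ℚ⟨i⟩
embed a = a +i 0ℚ

𝕚 : ℚ⟨i⟩
𝕚 = 0ℚ +i 1ℚ

-- The resultants are nested, so the variables are adjoined in the order w, u, v:
-- Rw = ℚ(i)[w], Ru = ℚ(i)[w][u], Rv = ℚ(i)[w][u][v].
Rw Ru Rv : DecRawRing
Rw = ℚ⟨i⟩-ring [X]
Ru = Rw [X]
Rv = Ru [X]

module ℚ[w] = DecRawRing (ℚ-ring [X])
module ℚi[w] = DecRawRing Rw
module ℚi[w][u] = DecRawRing Ru
module ℚi[w][u][v] = DecRawRing Rv

module Pℚ = Polynomial ℚ-ring
module Pw = Polynomial ℚ⟨i⟩-ring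
module Pu = Polynomial Rw
module Pv = Polynomial Ru

Q : (R : DecRawRing) (i x : DecRawRing.Carrier R) → ℕ → DecRawRing.Carrier R
Q R i x m = x ^ m + - (i ^ m)
  where open DecRawRing R

W : ℚi[w][u][v].Carrier
W = i * u ^ 2 * v ^ 2 + u ^ 2 * v + u * v ^ 2 + - ((1# + 1#) * w * u * v)
    + u + v + - i
  where
  open ℚi[w][u][v]
  i w u v : Carrier
  i = Pv.const (Pu.const (Pw.const 𝕚))
  w = Pv.const (Pu.const Pw.X)
  u = Pv.const Pu.X
  v = Pv.X

resultant : ℕ → ℚi[w].Carrier
resultant m = Pu.Res (Q Ru (Pu.const (Pw.const 𝕚)) Pu.X m)
                     (Pv.Res (Q Rv (Pv.const (Pu.const (Pw.const 𝕚))) Pv.X m) W)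

-- p /w^ k is the element p / w^k of ℚ(i)[w, w⁻¹].
infix 5 _/w^_
record Laurent : Set where
  constructor _/w^_
  field
    numerator : ℚi[w].Carrier
    exponent  : ℕ

infix 4 _≈ᴸ_
_≈ᴸ_ : Rel Laurent 0ℓ
(p /w^ k) ≈ᴸ (q /w^ l) = p * Pw.X ^ l ≈ q * Pw.X ^ k
  where open ℚi[w]

fromℚ[w] : ℚ[w].Carrier → Laurent
fromℚ[w] p = map embed p /w^ 0

D : ℕ → Laurent
D m = Pw.const (embed (½ ^ (m ℕ.^ 2))) * resultant m /w^ (3 ℕ.* m ∸ 2)
  where
  open ℚi[w] using (_*_)
  open DecRawRing ℚ-ring using (_^_)

w²-27/4 : ℚ[w].Carrier
w²-27/4 = Pℚ.X ^ 2 + - Pℚ.const (+ 27 ℚ./ 4)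
  where open ℚ[w]

-- Substituting u = i x and v = i y with x, y running over the m-th roots of unity turns W into
-- 2 x y (w - r), so the iterated resultant is 2 ^ (m ^ 2) ∏ (w - r a b), where r a b is the
-- symmetric function - (sin a + sin b + sin c) of the triple with a + b + c = 0 in ℤ/m.  Rotation
-- of triples has order 3 and preserves r.  Its orbits therefore contribute a cube F ^ 3, apart
-- from the fixed points 3 a = 0, which contribute w and, if 3 ∣ m, the factor w ^ 2 - 27/4; the
-- orbits with a zero entry contribute powers of w.  The roots live in any ℚ(i)-algebra A, not
-- necessarily a domain, with a root of unity ζ satisfying ∑ ζ ^ (d j) = 0 for all d not divisible
-- by m; such an A is obtained from ℚ(i) by adjoining p-th roots for the primes p ∣ m.
-- Complex conjugation fixes the product, so its coefficients are rational, and the coefficients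
-- of a monic F over A such that G F ^ 3 is rational, with G rational and monic, are rational by
-- descending induction, since 3 is invertible.

module Submission where

open import Algebra.Bundles using (CommutativeMonoid; CommutativeRing)
open import Algebra.Bundles.Raw using (RawRing)
open import Algebra.Core using (Op₁; Op₂)
import Algebra.Definitions as AlgDefs
open import Algebra.Morphism.Structures using (IsRingHomomorphism)
import Algebra.Properties.AbelianGroup as AbelianGroupProperties
import Algebra.Properties.CommutativeSemigroup as CommutativeSemigroupProperties
import Algebra.Properties.CommutativeMonoid.Sum as MonoidSum
import Algebra.Properties.CommutativeSemiring.Exp as Exp
import Algebra.Properties.Ring as RingProperties
import Algebra.Properties.Semiring.Mult.TCOptimised as Mult′
import Algebra.Properties.Semiring.Mult as SemiringMult
import Algebra.Properties.Semiring.Sum as SemiringSum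
import Algebra.Solver.Ring as RingSolver
open import Algebra.Solver.Ring.AlmostCommutativeRing using (fromCommutativeRing; _-Raw-AlmostCommutative⟶_)
open import Data.Bool.Base using (true; false; if_then_else_)
open import Data.Fin.Base as Fin using (Fin; zero; suc; toℕ; punchIn; punchOut; splitAt; _↑ˡ_; _↑ʳ_; fromℕ<)
import Data.Fin.Properties as Fin
import Data.Fin.Permutation as Perm
open import Data.List.Base as List using (List; []; _∷_)
open import Data.Maybe.Base as Maybe using (Maybe; just; nothing)
open import Data.Nat.Base as ℕ using (ℕ; zero; suc; z≤n; s≤s; _≤ᵇ_; NonZero)
import Data.Nat.Properties as ℕ
import Data.Nat.Divisibility as ℕ
import Data.Nat.DivMod as ℕ
import Data.Nat.Coprimality as Coprime
open import Data.Nat.Primality using (Prime; prime?; prime⇒nonZero; prime⇒irreducible; euclidsLemma)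
open import Data.Nat.Primality.Factorisation using (PrimeFactorisation; factorise)
import Data.Nat.GCD as GCD
open import Data.Nat.ListAction using (product)
open import Data.List.Relation.Unary.All using (All; []; _∷_)
import Data.Nat.Solver
import Data.Integer.Base as ℤ
open import Data.Product.Base using (Σ-syntax; ∃; _×_; _,_; proj₁; proj₂)
open import Data.Rational.Base as ℚ using (ℚ; 0ℚ; 1ℚ; ½)
import Data.Rational.Properties as ℚ
open import Data.Sum.Base using (_⊎_; inj₁; inj₂)
open import Data.Unit.Base using (⊤)
import Data.Vec.Functional as V
import Data.Vec.Functional.Properties as V
open import Function.Base using (_∘_; _$_; id)
open import Level using (0ℓ)
open import Relation.Binary.Core using (Rel)
open import Relation.Binary.PropositionalEquality as ≡ using (_≡_; _≗_)
open import Relation.Binary.Structures using (IsEquivalence; IsDecEquivalence)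
import Relation.Binary.Reasoning.Setoid as SetoidReasoning
open import Relation.Nullary using (¬_; Dec; yes; no; contradiction)
open import Relation.Nullary.Decidable using (_×-dec_; from-yes)
import Algebra.Morphism.Construct.Composition as Composition
open import Defs using (DecRawRing; module Polynomial; _[X]; Q; W; resultant; Rw; Ru; Rv; module Pw; module Pu; module Pv; module Pℚ; ℚ-ring; ℚ⟨i⟩; _+i_; ℚ⟨i⟩-ring; embed; 𝕚)

-- List polynomials come with operations but no ring laws, so an identity between them is checked by
-- mapping it into a genuine commutative ring, mostly power series over A, and is pulled back at the
-- end through the injectivity of ℚ(i) → A. No equality test is assumed on A; degrees over A are
-- therefore predicates on coefficients. Zero divisors in A are the main obstacle. For monic p with
-- roots α the Sylvester matrix satisfies det Syl · det V = det V · ∏ q(α), V being the Vandermonde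
-- matrix of the roots, and this can be cancelled only if det V is a unit; distinct roots would not
-- be enough. The orthogonality sums of ζ make V invertible: its inverse is, up to the integer m, a
-- discrete Fourier matrix. Conjugation is not realised as an automorphism of A. Instead the
-- resultant is evaluated a second time, with conjugated scalars and with ζ replaced by its inverse,
-- and both evaluations yield the same product. The orbit decomposition is proved in an arbitrary
-- commutative monoid: products of factors give the cube, and sums of ones in ℕ give the degree of
-- its root.

-- Integer coefficients are represented by formal differences of naturals.
module IntegerCoefficientSolver (R : CommutativeRing 0ℓ 0ℓ) where
  open CommutativeRing R
  open RingProperties ring using (x[y-z]≈xy-xz; [y-z]x≈yx-zx)
  open AbelianGroupProperties +-abelianGroup using (⁻¹-∙-comm; ⁻¹-anti-homo‿-; ε⁻¹≈ε)
  open CommutativeSemigroupProperties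
    (CommutativeMonoid.commutativeSemigroup +-commutativeMonoid) using (interchange)
  open Mult′ semiring using (×-homo-+; ×1-homo-*) renaming (_×_ to _·_)
  open SetoidReasoning setoid

  private
    cancel : ℕ → ℕ → ℕ × ℕ
    cancel zero    b       = 0 , b
    cancel (suc a) zero    = suc a , 0
    cancel (suc a) (suc b) = cancel a b

    difference : RawRing 0ℓ 0ℓ
    difference = record
      { Carrier = ℕ × ℕ
      ; _≈_ = λ { (a , b) (c , d) → a ℕ.+ d ≡ c ℕ.+ b }
      ; _+_ = λ { (a , b) (c , d) → cancel (a ℕ.+ c) (b ℕ.+ d) }
      ; _*_ = λ { (a , b) (c , d) → cancel (a ℕ.* c ℕ.+ b ℕ.* d) (a ℕ.* d ℕ.+ b ℕ.* c) }
      ; -_  = λ { (a , b) → b , a }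
      ; 0#  = 0 , 0
      ; 1#  = 1 , 0
      }

    -- The separate case `zero` and the optimised multiples make `con :0` and `con :1` evaluate
    -- definitionally to `0#` and `1#`, so that solved equations match their goals without
    -- conversion.
    ⟦_⟧ : ℕ × ℕ → Carrier
    ⟦ n , zero ⟧  = n · 1#
    ⟦ n , suc k ⟧ = n · 1# - suc k · 1#

    ⟦⟧-def : ∀ a b → ⟦ a , b ⟧ ≈ a · 1# - b · 1#
    ⟦⟧-def a zero    = sym (trans (+-congˡ ε⁻¹≈ε) (+-identityʳ _))
    ⟦⟧-def a (suc b) = refl

    ⟦⟧-equal : ∀ a b c d → a ℕ.+ d ≡ c ℕ.+ b → ⟦ a , b ⟧ ≈ ⟦ c , d ⟧
    ⟦⟧-equal a b c d e = trans (⟦⟧-def a b) (trans diff (sym (⟦⟧-def c d)))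
      where
      A = a · 1# ; B = b · 1# ; C = c · 1# ; D = d · 1#
      A+D≈C+B : A + D ≈ C + B
      A+D≈C+B = trans (sym (×-homo-+ 1# a d)) (trans (reflexive (≡.cong (_· 1#) e)) (×-homo-+ 1# c b))
      diff : A - B ≈ C - D
      diff = begin
        A - B  ≈⟨ +-identityʳ _ ⟨
        A - B + 0#  ≈⟨ +-congˡ (-‿inverseʳ D) ⟨
        (A - B) + (D - D)  ≈⟨ interchange _ _ _ _ ⟩
        (A + D) + (- B - D)  ≈⟨ +-cong A+D≈C+B (+-comm _ _) ⟩
        (C + B) + (- D - B)  ≈⟨ interchange _ _ _ _ ⟩
        (C - D) + (B - B)  ≈⟨ +-congˡ (-‿inverseʳ B) ⟩
        C - D + 0#  ≈⟨ +-identityʳ _ ⟩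
        C - D  ∎

    ⟦⟧-cancel : ∀ a b → ⟦ cancel a b ⟧ ≈ ⟦ a , b ⟧
    ⟦⟧-cancel zero    b       = refl
    ⟦⟧-cancel (suc a) zero    = refl
    ⟦⟧-cancel (suc a) (suc b) = trans (⟦⟧-cancel a b) (⟦⟧-equal a b (suc a) (suc b) (ℕ.+-suc a b))

    -‿interchange : ∀ a b c d → (a + c) - (b + d) ≈ (a - b) + (c - d)
    -‿interchange a b c d = trans (+-congˡ (sym (⁻¹-∙-comm b d))) (interchange a c (- b) (- d))

    ⟦⟧-+ : ∀ x y → ⟦ RawRing._+_ difference x y ⟧ ≈ ⟦ x ⟧ + ⟦ y ⟧
    ⟦⟧-+ (a , b) (c , d) = begin
      ⟦ cancel (a ℕ.+ c) (b ℕ.+ d) ⟧  ≈⟨ ⟦⟧-cancel (a ℕ.+ c) (b ℕ.+ d) ⟩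
      ⟦ a ℕ.+ c , b ℕ.+ d ⟧  ≈⟨ ⟦⟧-def (a ℕ.+ c) (b ℕ.+ d) ⟩
      (a ℕ.+ c) · 1# - (b ℕ.+ d) · 1#  ≈⟨ +-cong (×-homo-+ 1# a c) (-‿cong (×-homo-+ 1# b d)) ⟩
      (a · 1# + c · 1#) - (b · 1# + d · 1#)  ≈⟨ -‿interchange _ _ _ _ ⟩
      (a · 1# - b · 1#) + (c · 1# - d · 1#)  ≈⟨ +-cong (⟦⟧-def a b) (⟦⟧-def c d) ⟨
      ⟦ a , b ⟧ + ⟦ c , d ⟧  ∎

    ⟦⟧-* : ∀ x y → ⟦ RawRing._*_ difference x y ⟧ ≈ ⟦ x ⟧ * ⟦ y ⟧
    ⟦⟧-* (a , b) (c , d) = begin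
      ⟦ cancel (a ℕ.* c ℕ.+ b ℕ.* d) (a ℕ.* d ℕ.+ b ℕ.* c) ⟧
        ≈⟨ ⟦⟧-cancel (a ℕ.* c ℕ.+ b ℕ.* d) (a ℕ.* d ℕ.+ b ℕ.* c) ⟩
      ⟦ a ℕ.* c ℕ.+ b ℕ.* d , a ℕ.* d ℕ.+ b ℕ.* c ⟧  ≈⟨ ⟦⟧-def (a ℕ.* c ℕ.+ b ℕ.* d) (a ℕ.* d ℕ.+ b ℕ.* c) ⟩
      (a ℕ.* c ℕ.+ b ℕ.* d) · 1# - (a ℕ.* d ℕ.+ b ℕ.* c) · 1#
        ≈⟨ +-cong (expand a c b d) (-‿cong (expand a d b c)) ⟩
      (A * C + B * D) - (A * D + B * C)  ≈⟨ -‿interchange _ _ _ _ ⟩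
      (A * C - A * D) + (B * D - B * C)  ≈⟨ +-congˡ (⁻¹-anti-homo‿- _ _) ⟨
      (A * C - A * D) - (B * C - B * D)  ≈⟨ +-cong (x[y-z]≈xy-xz _ _ _) (-‿cong (x[y-z]≈xy-xz _ _ _)) ⟨
      A * (C - D) - B * (C - D)  ≈⟨ [y-z]x≈yx-zx _ _ _ ⟨
      (A - B) * (C - D)  ≈⟨ *-cong (⟦⟧-def a b) (⟦⟧-def c d) ⟨
      ⟦ a , b ⟧ * ⟦ c , d ⟧  ∎
      where
      A = a · 1# ; B = b · 1# ; C = c · 1# ; D = d · 1#
      expand : ∀ a c b d → (a ℕ.* c ℕ.+ b ℕ.* d) · 1# ≈ (a · 1#) * (c · 1#) + (b · 1#) * (d · 1#)
      expand a c b d = trans (×-homo-+ 1# (a ℕ.* c) (b ℕ.* d)) (+-cong (×1-homo-* a c) (×1-homo-* b d))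

    ⟦⟧-neg : ∀ x → ⟦ RawRing.-_ difference x ⟧ ≈ - ⟦ x ⟧
    ⟦⟧-neg (a , b) = begin
      ⟦ b , a ⟧  ≈⟨ ⟦⟧-def b a ⟩
      b · 1# - a · 1#  ≈⟨ ⁻¹-anti-homo‿- _ _ ⟨
      - (a · 1# - b · 1#)  ≈⟨ -‿cong (⟦⟧-def a b) ⟨
      - ⟦ a , b ⟧  ∎

    morphism : difference -Raw-AlmostCommutative⟶ fromCommutativeRing R
    morphism = record
      { ⟦_⟧ = ⟦_⟧ ; +-homo = ⟦⟧-+ ; *-homo = ⟦⟧-* ; -‿homo = ⟦⟧-neg ; 0-homo = refl ; 1-homo = refl }

    ⟦⟧-≟ : ∀ x y → Maybe (⟦ x ⟧ ≈ ⟦ y ⟧)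
    ⟦⟧-≟ (a , b) (c , d) with a ℕ.+ d ℕ.≟ c ℕ.+ b
    ... | no  _ = nothing
    ... | yes e = just (⟦⟧-equal a b c d e)

  open RingSolver difference (fromCommutativeRing R) morphism ⟦⟧-≟ public
    using (solve; _:+_; _:*_; :-_; _:-_; _:=_; con) renaming (Polynomial to Expression)

  :0 :1 : ℕ × ℕ
  :0 = 0 , 0
  :1 = 1 , 0

module Ring (R : CommutativeRing 0ℓ 0ℓ) where
  open CommutativeRing R hiding (zero; ring) public
  open RingProperties (CommutativeRing.ring R) public using (-‿distribˡ-*; -‿distribʳ-*; -1*x≈-x)
  open AbelianGroupProperties +-abelianGroup public
    using () renaming (ε⁻¹≈ε to -0#≈0#; ⁻¹-∙-comm to -‿+-comm; x∙y⁻¹≈ε⇒x≈y to x-y≈0⇒x≈y)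
  open Exp commutativeSemiring public
    using (_^_; ^-congˡ; ^-congʳ; ^-homo-*; ^-assocʳ; ^-distrib-*)
  open SemiringSum semiring public
    using (sum; sum-cong-≋; sum-replicate-zero; *-distribˡ-sum; *-distribʳ-sum; ∑-comm; ∑-distrib-+)
  open SemiringMult semiring public
    using (×-homo-+; ×1-homo-*; ×-assoc-*) renaming (_×_ to _·_)
  open MonoidSum *-commutativeMonoid public using () renaming
    ( sum to prod; sum-cong-≋ to prod-cong; ∑-distrib-+ to prod-distrib-*; ∑-comm to prod-comm; sum-replicate to prod-replicate
    ; sum-replicate-zero to prod-1 )
  module Reasoning = SetoidReasoning setoid
  module Solver = IntegerCoefficientSolver R

  1^n≈1 : ∀ n → 1# ^ n ≈ 1#
  1^n≈1 zero    = refl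
  1^n≈1 (suc n) = trans (*-identityˡ _) (1^n≈1 n)

module _ {A : Set} {_≈_ : Rel A 0ℓ} {_+_ _*_ : Op₂ A} { -_ : Op₁ A} {0# 1# : A} where
  open AlgDefs _≈_

  commutativeRing : IsEquivalence _≈_ →
    Congruent₂ _+_ → Associative _+_ → Commutative _+_ → LeftIdentity 0# _+_ →
    Congruent₁ -_ → LeftInverse 0# -_ _+_ →
    Congruent₂ _*_ → Associative _*_ → Commutative _*_ → LeftIdentity 1# _*_ →
    _*_ DistributesOverʳ _+_ → CommutativeRing 0ℓ 0ℓ
  commutativeRing eq +-cong +-assoc +-comm +-idˡ neg-cong +-invˡ *-cong *-assoc *-comm *-idˡ distʳ = record
    { Carrier = A ; _≈_ = _≈_ ; _+_ = _+_ ; _*_ = _*_ ; -_ = -_ ; 0# = 0# ; 1# = 1#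
    ; isCommutativeRing = record
      { isRing = record
        { +-isAbelianGroup = record
          { isGroup = record
            { isMonoid = record
              { isSemigroup = record
                { isMagma = record { isEquivalence = eq ; ∙-cong = +-cong } ; assoc = +-assoc }
              ; identity = +-idˡ , λ x → trans (+-comm x _) (+-idˡ x) }
            ; inverse = +-invˡ , λ x → trans (+-comm x _) (+-invˡ x)
            ; ⁻¹-cong = neg-cong }
          ; comm = +-comm }
        ; *-cong = *-cong
        ; *-assoc = *-assoc
        ; *-identity = *-idˡ , λ x → trans (*-comm x _) (*-idˡ x)
        ; distrib = (λ x y z → trans (*-comm x _)
                      (trans (distʳ x y z) (+-cong (*-comm y x) (*-comm z x)))) , distʳ }
      ; *-comm = *-comm } }
    where open IsEquivalence eq

module _ {R S : RawRing 0ℓ 0ℓ} where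
  private module R = RawRing R
  private module S = RawRing S

  ringHomomorphism : {f : R.Carrier → S.Carrier} →
    (∀ {x y} → x R.≈ y → f x S.≈ f y) →
    (∀ x y → f (x R.+ y) S.≈ (f x S.+ f y)) → f R.0# S.≈ S.0# →
    (∀ x y → f (x R.* y) S.≈ (f x S.* f y)) → f R.1# S.≈ S.1# →
    (∀ x → f (R.- x) S.≈ (S.- f x)) → IsRingHomomorphism R S f
  ringHomomorphism cong + 0h * 1h neg = record
    { isSemiringHomomorphism = record
      { isNearSemiringHomomorphism = record
        { +-isMonoidHomomorphism = record
          { isMagmaHomomorphism = record
            { isRelHomomorphism = record { cong = cong } ; homo = + }
          ; ε-homo = 0h }
        ; *-homo = * }
      ; 1#-homo = 1h }
    ; -‿homo = neg }

-- Power series and polynomials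

module Series (A : CommutativeRing 0ℓ 0ℓ) where
  private
    module A = Ring A
    open A using (Carrier; _≈_; _+_; _*_; -_; 0#; 1#)
    open A.Solver

  -- Coefficient functions serve for polynomials as well: without an equality test on coefficients
  -- no degree can be computed, so finiteness is a separate property, `Below`.
  Series : Set
  Series = ℕ → Carrier

  infix 4 _≈ₛ_
  _≈ₛ_ : Rel Series 0ℓ
  f ≈ₛ g = ∀ k → f k ≈ g k

  tail : Series → Series
  tail f k = f (suc k)

  constant : Carrier → Series
  constant a zero    = a
  constant a (suc k) = 0#

  var : Series
  var zero          = 0#
  var (suc zero)    = 1#
  var (suc (suc k)) = 0#

  -- The Cauchy product, from writing the first factor as `f 0` plus the variable times `tail f`;
  -- the ring laws then follow by induction on the coefficient index.
  _+ₛ_ _*ₛ_ : Op₂ Series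
  (f +ₛ g) k = f k + g k
  (f *ₛ g) zero    = f 0 * g 0
  (f *ₛ g) (suc k) = f 0 * g (suc k) + (tail f *ₛ g) k

  -ₛ_ : Op₁ Series
  (-ₛ f) k = - f k

  *ₛ-cong : ∀ {f f′ g g′} → f ≈ₛ f′ → g ≈ₛ g′ → (f *ₛ g) ≈ₛ (f′ *ₛ g′)
  *ₛ-cong f≈ g≈ zero    = A.*-cong (f≈ 0) (g≈ 0)
  *ₛ-cong f≈ g≈ (suc k) = A.+-cong (A.*-cong (f≈ 0) (g≈ (suc k))) (*ₛ-cong (f≈ ∘ suc) g≈ k)

  *ₛ-zeroˡ : ∀ {f} g → (∀ k → f k ≈ 0#) → ∀ k → (f *ₛ g) k ≈ 0#
  *ₛ-zeroˡ g f≈0 zero    = A.trans (A.*-congʳ (f≈0 0)) (A.zeroˡ _)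
  *ₛ-zeroˡ g f≈0 (suc k) = A.trans (A.+-cong (A.trans (A.*-congʳ (f≈0 0)) (A.zeroˡ _)) (*ₛ-zeroˡ g (f≈0 ∘ suc) k))
                                   (A.+-identityˡ _)

  private
    *ₛ-sucʳ : ∀ f g k → (f *ₛ g) (suc k) ≈ f (suc k) * g 0 + (f *ₛ tail g) k
    *ₛ-sucʳ f g zero    = A.+-comm _ _
    *ₛ-sucʳ f g (suc k) = A.trans (A.+-congˡ (*ₛ-sucʳ (tail f) g k))
      (solve 3 (λ a b c → a :+ (b :+ c) := b :+ (a :+ c)) A.refl _ _ _)

    *ₛ-comm : ∀ f g → (f *ₛ g) ≈ₛ (g *ₛ f)
    *ₛ-comm f g zero    = A.*-comm _ _
    *ₛ-comm f g (suc k) = A.trans (A.+-cong (A.*-comm _ _) (*ₛ-comm (tail f) g k)) (A.sym (*ₛ-sucʳ g f k))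

    *ₛ-distribʳ : ∀ f g h → ((g +ₛ h) *ₛ f) ≈ₛ ((g *ₛ f) +ₛ (h *ₛ f))
    *ₛ-distribʳ f g h zero    = A.distribʳ _ _ _
    *ₛ-distribʳ f g h (suc k) = A.trans (A.+-cong (A.distribʳ _ _ _) (*ₛ-distribʳ f (tail g) (tail h) k))
      (solve 4 (λ a b c d → (a :+ b) :+ (c :+ d) := (a :+ c) :+ (b :+ d)) A.refl _ _ _ _)

    *ₛ-scale : ∀ a f g k → ((λ j → a * f j) *ₛ g) k ≈ a * (f *ₛ g) k
    *ₛ-scale a f g zero    = A.*-assoc _ _ _
    *ₛ-scale a f g (suc k) = A.trans (A.+-cong (A.*-assoc _ _ _) (*ₛ-scale a (tail f) g k)) (A.sym (A.distribˡ _ _ _))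

    *ₛ-assoc : ∀ f g h → ((f *ₛ g) *ₛ h) ≈ₛ (f *ₛ (g *ₛ h))
    *ₛ-assoc f g h zero    = A.*-assoc _ _ _
    *ₛ-assoc f g h (suc k) = begin
      (f 0 * g 0) * h (suc k) + (tail (f *ₛ g) *ₛ h) k
        ≈⟨ A.+-congˡ (*ₛ-distribʳ h (λ j → f 0 * g (suc j)) (tail f *ₛ g) k) ⟩
      (f 0 * g 0) * h (suc k) + (((λ j → f 0 * g (suc j)) *ₛ h) k + ((tail f *ₛ g) *ₛ h) k)
        ≈⟨ A.+-congˡ (A.+-cong (*ₛ-scale (f 0) (tail g) h k) (*ₛ-assoc (tail f) g h k)) ⟩
      (f 0 * g 0) * h (suc k) + (f 0 * (tail g *ₛ h) k + (tail f *ₛ (g *ₛ h)) k)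
        ≈⟨ solve 5 (λ a b c d e → (a :* b) :* c :+ (a :* d :+ e)
                            := a :* (b :* c :+ d) :+ e) A.refl _ _ _ _ _ ⟩
      f 0 * (g 0 * h (suc k) + (tail g *ₛ h) k) + (tail f *ₛ (g *ₛ h)) k ∎
      where open A.Reasoning

  constant-* : ∀ a f k → (constant a *ₛ f) k ≈ a * f k
  constant-* a f zero    = A.refl
  constant-* a f (suc k) = A.trans (A.+-congˡ (*ₛ-zeroˡ f (λ _ → A.refl) k)) (A.+-identityʳ _)

  var-*-suc : ∀ f k → (var *ₛ f) (suc k) ≈ f k
  var-*-suc f k = A.trans (A.+-cong (A.zeroˡ _) (*ₛ-cong {g = f} tail-var (λ _ → A.refl) k))
    (A.trans (A.+-identityˡ _) (A.trans (constant-* 1# f k) (A.*-identityˡ _)))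
    where
    tail-var : tail var ≈ₛ constant 1#
    tail-var zero    = A.refl
    tail-var (suc j) = A.refl

  ring : CommutativeRing 0ℓ 0ℓ
  ring = commutativeRing
    {_≈_ = _≈ₛ_} {_+ₛ_} {_*ₛ_} { -ₛ_} {λ _ → 0#} {constant 1#}
    (record { refl = λ _ → A.refl ; sym = λ e k → A.sym (e k) ; trans = λ e f k → A.trans (e k) (f k) })
    (λ e f k → A.+-cong (e k) (f k)) (λ f g h k → A.+-assoc _ _ _) (λ f g k → A.+-comm _ _)
    (λ f k → A.+-identityˡ _) (λ e k → A.-‿cong (e k)) (λ f k → A.-‿inverseˡ _)
    *ₛ-cong *ₛ-assoc *ₛ-comm (λ f k → A.trans (constant-* 1# f k) (A.*-identityˡ _)) *ₛ-distribʳ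

  constant-hom : IsRingHomomorphism (CommutativeRing.rawRing A) (CommutativeRing.rawRing ring) constant
  constant-hom = ringHomomorphism
    (λ { e zero → e ; e (suc k) → A.refl })
    (λ { a b zero → A.refl ; a b (suc k) → A.sym (A.+-identityˡ _) })
    (λ { zero → A.refl ; (suc k) → A.refl })
    (λ a b → λ { zero → A.refl ; (suc k) → A.sym (A.trans (constant-* a (constant b) (suc k)) (A.zeroʳ _)) })
    (λ _ → A.refl)
    (λ { a zero → A.refl ; a (suc k) → A.sym A.-0#≈0# })

  module S = Ring ring

  Below : ℕ → Series → Set
  Below n f = ∀ k → n ℕ.≤ k → f k ≈ 0#

  Below-≤ : ∀ {m n f} → m ℕ.≤ n → Below m f → Below n f
  Below-≤ m≤n b k n≤k = b k (ℕ.≤-trans m≤n n≤k)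

  Below-cong : ∀ {n f g} → f ≈ₛ g → Below n f → Below n g
  Below-cong e b k n≤k = A.trans (A.sym (e k)) (b k n≤k)

  Below-+ : ∀ {n f g} → Below n f → Below n g → Below n (f +ₛ g)
  Below-+ b c k n≤k = A.trans (A.+-cong (b k n≤k) (c k n≤k)) (A.+-identityˡ _)

  Below-neg : ∀ {n f} → Below n f → Below n (-ₛ f)
  Below-neg b k n≤k = A.trans (A.-‿cong (b k n≤k)) A.-0#≈0#

  Below-constant : ∀ a → Below 1 (constant a)
  Below-constant a (suc k) _ = A.refl

  -- The bounds are strict, so the degrees are at most m and less than n. Induction on m: a first
  -- factor below 1 is a constant, and otherwise its tail has a smaller bound.
  Below-* : ∀ {m n f g} → Below (suc m) f → Below n g → Below (m ℕ.+ n) (f *ₛ g)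
  Below-* {zero} {f = f} {g} b c k n≤k =
    A.trans (*ₛ-cong {g = g} {g} f-constant (λ _ → A.refl) k)
      (A.trans (constant-* (f 0) g k) (A.trans (A.*-congˡ (c k n≤k)) (A.zeroʳ _)))
    where
    f-constant : f ≈ₛ constant (f 0)
    f-constant zero    = A.refl
    f-constant (suc j) = b (suc j) (s≤s z≤n)
  Below-* {suc m} {f = f} b c (suc k) (s≤s le) =
    A.trans (A.+-cong (A.trans (A.*-congˡ (c (suc k) (ℕ.m≤n⇒m≤1+n (ℕ.≤-trans (ℕ.m≤n+m _ m) le)))) (A.zeroʳ _))
                      (Below-* {m} {f = tail f} (λ j le → b (suc j) (s≤s le)) c k le))
      (A.+-identityˡ _)

  top-* : ∀ {m n f g} → Below (suc m) f → Below (suc n) g → (f *ₛ g) (m ℕ.+ n) ≈ f m * g n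
  top-* {zero} {n} {f} {g} b c =
    A.trans (*ₛ-cong {g = g} {g} f-constant (λ _ → A.refl) n) (constant-* (f 0) g n)
    where
    f-constant : f ≈ₛ constant (f 0)
    f-constant zero    = A.refl
    f-constant (suc j) = b (suc j) (s≤s z≤n)
  top-* {suc m} {n} {f} b c =
    A.trans (A.+-cong (A.trans (A.*-congˡ (c (suc (m ℕ.+ n)) (s≤s (ℕ.m≤n+m n m)))) (A.zeroʳ _))
                      (top-* {m} {f = tail f} (λ j le → b (suc j) (s≤s le)) c))
      (A.+-identityˡ _)

  Monic : ℕ → Series → Set
  Monic n f = f n ≈ 1# × Below (suc n) f

  Monic-cong : ∀ {n f g} → f ≈ₛ g → Monic n f → Monic n g
  Monic-cong {n} e (t , b) = A.trans (A.sym (e n)) t , Below-cong e b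

  Monic-1 : Monic 0 (constant 1#)
  Monic-1 = A.refl , Below-constant 1#

  Monic-var : Monic 1 var
  Monic-var = A.refl , λ { (suc zero) (s≤s ()) ; (suc (suc k)) _ → A.refl }

  Monic-* : ∀ {m n f g} → Monic m f → Monic n g → Monic (m ℕ.+ n) (f *ₛ g)
  Monic-* {m} {n} {f} {g} (t , b) (u , c) =
    A.trans (top-* b c) (A.trans (A.*-cong t u) (A.*-identityˡ _)) ,
    λ k le → Below-* b c k (ℕ.≤-trans (ℕ.≤-reflexive (ℕ.+-suc m n)) le)

  Monic-+ : ∀ {n f g} → Monic n f → Below n g → Monic n (f +ₛ g)
  Monic-+ {n} (t , b) c = A.trans (A.+-cong t (c n ℕ.≤-refl)) (A.+-identityʳ _) ,
                          Below-+ b (Below-≤ (ℕ.n≤1+n n) c)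

  Monic-^ : ∀ {n f} k → Monic n f → Monic (k ℕ.* n) (f S.^ k)
  Monic-^ zero    m = Monic-1
  Monic-^ (suc k) m = Monic-* m (Monic-^ k m)

  Monic-var^ : ∀ k → Monic k (var S.^ k)
  Monic-var^ k = ≡.subst (λ n → Monic n (var S.^ k)) (ℕ.*-identityʳ k) (Monic-^ k Monic-var)

  -- The degree stays a sum over the same index set as the product, which lets the degree of the
  -- orbit product be `orbit-count` by construction.
  Monic-prod : ∀ {n} {d : Fin n → ℕ} {f : Fin n → Series} → (∀ i → Monic (d i) (f i)) →
    Monic (MonoidSum.sum ℕ.+-0-commutativeMonoid d) (S.prod f)
  Monic-prod {zero}  m = Monic-1
  Monic-prod {suc n} m = Monic-* (m zero) (Monic-prod (m ∘ suc))

module AdjoinRoot (A : CommutativeRing 0ℓ 0ℓ) where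
  private
    module A = Ring A
  open Series A using (Series; constant; var; Below; Below-≤; Below-+; Below-neg; Below-*; Below-constant; top-*; Monic; Monic-var;
    module S; constant-hom; _≈ₛ_)
  open S.Solver

  Polynomials : Set
  Polynomials = Σ[ f ∈ Series ] Σ[ n ∈ ℕ ] Below n f

  infixl 6 _⊞_
  infixl 7 _⊠_
  _⊞_ _⊠_ : Op₂ Polynomials
  (f , m , b) ⊞ (g , n , c) = f S.+ g , m ℕ.+ n ,
    Below-+ (Below-≤ (ℕ.m≤m+n m n) b) (Below-≤ (ℕ.m≤n+m n m) c)
  (f , m , b) ⊠ (g , n , c) = f S.* g , m ℕ.+ n , Below-* (Below-≤ (ℕ.n≤1+n m) b) c

  ⊟_ : Op₁ Polynomials
  ⊟ (f , m , b) = S.- f , m , Below-neg b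

  constantₚ : A.Carrier → Polynomials
  constantₚ a = constant a , 1 , Below-constant a

  varₚ : Polynomials
  varₚ = var , 2 , proj₂ Monic-var

  0ₚ : Polynomials
  0ₚ = S.0# , 0 , λ _ _ → A.refl

  module Modulo (P : Polynomials) where
    infix 4 _≡ₚ_
    -- The quotient has to be a polynomial. In the ring of power series a modulus with invertible
    -- constant term, such as 1 + x + ... + x^(p-1), is a unit, and all elements would be congruent.
    record _≡ₚ_ (f g : Polynomials) : Set where
      constructor multiple
      field
        quotient : Polynomials
        equation : proj₁ f S.≈ proj₁ g S.+ proj₁ quotient S.* proj₁ P

    ≈⇒≡ₚ : ∀ {f g} → proj₁ f S.≈ proj₁ g → f ≡ₚ g
    ≈⇒≡ₚ e = multiple 0ₚ (S.trans e (S.sym (S.trans (S.+-congˡ (S.zeroˡ (proj₁ P))) (S.+-identityʳ _))))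

    ring : CommutativeRing 0ℓ 0ℓ
    ring = commutativeRing {_≈_ = _≡ₚ_} {_⊞_} {_⊠_} {⊟_} {0ₚ} {constantₚ A.1#}
      (record
        { refl = λ {f} → ≈⇒≡ₚ S.refl
        ; sym = λ { {f , _} {g , _} (multiple h e) → multiple (⊟ h) $ S.trans
            (solve 2 (λ g x → g := (g :+ x) :+ :- x) S.refl g (proj₁ h S.* proj₁ P))
            (S.+-cong (S.sym e) (S.-‿distribˡ-* (proj₁ h) (proj₁ P))) }
        ; trans = λ { {f , _} {g , _} {k , _} (multiple h e) (multiple h′ e′) → multiple (h′ ⊞ h) $ S.trans e
            (S.trans (S.+-congʳ e′)
            (solve 4 (λ k h h′ p → (k :+ h′ :* p) :+ h :* p := k :+ (h′ :+ h) :* p) S.refl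
               k (proj₁ h) (proj₁ h′) (proj₁ P))) } })
      (λ { {f , _} {f′ , _} {g , _} {g′ , _} (multiple h e) (multiple k e′) → multiple (h ⊞ k) $ S.trans (S.+-cong e e′)
            (solve 5 (λ f g h k p → (f :+ h :* p) :+ (g :+ k :* p) := (f :+ g) :+ (h :+ k) :* p) S.refl
               f′ g′ (proj₁ h) (proj₁ k) (proj₁ P)) })
      (λ f g h → ≈⇒≡ₚ (S.+-assoc (proj₁ f) (proj₁ g) (proj₁ h)))
      (λ f g → ≈⇒≡ₚ (S.+-comm (proj₁ f) (proj₁ g)))
      (λ f → ≈⇒≡ₚ (S.+-identityˡ (proj₁ f)))
      (λ { {f , _} {g , _} (multiple h e) → multiple (⊟ h) $ S.trans (S.-‿cong e)
            (solve 3 (λ g h p → :- (g :+ h :* p) := :- g :+ (:- h) :* p) S.refl g (proj₁ h) (proj₁ P)) })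
      (λ f → ≈⇒≡ₚ (S.-‿inverseˡ (proj₁ f)))
      (λ { {f} {f′} {g} {g′} (multiple h e) (multiple k e′) → multiple (f′ ⊠ k ⊞ h ⊠ g) $ S.trans (S.*-cong e S.refl) (S.trans
            (solve 4 (λ f g h p → (f :+ h :* p) :* g := f :* g :+ h :* g :* p) S.refl (proj₁ f′) (proj₁ g) (proj₁ h) (proj₁ P))
            (S.trans (S.+-congʳ (S.*-congˡ e′))
            (solve 5 (λ f g′ k p hg → f :* (g′ :+ k :* p) :+ hg :* p := f :* g′ :+ (f :* k :+ hg) :* p) S.refl
               (proj₁ f′) (proj₁ g′) (proj₁ k) (proj₁ P) (proj₁ h S.* proj₁ g)))) })
      (λ f g h → ≈⇒≡ₚ (S.*-assoc (proj₁ f) (proj₁ g) (proj₁ h)))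
      (λ f g → ≈⇒≡ₚ (S.*-comm (proj₁ f) (proj₁ g)))
      (λ f → ≈⇒≡ₚ (S.*-identityˡ (proj₁ f)))
      (λ h f g → ≈⇒≡ₚ (S.distribʳ (proj₁ h) (proj₁ f) (proj₁ g)))

    P≡0 : P ≡ₚ 0ₚ
    P≡0 = multiple (constantₚ A.1#) (S.sym (S.trans (S.+-identityˡ _) (S.*-identityˡ (proj₁ P))))

    constantₚ-hom : IsRingHomomorphism A.rawRing (CommutativeRing.rawRing ring) constantₚ
    constantₚ-hom = ringHomomorphism
      (λ {a} {b} e → ≈⇒≡ₚ (C.⟦⟧-cong e))
      (λ a b → ≈⇒≡ₚ (C.+-homo a b))
      (≈⇒≡ₚ C.0#-homo)
      (λ a b → ≈⇒≡ₚ (C.*-homo a b))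
      (≈⇒≡ₚ S.refl)
      (λ a → ≈⇒≡ₚ (C.-‿homo a))
      where module C = IsRingHomomorphism constant-hom

    -- A nonzero multiple of a monic polynomial has at least its degree.
    constantₚ-injective : ∀ {n} → Monic (suc n) (proj₁ P) → ∀ {a b} → constantₚ a ≡ₚ constantₚ b → a A.≈ b
    constantₚ-injective {n} (top , below) {a} {b} (multiple (h , N , h-below) e) =
      A.trans (e 0) (A.trans (A.+-congˡ (A.trans (A.*-congʳ (h≈0 N 0 (ℕ.≤-reflexive (≡.sym (ℕ.+-identityʳ N)))))
          (A.zeroˡ _))) (A.+-identityʳ b))
      where
      open A.Reasoning
      -- Descending induction on `k`, with `j` bounding its distance from the bound `N` of the
      -- quotient. Once `h` vanishes above `k`, its coefficient at `k` is the one of the product at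
      -- `k + suc n`, a positive degree, where both constants are zero.
      h≈0 : ∀ j k → N ℕ.≤ j ℕ.+ k → h k A.≈ A.0#
      h≈0 zero    k le = h-below k le
      h≈0 (suc j) k le = begin
        h k  ≈⟨ A.*-identityʳ _ ⟨
        h k A.* A.1#  ≈⟨ A.*-congˡ top ⟨
        h k A.* proj₁ P (suc n)  ≈⟨ top-* {k} {suc n} h-below-k below ⟨
        (h S.* proj₁ P) (k ℕ.+ suc n)  ≈⟨ A.reflexive (≡.cong (h S.* proj₁ P) (ℕ.+-suc k n)) ⟩
        (h S.* proj₁ P) (suc (k ℕ.+ n))  ≈⟨ A.+-identityˡ _ ⟨
        A.0# A.+ (h S.* proj₁ P) (suc (k ℕ.+ n)) ≈⟨ e (suc (k ℕ.+ n)) ⟨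
        A.0#  ∎
        where
        h-below-k : Below (suc k) h
        h-below-k i k<i = h≈0 j i (ℕ.≤-trans le (ℕ.≤-trans (ℕ.≤-reflexive (≡.sym (ℕ.+-suc j k))) (ℕ.+-monoʳ-≤ j k<i)))

-- Gaussian rationals, ring homomorphisms and invertible integers

module Gaussian where
  private
    module ℚ-ring = Ring ℚ.+-*-commutativeRing
    open ℚ-ring.Solver
    open DecRawRing ℚ⟨i⟩-ring

  ring : CommutativeRing 0ℓ 0ℓ
  ring = commutativeRing {_≈_ = _≡_} {_+_} {_*_} { -_} {0#} {1#} ≡.isEquivalence
    (≡.cong₂ _+_) (λ (a +i b) (c +i d) (e +i f) → ≡.cong₂ _+i_ (ℚ.+-assoc a c e) (ℚ.+-assoc b d f))
    (λ (a +i b) (c +i d) → ≡.cong₂ _+i_ (ℚ.+-comm a c) (ℚ.+-comm b d))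
    (λ (a +i b) → ≡.cong₂ _+i_ (ℚ.+-identityˡ a) (ℚ.+-identityˡ b))
    (≡.cong -_) (λ (a +i b) → ≡.cong₂ _+i_ (ℚ.+-inverseˡ a) (ℚ.+-inverseˡ b))
    (≡.cong₂ _*_)
    (λ (a +i b) (c +i d) (e +i f) → ≡.cong₂ _+i_
      (solve 6 (λ a b c d e f → (a :* c :- b :* d) :* e :- (a :* d :+ b :* c) :* f
         := a :* (c :* e :- d :* f) :- b :* (c :* f :+ d :* e)) ≡.refl a b c d e f)
      (solve 6 (λ a b c d e f → (a :* c :- b :* d) :* f :+ (a :* d :+ b :* c) :* e
         := a :* (c :* f :+ d :* e) :+ b :* (c :* e :- d :* f)) ≡.refl a b c d e f))
    (λ (a +i b) (c +i d) → ≡.cong₂ _+i_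
      (solve 4 (λ a b c d → a :* c :- b :* d := c :* a :- d :* b) ≡.refl a b c d)
      (solve 4 (λ a b c d → a :* d :+ b :* c := c :* b :+ d :* a) ≡.refl a b c d))
    (λ (a +i b) → ≡.cong₂ _+i_
      (solve 2 (λ a b → con :1 :* a :- con :0 :* b := a) ≡.refl a b)
      (solve 2 (λ a b → con :1 :* b :+ con :0 :* a := b) ≡.refl a b))
    (λ (a +i b) (c +i d) (e +i f) → ≡.cong₂ _+i_
      (solve 6 (λ a b c d e f → (c :+ e) :* a :- (d :+ f) :* b := (c :* a :- d :* b) :+ (e :* a :- f :* b)) ≡.refl a b c d e f)
      (solve 6 (λ a b c d e f → (c :+ e) :* b :+ (d :+ f) :* a := (c :* b :+ d :* a) :+ (e :* b :+ f :* a)) ≡.refl a b c d e f))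

  rawRing-ℚ : RawRing 0ℓ 0ℓ
  rawRing-ℚ = DecRawRing.rawRing ℚ-ring

  embed-hom : IsRingHomomorphism rawRing-ℚ rawRing embed
  embed-hom = ringHomomorphism (≡.cong embed) (λ _ _ → ≡.refl) ≡.refl
    (λ a b → ≡.cong₂ _+i_
      (solve 2 (λ a b → a :* b := a :* b :- con :0 :* con :0) ≡.refl a b)
      (solve 2 (λ a b → con :0 := a :* con :0 :+ con :0 :* b) ≡.refl a b))
    ≡.refl (λ _ → ≡.refl)

  conjugate : ℚ⟨i⟩ → ℚ⟨i⟩
  conjugate (a +i b) = a +i (ℚ.- b)

  conjugate-hom : IsRingHomomorphism rawRing rawRing conjugate
  conjugate-hom = ringHomomorphism (≡.cong conjugate)
    (λ (a +i b) (c +i d) → ≡.cong₂ _+i_ ≡.refl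
      (solve 2 (λ b d → :- (b :+ d) := (:- b) :+ (:- d)) ≡.refl b d)) ≡.refl
    (λ (a +i b) (c +i d) → ≡.cong₂ _+i_
      (solve 4 (λ a b c d → a :* c :- b :* d := a :* c :- (:- b) :* (:- d)) ≡.refl a b c d)
      (solve 4 (λ a b c d → :- (a :* d :+ b :* c) := a :* (:- d) :+ (:- b) :* c) ≡.refl a b c d))
    ≡.refl (λ _ → ≡.refl)

  conjugate-fixed : ∀ z → conjugate z ≡ z → z ≡ embed (ℚ⟨i⟩.re z)
  conjugate-fixed (a +i b) e = ≡.cong (a +i_) (≡.trans b≡½[b+b] (≡.trans (≡.cong (½ ℚ.*_) b+b≡0) (ℚ.*-zeroʳ ½)))
    where
    b+b≡0 : b ℚ.+ b ≡ 0ℚ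
    b+b≡0 = ≡.trans (≡.cong (ℚ._+ b) (≡.sym (≡.cong ℚ⟨i⟩.im e))) (ℚ.+-inverseˡ b)
    b≡½[b+b] : b ≡ ½ ℚ.* (b ℚ.+ b)
    b≡½[b+b] = ≡.trans (≡.sym (ℚ.*-identityˡ b)) (solve 2 (λ h b → (h :+ h) :* b := h :* (b :+ b)) ≡.refl ½ b)

module Homomorphism (R : RawRing 0ℓ 0ℓ) (S : CommutativeRing 0ℓ 0ℓ) (f : RawRing.Carrier R → CommutativeRing.Carrier S)
  (f-hom : IsRingHomomorphism R (CommutativeRing.rawRing S) f) where
  private
    module S = Ring S
    open import Algebra.Definitions.RawSemiring (RawRing.rawSemiring R) using (_^_; sum) renaming (_×_ to _·_)
  open IsRingHomomorphism f-hom

  ^-homo : ∀ x n → f (x ^ n) S.≈ f x S.^ n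
  ^-homo x zero    = 1#-homo
  ^-homo x (suc n) = S.trans (*-homo x _) (S.*-congˡ (^-homo x n))

  ×-homo : ∀ n x → f (n · x) S.≈ n S.· f x
  ×-homo zero    x = 0#-homo
  ×-homo (suc n) x = S.trans (+-homo x _) (S.+-congˡ (×-homo n x))

  sum-homo : ∀ {n} (t : Fin n → RawRing.Carrier R) → f (sum t) S.≈ S.sum (f ∘ t)
  sum-homo {zero}  t = 0#-homo
  sum-homo {suc n} t = S.trans (+-homo _ _) (S.+-congˡ (sum-homo (t ∘ suc)))

module ScalarInverse (R : CommutativeRing 0ℓ 0ℓ) (ι : ℚ⟨i⟩ → CommutativeRing.Carrier R)
  (ι-hom : IsRingHomomorphism (DecRawRing.rawRing ℚ⟨i⟩-ring) (CommutativeRing.rawRing R) ι) where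
  open Ring R
  private
    κ : ℚ → Carrier
    κ = ι ∘ embed
    κ-hom : IsRingHomomorphism Gaussian.rawRing-ℚ rawRing κ
    κ-hom = Composition.isRingHomomorphism trans Gaussian.embed-hom ι-hom
    module κ where
      open IsRingHomomorphism κ-hom public
      open Homomorphism _ R κ κ-hom public
    open import Algebra.Definitions.RawSemiring (RawRing.rawSemiring Gaussian.rawRing-ℚ) using () renaming (_×_ to _·ℚ_)

    positive : ∀ n → ℚ.Positive (suc n ·ℚ 1ℚ)
    positive zero    = _
    positive (suc n) = ℚ.pos+pos⇒pos 1ℚ (suc n ·ℚ 1ℚ) {{positive n}}

  -- A positive multiple of `1ℚ` is invertible in ℚ, and its inverse is transported along ℚ → ℚ(i) →
  -- R.
  inverse : ∀ n → .{{NonZero n}} → ∃ λ r → r * (n · 1#) ≈ 1#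
  inverse (suc n) = κ q , (begin
    κ q * (suc n · 1#)  ≈⟨ *-congˡ (+-cong κ.1#-homo (trans (κ.×-homo n 1ℚ) (·-cong n κ.1#-homo))) ⟨
    κ q * (κ 1ℚ + κ (n ·ℚ 1ℚ))  ≈⟨ *-congˡ (κ.+-homo _ _) ⟨
    κ q * κ (suc n ·ℚ 1ℚ)  ≈⟨ κ.*-homo _ _ ⟨
    κ (q ℚ.* (suc n ·ℚ 1ℚ))  ≈⟨ κ.⟦⟧-cong (ℚ.*-inverseˡ (suc n ·ℚ 1ℚ) {{nz}}) ⟩
    κ 1ℚ  ≈⟨ κ.1#-homo ⟩
    1#  ∎)
    where
    open Reasoning
    nz : ℚ.NonZero (suc n ·ℚ 1ℚ)
    nz = ℚ.pos⇒nonZero (suc n ·ℚ 1ℚ) {{positive n}}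
    q : ℚ
    q = (ℚ.1/ (suc n ·ℚ 1ℚ)) {{nz}}
    ·-cong : ∀ n {x y} → x ≈ y → n · x ≈ n · y
    ·-cong zero    e = refl
    ·-cong (suc n) e = +-cong e (·-cong n e)

  -- Takes the place of cancellation in a domain: integers can be cancelled in every ℚ(i)-algebra.
  regular : ∀ n → .{{NonZero n}} → ∀ {x} → n · x ≈ 0# → x ≈ 0#
  regular n {x} n·x≈0 = let r , r-inv = inverse n in begin
    x  ≈⟨ *-identityˡ x ⟨
    1# * x  ≈⟨ *-congʳ r-inv ⟨
    (r * (n · 1#)) * x  ≈⟨ *-assoc _ _ _ ⟩
    r * ((n · 1#) * x)  ≈⟨ *-congˡ (×-assoc-* n 1# x) ⟩
    r * (n · (1# * x))  ≈⟨ *-congˡ (×-congʳ n (*-identityˡ x)) ⟩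
    r * (n · x)  ≈⟨ *-congˡ n·x≈0 ⟩
    r * 0#  ≈⟨ zeroʳ r ⟩
    0#  ∎
    where
    open Reasoning
    open SemiringMult semiring using (×-congʳ)

-- Principal roots of unity

module Geometric (R : CommutativeRing 0ℓ 0ℓ) where
  open Ring R
  open Reasoning
  open Solver

  geometric : Carrier → ℕ → Carrier
  geometric x n = sum {n} (λ j → x ^ toℕ j)

  geometric-cong : ∀ {x y} n → x ≈ y → geometric x n ≈ geometric y n
  geometric-cong n x≈y = sum-cong-≋ {n} (λ j → ^-congˡ (toℕ j) x≈y)

  geometric-first : ∀ x n → geometric x (suc n) ≈ 1# + x * geometric x n
  geometric-first x n = +-congˡ (sym (*-distribˡ-sum x (λ (j : Fin n) → x ^ toℕ j)))

  geometric-last : ∀ x n → geometric x (suc n) ≈ geometric x n + x ^ n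
  geometric-last x zero    = +-comm _ _
  geometric-last x (suc n) = begin
    geometric x (suc (suc n))  ≈⟨ geometric-first x (suc n) ⟩
    1# + x * geometric x (suc n)  ≈⟨ +-congˡ (*-congˡ (geometric-last x n)) ⟩
    1# + x * (geometric x n + x ^ n)  ≈⟨ solve 4 (λ u x g y → u :+ x :* (g :+ y) := (u :+ x :* g) :+ x :* y) refl 1# x _ _ ⟩
    (1# + x * geometric x n) + x ^ suc n ≈⟨ +-congʳ (geometric-first x n) ⟨
    geometric x (suc n) + x ^ suc n  ∎

  geometric-telescope : ∀ x n → 1# + x * geometric x n ≈ geometric x n + x ^ n
  geometric-telescope x n = trans (sym (geometric-first x n)) (geometric-last x n)

  geometric-fixed : ∀ x n → x ^ n ≈ 1# → x * geometric x n ≈ geometric x n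
  geometric-fixed x n x^n≈1 = begin
    x * geometric x n  ≈⟨ solve 2 (λ u t → t := (u :+ t) :- u) refl 1# _ ⟩
    (1# + x * geometric x n) - 1#  ≈⟨ +-congʳ (geometric-telescope x n) ⟩
    (geometric x n + x ^ n) - 1#  ≈⟨ +-congʳ (+-congˡ x^n≈1) ⟩
    (geometric x n + 1#) - 1#  ≈⟨ solve 2 (λ u t → (t :+ u) :- u := t) refl 1# _ ⟩
    geometric x n  ∎

  ^-fixed : ∀ {x t} → x * t ≈ t → ∀ n → x ^ n * t ≈ t
  ^-fixed e zero    = *-identityˡ _
  ^-fixed e (suc n) = trans (*-assoc _ _ _) (trans (*-congˡ (^-fixed e n)) e)

  -- Summing x ^ j * t = t over j < n gives n t = 0.
  fixed⇒≈0 : ∀ n → (∀ {t} → n · t ≈ 0# → t ≈ 0#) → ∀ {x t} → x * t ≈ t → geometric x n ≈ 0# → t ≈ 0#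
  fixed⇒≈0 n regular {x} {t} fixed geometric≈0 = regular (begin
    n · t  ≈⟨ SemiringSum.sum-replicate semiring n ⟨
    sum {n} (λ _ → t)  ≈⟨ sum-cong-≋ {n} (λ j → ^-fixed fixed (toℕ j)) ⟨
    sum {n} (λ j → x ^ toℕ j * t)  ≈⟨ *-distribʳ-sum t (λ (j : Fin n) → x ^ toℕ j) ⟨
    geometric x n * t  ≈⟨ *-congʳ geometric≈0 ⟩
    0# * t  ≈⟨ zeroˡ t ⟩
    0#  ∎)

  -- In a domain, orthogonality would follow from ζ having exact order n. With zero divisors it has
  -- to be demanded, because Fourier inversion rests on these sums.
  record Principal (n : ℕ) (ζ : Carrier) : Set where
    field
      root       : ζ ^ n ≈ 1#
      orthogonal : ∀ d → ¬ (n ℕ.∣ d) → geometric (ζ ^ d) n ≈ 0#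

  swap-exponents : ∀ x m n → (x ^ m) ^ n ≈ (x ^ n) ^ m
  swap-exponents x m n = trans (^-assocʳ x m n) (trans (^-congʳ x (ℕ.*-comm m n)) (sym (^-assocʳ x n m)))

  ^∣≈1 : ∀ {x n} → x ^ n ≈ 1# → ∀ {d} → n ℕ.∣ d → x ^ d ≈ 1#
  ^∣≈1 {x} {n} x^n≈1 (ℕ.divides q ≡.refl) =
    trans (^-congʳ x (ℕ.*-comm q n)) (trans (sym (^-assocʳ x n q)) (trans (^-congˡ q x^n≈1) (1^n≈1 q)))

  -- As ζ^(n+1) = 1, the power ζ^n is the inverse of ζ. Orthogonality carries over since n + 1
  -- divides d + n d, so that dividing n d forces dividing d.
  Principal-^ : ∀ {n ζ} → Principal (suc n) ζ → Principal (suc n) (ζ ^ n)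
  Principal-^ {n} {ζ} p = record
    { root = trans (swap-exponents ζ n (suc n)) (trans (^-congˡ n (Principal.root p)) (1^n≈1 n))
    ; orthogonal = λ d ∤d → trans (geometric-cong (suc n) (^-assocʳ ζ n d))
        (Principal.orthogonal p (n ℕ.* d) (λ ∣nd → ∤d (ℕ.∣m+n∣m⇒∣n
          (≡.subst (suc n ℕ.∣_) (ℕ.+-comm d (n ℕ.* d)) (ℕ.m∣m*n d)) ∣nd))) }

module GeometricHomomorphism (A B : CommutativeRing 0ℓ 0ℓ) (f : CommutativeRing.Carrier A → CommutativeRing.Carrier B)
  (f-hom : IsRingHomomorphism (CommutativeRing.rawRing A) (CommutativeRing.rawRing B) f) where
  private
    module A = Ring A
    module B = Ring B
    module GA = Geometric A
    module GB = Geometric B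
  open IsRingHomomorphism f-hom
  open Homomorphism A.rawRing B f f-hom

  geometric-homo : ∀ x n → f (GA.geometric x n) B.≈ GB.geometric (f x) n
  geometric-homo x n = B.trans (sum-homo {n} _) (B.sum-cong-≋ {n} (λ j → ^-homo x (toℕ j)))

  geometric≈0 : ∀ {x} n → GA.geometric x n A.≈ A.0# → GB.geometric (f x) n B.≈ B.0#
  geometric≈0 n e = B.trans (B.sym (geometric-homo _ n)) (B.trans (⟦⟧-cong e) 0#-homo)

  ^≈1 : ∀ {x} n → x A.^ n A.≈ A.1# → f x B.^ n B.≈ B.1#
  ^≈1 n e = B.trans (B.sym (^-homo _ n)) (B.trans (⟦⟧-cong e) 1#-homo)

  Principal-homo : ∀ {n ζ} → GA.Principal n ζ → GB.Principal n (f ζ)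
  Principal-homo {n} p = record
    { root = ^≈1 n (GA.Principal.root p)
    ; orthogonal = λ d ∤d → B.trans (GB.geometric-cong n (B.sym (^-homo _ d))) (geometric≈0 n (GA.Principal.orthogonal p d ∤d)) }

-- Adjoining roots and constructing the cyclotomic algebra

module RootExtensions (A : CommutativeRing 0ℓ 0ℓ) where
  private
    module A = Ring A
  open Series A using (var; constant; module S; Monic; Below; Below-≤; Below-neg; Below-constant; Below-cong; Below-+;
    Monic-+; Monic-cong; Monic-var^)
  open AdjoinRoot A
  open Geometric (Series.ring A)

  record Extension : Set₁ where
    field
      ring      : CommutativeRing 0ℓ 0ℓ
      lift      : A.Carrier → CommutativeRing.Carrier ring
      lift-hom  : IsRingHomomorphism A.rawRing (CommutativeRing.rawRing ring) lift
      injective : ∀ {a b} → CommutativeRing._≈_ ring (lift a) (lift b) → a A.≈ b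
      x         : CommutativeRing.Carrier ring

  private module PowersModulo (P : Polynomials) where
    open Modulo P
    private
      module B = Ring ring
      module GB = Geometric ring

    proj-^ : ∀ k → proj₁ (varₚ B.^ k) ≡ var S.^ k
    proj-^ zero    = ≡.refl
    proj-^ (suc k) = ≡.cong (var S.*_) (proj-^ k)

    proj-sum : ∀ {n} (t : Fin n → Polynomials) → proj₁ (B.sum t) S.≈ S.sum (proj₁ ∘ t)
    proj-sum {zero}  t = S.refl
    proj-sum {suc n} t = S.+-congˡ (proj-sum (t ∘ suc))

    proj-geometric : ∀ n → proj₁ (GB.geometric varₚ n) S.≈ geometric var n
    proj-geometric n = S.trans (proj-sum (λ (j : Fin n) → varₚ B.^ toℕ j))
      (S.sum-cong-≋ {n} (λ j → S.reflexive (proj-^ (toℕ j))))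

  binomial-monic : ∀ n c → Monic (suc n) (var S.^ suc n S.- constant c)
  binomial-monic n c = Monic-+ (Monic-var^ (suc n)) (Below-≤ (s≤s z≤n) (Below-neg (Below-constant c)))

  binomialₚ : ℕ → A.Carrier → Polynomials
  binomialₚ n c = var S.^ suc n S.- constant c , suc (suc n) , proj₂ (binomial-monic n c)

  geometric-below : ∀ n → Below n (geometric var n)
  geometric-below zero    = λ _ _ → A.refl
  geometric-below (suc n) = Below-cong (S.sym (geometric-last var n))
    (Below-+ (Below-≤ (ℕ.n≤1+n n) (geometric-below n)) (proj₂ (Monic-var^ n)))

  geometric-monic : ∀ n → Monic n (geometric var (suc n))
  geometric-monic n = Monic-cong (S.trans (S.+-comm _ _) (S.sym (geometric-last var n)))
    (Monic-+ (Monic-var^ n) (geometric-below n))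

  geometricₚ : ℕ → Polynomials
  geometricₚ n = geometric var n , n , geometric-below n

  -- Degree `suc n`: a monic modulus of degree 0 would collapse the quotient and destroy the
  -- injectivity of scalars. The index shifts in `adjoin-power` and `adjoin-geometric` ensure a
  -- positive degree.
  quotient : ∀ {n} (P : Polynomials) → Monic (suc n) (proj₁ P) → Extension
  quotient P P-monic = record
    { ring = ring ; lift = constantₚ ; lift-hom = constantₚ-hom ; injective = constantₚ-injective P-monic ; x = varₚ }
    where open Modulo P

  adjoin-power : ∀ n c → Σ[ E ∈ Extension ] (let open Extension E in
    let open Ring ring in x ^ suc n ≈ lift c)
  adjoin-power n c = quotient P (binomial-monic n c) ,
    B.x-y≈0⇒x≈y _ _ (B.trans (≈⇒≡ₚ (S.+-congʳ (S.reflexive (proj-^ (suc n))))) P≡0)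
    where
    P : Polynomials
    P = binomialₚ n c
    open PowersModulo P
    open Modulo P
    module B = Ring ring

  adjoin-geometric : ∀ n → Σ[ E ∈ Extension ] (let open Extension E in
    let open Ring ring in Geometric.geometric ring x (suc (suc n)) ≈ 0#)
  adjoin-geometric n = quotient P (geometric-monic (suc n)) ,
    CommutativeRing.trans ring (≈⇒≡ₚ (proj-geometric (suc (suc n)))) P≡0
    where
    P : Polynomials
    P = geometricₚ (suc (suc n))
    open PowersModulo P
    open Modulo P

-- Injectivity of `ι` is what brings equations found over the algebra back to ℚ(i); it also shows
-- that the algebra is not the zero ring.
record CyclotomicAlgebra (n : ℕ) : Set₁ where
  field
    ring      : CommutativeRing 0ℓ 0ℓ
    ι         : ℚ⟨i⟩ → CommutativeRing.Carrier ring
    ι-hom     : IsRingHomomorphism (DecRawRing.rawRing ℚ⟨i⟩-ring) (CommutativeRing.rawRing ring) ι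
    injective : ∀ {x y} → CommutativeRing._≈_ ring (ι x) (ι y) → x ≡ y
    ζ         : CommutativeRing.Carrier ring
    principal : Geometric.Principal ring n ζ


module CyclotomicExtension {n : ℕ} (n≢0 : NonZero n) (C : CyclotomicAlgebra n) where
  open CyclotomicAlgebra C renaming (ring to A; injective to ι-injective)
  private
    module A = Ring A
    module GA = Geometric A
    instance _ = n≢0
  open GA.Principal principal
  open RootExtensions A using (Extension; adjoin-power; adjoin-geometric)

  module ExtensionProperties (E : Extension) where
    open Extension E public
    open Ring ring public
    open Geometric ring public
    open GeometricHomomorphism A ring lift lift-hom public
    open Homomorphism A.rawRing ring lift lift-hom public
    open IsRingHomomorphism lift-hom public using (⟦⟧-cong; 1#-homo)

    scalar-hom : IsRingHomomorphism (DecRawRing.rawRing ℚ⟨i⟩-ring) rawRing (lift ∘ ι)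
    scalar-hom = Composition.isRingHomomorphism
      trans ι-hom lift-hom

    scalar-injective : ∀ {x y} → lift (ι x) ≈ lift (ι y) → x ≡ y
    scalar-injective = ι-injective ∘ injective

    regular : ∀ m → .{{NonZero m}} → ∀ {t} → m · t ≈ 0# → t ≈ 0#
    regular m = ScalarInverse.regular ring (lift ∘ ι) scalar-hom m

    extend : ∀ {N} ζ′ → Principal N ζ′ → CyclotomicAlgebra N
    extend ζ′ pr = record
      { ring = ring ; ι = lift ∘ ι ; ι-hom = scalar-hom ; injective = scalar-injective
      ; ζ = ζ′ ; principal = pr }

    -- Orthogonality only has to be witnessed by some vanishing geometric sum whose ratio fixes T.
    principal-by : ∀ N {ζ′} → ζ′ ^ N ≈ 1# →
      (∀ d → ¬ (N ℕ.∣ d) → ∃ λ y → ∃ λ m → NonZero m × geometric y m ≈ 0# ×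
         (∀ t → ζ′ ^ d * t ≈ t → y * t ≈ t)) →
      Principal N ζ′
    principal-by N {ζ′} root witness = record
      { root = root
      ; orthogonal = λ d ∤d → let y , m , m≢0 , geometric≈0 , fixed = witness d ∤d in
          fixed⇒≈0 m (regular m {{m≢0}})
            (fixed (geometric (ζ′ ^ d) N) (geometric-fixed (ζ′ ^ d) N
              (begin
                (ζ′ ^ d) ^ N  ≈⟨ swap-exponents ζ′ d N ⟩
                (ζ′ ^ N) ^ d  ≈⟨ ^-congˡ d root ⟩
                1# ^ d  ≈⟨ 1^n≈1 d ⟩
                1#  ∎)))
            geometric≈0 }
      where open Reasoning

  -- Write n = q p. If p divides d, then x^d is ζ^(d/p), and n does not divide d/p. Otherwise
  -- (x^d)^n = ζ^(d q), and n does not divide d q because p does not divide d. Either way an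
  -- orthogonality sum of ζ is the witness.
  ramified : ∀ p → p ℕ.∣ n → (E : Extension) →
    (let open ExtensionProperties E) → x ^ p ≈ lift ζ → CyclotomicAlgebra (p ℕ.* n)
  ramified p (ℕ.divides q n≡q*p) E x^p≈ζ = extend x (principal-by (p ℕ.* n) {x} x^pn≈1 witness)
    where
    open ExtensionProperties E
    q≢0 : NonZero q
    q≢0 = ℕ.m*n≢0⇒m≢0 q {{≡.subst NonZero n≡q*p n≢0}}
    x^p*k : ∀ k → x ^ (p ℕ.* k) ≈ lift (ζ A.^ k)
    x^p*k k = begin
      x ^ (p ℕ.* k)  ≈⟨ ^-assocʳ x p k ⟨
      (x ^ p) ^ k  ≈⟨ ^-congˡ k x^p≈ζ ⟩
      lift ζ ^ k  ≈⟨ ^-homo ζ k ⟨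
      lift (ζ A.^ k)  ∎
      where open Reasoning
    x^pn≈1 : x ^ (p ℕ.* n) ≈ 1#
    x^pn≈1 = trans (x^p*k n) (trans (⟦⟧-cong root) 1#-homo)
    witness : ∀ d → ¬ (p ℕ.* n ℕ.∣ d) → ∃ λ y → ∃ λ m → NonZero m × geometric y m ≈ 0# ×
         (∀ t → x ^ d * t ≈ t → y * t ≈ t)
    witness d ∤d with p ℕ.∣? d
    ... | yes (ℕ.divides d′ ≡.refl) = lift (ζ A.^ d′) , n , n≢0 ,
      geometric≈0 {ζ A.^ d′} n (orthogonal d′ (λ n∣d′ → ∤d (≡.subst (p ℕ.* n ℕ.∣_) (ℕ.*-comm p d′) (ℕ.*-monoʳ-∣ p n∣d′)))) ,
      λ t fixed → begin
        lift (ζ A.^ d′) * t  ≈⟨ *-congʳ (x^p*k d′) ⟨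
        x ^ (p ℕ.* d′) * t  ≈⟨ *-congʳ (^-congʳ x (ℕ.*-comm p d′)) ⟩
        x ^ (d′ ℕ.* p) * t  ≈⟨ fixed ⟩
        t  ∎
      where open Reasoning
    ... | no p∤d = lift (ζ A.^ (d ℕ.* q)) , n , n≢0 ,
      geometric≈0 {ζ A.^ (d ℕ.* q)} n (orthogonal (d ℕ.* q)
        (λ n∣dq → p∤d (ℕ.*-cancelˡ-∣ q {{q≢0}} (≡.subst₂ ℕ._∣_ n≡q*p (ℕ.*-comm d q) n∣dq)))) ,
      λ t fixed → begin
        lift (ζ A.^ (d ℕ.* q)) * t  ≈⟨ *-congʳ (x^p*k (d ℕ.* q)) ⟨
        x ^ (p ℕ.* (d ℕ.* q)) * t  ≈⟨ *-congʳ (^-congʳ x exponent) ⟩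
        x ^ (d ℕ.* n) * t  ≈⟨ *-congʳ (^-assocʳ x d n) ⟨
        (x ^ d) ^ n * t  ≈⟨ ^-fixed fixed n ⟩
        t  ∎
      where
      open Reasoning
      exponent : p ℕ.* (d ℕ.* q) ≡ d ℕ.* n
      exponent = ≡.trans (ℕ.*-comm p (d ℕ.* q)) (≡.trans (ℕ.*-assoc d q p) (≡.cong (d ℕ.*_) (≡.sym n≡q*p)))

  -- The new root is ζ x with x^p = 1. If n does not divide d, then (ζ x)^(d p) = ζ^(d p), and n
  -- does not divide d p by coprimality. If n divides d, then (ζ x)^d = x^d with p not dividing d,
  -- and the sum adjoined for x is the witness.
  unramified : ∀ p → Prime p → ¬ (p ℕ.∣ n) → (E : Extension) →
    (let open ExtensionProperties E) → geometric x p ≈ 0# → CyclotomicAlgebra (p ℕ.* n)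
  unramified p prime-p p∤n E x-geometric = extend ξ (principal-by (p ℕ.* n) ξ^pn≈1 witness)
    where
    open ExtensionProperties E
    open Reasoning
    ξ : Carrier
    ξ = lift ζ * x
    x^p≈1 : x ^ p ≈ 1#
    x^p≈1 = begin
      x ^ p  ≈⟨ +-identityˡ _ ⟨
      0# + x ^ p  ≈⟨ +-congʳ x-geometric ⟨
      geometric x p + x ^ p  ≈⟨ geometric-telescope x p ⟨
      1# + x * geometric x p  ≈⟨ +-congˡ (trans (*-congˡ x-geometric) (zeroʳ x)) ⟩
      1# + 0#  ≈⟨ +-identityʳ 1# ⟩
      1#  ∎
    ξ^ : ∀ k → ξ ^ k ≈ lift ζ ^ k * x ^ k
    ξ^ = ^-distrib-* (lift ζ) x
    ξ^n∣ : ∀ {k} → n ℕ.∣ k → ξ ^ k ≈ x ^ k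
    ξ^n∣ {k} n∣k = trans (ξ^ k) (trans (*-congʳ (^∣≈1 (^≈1 n root) n∣k)) (*-identityˡ _))
    ξ^p∣ : ∀ {k} → p ℕ.∣ k → ξ ^ k ≈ lift ζ ^ k
    ξ^p∣ {k} p∣k = trans (ξ^ k) (trans (*-congˡ (^∣≈1 x^p≈1 p∣k)) (*-identityʳ _))
    ξ^pn≈1 : ξ ^ (p ℕ.* n) ≈ 1#
    ξ^pn≈1 = trans (ξ^p∣ (ℕ.m∣m*n n)) (^∣≈1 (^≈1 n root) (ℕ.n∣m*n p))
    coprime : ∀ {m} → ¬ (p ℕ.∣ m) → Coprime.Coprime p m
    coprime p∤m (d∣p , d∣m) with prime⇒irreducible prime-p d∣p
    ... | inj₁ d≡1    = d≡1
    ... | inj₂ ≡.refl = contradiction d∣m p∤m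
    witness : ∀ d → ¬ (p ℕ.* n ℕ.∣ d) → ∃ λ y → ∃ λ m → NonZero m × geometric y m ≈ 0# ×
         (∀ t → ξ ^ d * t ≈ t → y * t ≈ t)
    witness d ∤d with n ℕ.∣? d
    ... | no n∤d = lift (ζ A.^ (d ℕ.* p)) , n , n≢0 ,
      geometric≈0 {ζ A.^ (d ℕ.* p)} n (orthogonal (d ℕ.* p)
        (λ n∣dp → n∤d (Coprime.coprime-divisor (Coprime.sym (coprime p∤n)) (≡.subst (n ℕ.∣_) (ℕ.*-comm d p) n∣dp)))) ,
      λ t fixed → begin
        lift (ζ A.^ (d ℕ.* p)) * t  ≈⟨ *-congʳ (^-homo ζ (d ℕ.* p)) ⟩
        lift ζ ^ (d ℕ.* p) * t  ≈⟨ *-congʳ (ξ^p∣ (ℕ.n∣m*n d)) ⟨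
        ξ ^ (d ℕ.* p) * t  ≈⟨ *-congʳ (^-assocʳ ξ d p) ⟨
        (ξ ^ d) ^ p * t  ≈⟨ ^-fixed fixed p ⟩
        t  ∎
    ... | yes (ℕ.divides q ≡.refl) = x , p , prime⇒nonZero prime-p , x-geometric , λ t fixed → x-fixed t
        (trans (*-congʳ (sym (ξ^n∣ (ℕ.n∣m*n q)))) fixed)
      where
      p∤d : ¬ (p ℕ.∣ q ℕ.* n)
      p∤d p∣qn with euclidsLemma q n prime-p p∣qn
      ... | inj₁ p∣q = ∤d (ℕ.*-monoˡ-∣ n p∣q)
      ... | inj₂ p∣n = p∤n p∣n
      x-fixed : ∀ t → x ^ d * t ≈ t → x * t ≈ t
      -- Bézout for p and d shows that, modulo x^p = 1, either x or its inverse is a power of x^d;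
      -- so whatever x^d fixes is fixed by x.
      x-fixed t fixed with Coprime.coprime-Bézout (coprime p∤d)
      ... | GCD.Bézout.+- u v eq = begin
        x * t  ≈⟨ *-congˡ (^-fixed fixed v) ⟨
        x * ((x ^ d) ^ v * t)  ≈⟨ *-assoc _ _ _ ⟨
        (x * (x ^ d) ^ v) * t  ≈⟨ *-congʳ (*-congˡ (trans (^-assocʳ x d v) (^-congʳ x (ℕ.*-comm d v)))) ⟩
        x ^ (1 ℕ.+ v ℕ.* d) * t  ≈⟨ *-congʳ (^∣≈1 x^p≈1 (ℕ.divides u eq)) ⟩
        1# * t  ≈⟨ *-identityˡ t ⟩
        t  ∎
      ... | GCD.Bézout.-+ u v eq = begin
        x * t  ≈⟨ *-congʳ (trans (sym (*-identityʳ x)) (*-congˡ (sym (^∣≈1 x^p≈1 (ℕ.n∣m*n u))))) ⟩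
        x ^ (1 ℕ.+ u ℕ.* p) * t  ≈⟨ *-congʳ (^-congʳ x (≡.trans eq (ℕ.*-comm v d))) ⟩
        x ^ (d ℕ.* v) * t  ≈⟨ *-congʳ (^-assocʳ x d v) ⟨
        (x ^ d) ^ v * t  ≈⟨ ^-fixed fixed v ⟩
        t  ∎

  extend-by-prime : ∀ p → Prime p → CyclotomicAlgebra (p ℕ.* n)
  extend-by-prime p prime-p with p ℕ.∣? n
  extend-by-prime p@(suc p-1) prime-p | yes p∣n =
    let E , x^p≈ζ = adjoin-power p-1 ζ in ramified p p∣n E x^p≈ζ
  extend-by-prime zero prime-p | yes _ = contradiction (prime⇒nonZero prime-p) λ ()
  extend-by-prime zero prime-p | no _ = contradiction (prime⇒nonZero prime-p) λ ()
  extend-by-prime (suc zero) prime-p | no p∤n = contradiction (ℕ.1∣ n) p∤n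
  extend-by-prime p@(suc (suc p-2)) prime-p | no p∤n =
    let E , x-geometric = adjoin-geometric p-2 in unramified p prime-p p∤n E x-geometric

-- Irreducibility of the adjoined polynomials is never examined, and zero divisors do occur: for n =
-- 4 the second step adjoins a square root of -1 to a ring that already contains i.
cyclotomicAlgebra : ∀ n → .{{NonZero n}} → CyclotomicAlgebra n
cyclotomicAlgebra n = ≡.subst CyclotomicAlgebra (≡.sym isFactorisation) (proj₂ (build factors factorsPrime))
  where
  open PrimeFactorisation (factorise n)
  base : CyclotomicAlgebra 1
  base = record
    { ring = Gaussian.ring ; ι = id ; ι-hom = ringHomomorphism id (λ _ _ → ≡.refl) ≡.refl (λ _ _ → ≡.refl) ≡.refl (λ _ → ≡.refl)
    ; injective = id ; ζ = 1# ; principal = record { root = *-identityˡ 1# ; orthogonal = λ d 1∤d → contradiction (ℕ.1∣ d) 1∤d } }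
    where open Ring Gaussian.ring
  build : ∀ ps → All Prime ps → NonZero (product ps) × CyclotomicAlgebra (product ps)
  build []       []               = _ , base
  build (p ∷ ps) (prime-p ∷ primes) with build ps primes
  ... | n≢0 , C = ℕ.m*n≢0 p (product ps) {{prime⇒nonZero prime-p}} {{n≢0}} ,
    CyclotomicExtension.extend-by-prime n≢0 C p prime-p

-- Determinants and resultants

module Determinant (R : CommutativeRing 0ℓ 0ℓ) where
  open Ring R
  open Reasoning
  open Solver

  Row : ℕ → Set
  Row N = Fin N → Carrier

  infix 4 _≈ᵣ_ _≈ₘ_
  _≈ᵣ_ : ∀ {N} → Rel (Row N) 0ℓ
  v ≈ᵣ w = ∀ j → v j ≈ w j

  _≈ₘ_ : ∀ {n N} → Rel (Fin n → Row N) 0ℓ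
  M ≈ₘ M′ = ∀ i → M i ≈ᵣ M′ i

  sign : ∀ {n} → Fin n → Carrier
  sign j = (- 1#) ^ toℕ j

  det : ∀ {n} → (Fin n → Row n) → Carrier
  det {zero}  M = 1#
  det {suc n} M = sum λ j → sign j * M zero j * det (λ i k → M (suc i) (punchIn j k))

  det-cong : ∀ {n} {M M′ : Fin n → Row n} → M ≈ₘ M′ → det M ≈ det M′
  det-cong {zero}  e = refl
  det-cong {suc n} e = sum-cong-≋ {suc n} λ j → *-cong (*-congˡ {sign j} (e zero j)) (det-cong λ i k → e (suc i) (punchIn j k))

  private
    variable
      n N N′ : ℕ

    sum-zero : (f : Row n) → (∀ j → f j ≈ 0#) → sum f ≈ 0#
    sum-zero {n} f f≈0 = trans (sum-cong-≋ {n} f≈0) (sum-replicate-zero n)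

  Form : ℕ → ℕ → Set
  Form n N = (Fin n → Row N) → Carrier

  Congruent : Form n N → Set
  Congruent F = ∀ {M M′} → M ≈ₘ M′ → F M ≈ F M′

  record Linear (f : Row N → Carrier) : Set where
    field
      cong  : ∀ {v w} → v ≈ᵣ w → f v ≈ f w
      add   : ∀ v w → f (λ j → v j + w j) ≈ f v + f w
      scale : ∀ a v → f (λ j → a * v j) ≈ a * f v

  record LinearMap (T : Row N → Row N′) : Set where
    field
      cong  : ∀ {v w} → v ≈ᵣ w → T v ≈ᵣ T w
      add   : ∀ v w → T (λ j → v j + w j) ≈ᵣ λ j → T v j + T w j
      scale : ∀ a v → T (λ j → a * v j) ≈ᵣ λ j → a * T v j

  linearMap : {T : Row N → Row N′} → (∀ k → Linear (λ v → T v k)) → LinearMap T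
  linearMap l = record
    { cong = λ e k → Linear.cong (l k) e
    ; add = λ v w k → Linear.add (l k) v w
    ; scale = λ a v k → Linear.scale (l k) a v }

  Linear-∘ : {f : Row N′ → Carrier} {T : Row N → Row N′} → Linear f → LinearMap T → Linear (f ∘ T)
  Linear-∘ f T = record
    { cong = λ e → f.cong (T.cong e)
    ; add = λ v w → trans (f.cong (T.add v w)) (f.add _ _)
    ; scale = λ a v → trans (f.cong (T.scale a v)) (f.scale _ _) }
    where
    module f = Linear f
    module T = LinearMap T

  Linear-resp : {f g : Row N → Carrier} → (∀ v → f v ≈ g v) → Linear f → Linear g
  Linear-resp e f = record
    { cong = λ v≈w → trans (sym (e _)) (trans (f.cong v≈w) (e _))
    ; add = λ v w → trans (sym (e _)) (trans (f.add v w) (+-cong (e v) (e w)))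
    ; scale = λ a v → trans (sym (e _)) (trans (f.scale a v) (*-congˡ (e v))) }
    where module f = Linear f

  Linear-coordinate : ∀ (k : Fin N) → Linear (λ v → v k)
  Linear-coordinate k = record { cong = λ e → e k ; add = λ v w → refl ; scale = λ a v → refl }

  Linear-0 : Linear {N} (λ _ → 0#)
  Linear-0 = record { cong = λ _ → refl ; add = λ _ _ → sym (+-identityˡ 0#) ; scale = λ a _ → sym (zeroʳ a) }

  Linear-+ : {f g : Row N → Carrier} → Linear f → Linear g → Linear (λ v → f v + g v)
  Linear-+ f g = record
    { cong = λ e → +-cong (f.cong e) (g.cong e)
    ; add = λ v w → trans (+-cong (f.add v w) (g.add v w))
        (solve 4 (λ a b c d → (a :+ b) :+ (c :+ d) := (a :+ c) :+ (b :+ d)) refl _ _ _ _)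
    ; scale = λ a v → trans (+-cong (f.scale a v) (g.scale a v)) (sym (distribˡ _ _ _)) }
    where
    module f = Linear f
    module g = Linear g

  Linear-* : {f : Row N → Carrier} (a : Carrier) → Linear f → Linear (λ v → a * f v)
  Linear-* a f = record
    { cong = λ e → *-congˡ (f.cong e)
    ; add = λ v w → trans (*-congˡ (f.add v w)) (distribˡ _ _ _)
    ; scale = λ b v → trans (*-congˡ (f.scale b v)) (solve 3 (λ a b c → a :* (b :* c) := b :* (a :* c)) refl a b _) }
    where module f = Linear f

  Linear-sum : {f : Fin n → Row N → Carrier} → (∀ i → Linear (f i)) → Linear (λ v → sum (λ i → f i v))
  Linear-sum {zero}  f = Linear-0
  Linear-sum {suc n} f = Linear-+ (f zero) (Linear-sum (f ∘ suc))

  basis : Fin N → Row N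
  basis zero    = 1# V.∷ λ _ → 0#
  basis (suc j) = 0# V.∷ basis j

  basis-diagonal : ∀ (i : Fin N) → basis i i ≈ 1#
  basis-diagonal zero    = refl
  basis-diagonal (suc i) = basis-diagonal i

  basis-off-diagonal : ∀ (i j : Fin N) → ¬ i ≡ j → basis i j ≈ 0#
  basis-off-diagonal zero    zero    i≢j = contradiction ≡.refl i≢j
  basis-off-diagonal zero    (suc j) i≢j = refl
  basis-off-diagonal (suc i) zero    i≢j = refl
  basis-off-diagonal (suc i) (suc j) i≢j = basis-off-diagonal i j (i≢j ∘ ≡.cong suc)

  linear-expand : {f : Row N → Carrier} → Linear f → ∀ v → f v ≈ sum (λ j → v j * f (basis j))
  linear-expand {zero} {f} l v = begin
    f v  ≈⟨ cong (λ ()) ⟩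
    f (λ j → 0# * v j)  ≈⟨ scale 0# v ⟩
    0# * f v  ≈⟨ zeroˡ _ ⟩
    0#  ∎
    where open Linear l
  linear-expand {suc N} {f} l v = begin
    f v  ≈⟨ cong split ⟩
    f (λ j → v zero * basis zero j + (0# V.∷ v ∘ suc) j)  ≈⟨ add _ _ ⟩
    f (λ j → v zero * basis zero j) + f (0# V.∷ v ∘ suc)  ≈⟨ +-cong (scale _ _) (linear-expand (Linear-∘ l extend) (v ∘ suc)) ⟩
    v zero * f (basis zero) + sum (λ j → v (suc j) * f (0# V.∷ basis j)) ∎
    where
    open Linear l
    split : ∀ j → v j ≈ v zero * basis zero j + (0# V.∷ v ∘ suc) j
    split zero    = sym (trans (+-identityʳ _) (*-identityʳ _))
    split (suc j) = sym (trans (+-congʳ (zeroʳ _)) (+-identityˡ _))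
    extend : LinearMap {N} (0# V.∷_)
    extend = linearMap λ { zero → Linear-0 ; (suc k) → Linear-coordinate k }

  -- Only adjacent repetitions need to be excluded.
  HeadAlternating : ∀ n → Form (suc n) N → Set
  HeadAlternating zero    F = ⊤
  HeadAlternating (suc n) F = ∀ v M → F (v V.∷ v V.∷ M) ≈ 0#

  Alternating : ∀ n → Form n N → Set
  Alternating zero    F = ⊤
  Alternating (suc n) F =
    (∀ M → Linear (λ v → F (v V.∷ M))) × HeadAlternating n F × (∀ v → Alternating n (λ M → F (v V.∷ M)))

  ∷-cong : ∀ {v w : Row N} {M M′ : Fin n → Row N} → v ≈ᵣ w → M ≈ₘ M′ → (v V.∷ M) ≈ₘ (w V.∷ M′)
  ∷-cong e f zero    = e
  ∷-cong e f (suc i) = f i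

  ≈ᵣ-refl : ∀ {v : Row N} → v ≈ᵣ v
  ≈ᵣ-refl j = refl

  head∷tail : ∀ (M : Fin (suc n) → Row N) → M ≈ₘ (M zero V.∷ M ∘ suc)
  head∷tail M zero    = ≈ᵣ-refl
  head∷tail M (suc i) = ≈ᵣ-refl

  fix-head : {F : Form (suc n) N} → Congruent F → ∀ v → Congruent (λ M → F (v V.∷ M))
  fix-head c v e = c (∷-cong ≈ᵣ-refl e)

  Alternating-resp : ∀ {n} {F G : Form n N} → (∀ M → F M ≈ G M) → Alternating n F → Alternating n G
  Alternating-resp {n = zero}        e _ = _
  Alternating-resp {n = suc zero}    e (l , h , r) =
    (λ M → Linear-resp (λ v → e _) (l M)) , _ , λ v → _
  Alternating-resp {n = suc (suc n)} e (l , h , r) =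
    (λ M → Linear-resp (λ v → e _) (l M)) , (λ v M → trans (sym (e _)) (h v M)) ,
    λ v → Alternating-resp (λ M → e _) (r v)

  Alternating-0 : ∀ n → Alternating {N} n (λ _ → 0#)
  Alternating-0 zero          = _
  Alternating-0 (suc zero)    = (λ _ → Linear-0) , _ , λ _ → _
  Alternating-0 (suc (suc n)) = (λ _ → Linear-0) , (λ _ _ → refl) , λ _ → Alternating-0 (suc n)

  Alternating-+ : ∀ n {F G : Form n N} → Alternating n F → Alternating n G → Alternating n (λ M → F M + G M)
  Alternating-+ zero          _ _ = _
  Alternating-+ (suc zero)    (l , h , r) (l′ , h′ , r′) = (λ M → Linear-+ (l M) (l′ M)) , _ , λ _ → _
  Alternating-+ (suc (suc n)) (l , h , r) (l′ , h′ , r′) =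
    (λ M → Linear-+ (l M) (l′ M)) , (λ v M → trans (+-cong (h v M) (h′ v M)) (+-identityˡ 0#)) ,
    λ v → Alternating-+ (suc n) (r v) (r′ v)

  Alternating-* : ∀ n {F : Form n N} a → Alternating n F → Alternating n (λ M → a * F M)
  Alternating-* zero          a _ = _
  Alternating-* (suc zero)    a (l , h , r) = (λ M → Linear-* a (l M)) , _ , λ _ → _
  Alternating-* (suc (suc n)) a (l , h , r) =
    (λ M → Linear-* a (l M)) , (λ v M → trans (*-congˡ (h v M)) (zeroʳ a)) , λ v → Alternating-* (suc n) a (r v)

  Alternating-sum : ∀ {k} n {F : Fin k → Form n N} → (∀ i → Alternating n (F i)) → Alternating n (λ M → sum (λ i → F i M))
  Alternating-sum {k = zero}  n a = Alternating-0 n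
  Alternating-sum {k = suc k} n a = Alternating-+ n (a zero) (Alternating-sum n (a ∘ suc))

  Alternating-∘ : ∀ n {F : Form n N′} {T : Row N → Row N′} → Congruent F → Alternating n F → LinearMap T →
    Alternating n (λ M → F (T ∘ M))
  Alternating-∘ zero    c _ T = _
  Alternating-∘ (suc n) {F} {T} c (l , h , r) T-linear =
    (λ M → Linear-resp (λ v → push v M) (Linear-∘ (l (T ∘ M)) T-linear)) , head n c h ,
    λ v → Alternating-resp (λ M → push v M) (Alternating-∘ n (fix-head c (T v)) (r (T v)) T-linear)
    where
    T∷ : ∀ {m} v (M : Fin m → _) → (T v V.∷ T ∘ M) ≈ₘ (T ∘ (v V.∷ M))
    T∷ v M zero    = ≈ᵣ-refl
    T∷ v M (suc i) = ≈ᵣ-refl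
    push : ∀ v M → F (T v V.∷ T ∘ M) ≈ F (T ∘ (v V.∷ M))
    push v M = c (T∷ v M)
    head : ∀ m {F : Form (suc m) _} → Congruent F → HeadAlternating m F → HeadAlternating m (λ M → F (T ∘ M))
    head zero    c _ = _
    head (suc m) c h v M = trans (sym (c λ i → λ { j → step i j })) (h (T v) (T ∘ M))
      where
      step : (T v V.∷ T v V.∷ T ∘ M) ≈ₘ (T ∘ (v V.∷ v V.∷ M))
      step zero          = ≈ᵣ-refl
      step (suc zero)    = ≈ᵣ-refl
      step (suc (suc i)) = ≈ᵣ-refl

  multilinear-unique : ∀ n {F G : Form n N} → Congruent F → Congruent G → Alternating n F → Alternating n G →
    (∀ (σ : Fin n → Fin N) → F (basis ∘ σ) ≈ G (basis ∘ σ)) → ∀ M → F M ≈ G M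
  multilinear-unique zero cF cG _ _ e M = trans (cF λ ()) (trans (e λ ()) (cG λ ()))
  multilinear-unique {N} (suc n) {F} {G} cF cG (lF , _ , rF) (lG , _ , rG) e M = begin
    F M  ≈⟨ cF (head∷tail M) ⟩
    F (M zero V.∷ M ∘ suc)  ≈⟨ linear-expand (lF (M ∘ suc)) (M zero) ⟩
    sum (λ j → M zero j * F (basis j V.∷ M ∘ suc))  ≈⟨ sum-cong-≋ {N} (λ j → *-congˡ (rows j)) ⟩
    sum (λ j → M zero j * G (basis j V.∷ M ∘ suc))  ≈⟨ linear-expand (lG (M ∘ suc)) (M zero) ⟨
    G (M zero V.∷ M ∘ suc)  ≈⟨ cG (head∷tail M) ⟨
    G M  ∎
    where
    rows : ∀ j → F (basis j V.∷ M ∘ suc) ≈ G (basis j V.∷ M ∘ suc)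
    rows j = multilinear-unique n (fix-head cF (basis j)) (fix-head cG (basis j)) (rF (basis j)) (rG (basis j))
      (λ σ → trans (cF (λ { zero → ≈ᵣ-refl ; (suc i) → ≈ᵣ-refl }))
                   (trans (e (j V.∷ σ)) (cG (λ { zero → ≈ᵣ-refl ; (suc i) → ≈ᵣ-refl })))) (M ∘ suc)

  -- The terms (j, k) and (k, j) of a double Laplace expansion cancel.
  expansion-cancel : ∀ n (v : Row (suc (suc n))) (D : (Fin n → Fin (suc (suc n))) → Carrier) → (∀ {s t} → s ≗ t → D s ≈ D t) →
    sum (λ j → sign j * v j * sum (λ k → sign k * v (punchIn j k) * D (punchIn j ∘ punchIn k))) ≈ 0#
  expansion-cancel n v D D-cong = begin
    1# * v zero * sum (λ k → first k) + sum (λ j → sign (suc j) * v (suc j) * (1# * v zero * D (suc ∘ punchIn j) + rest j))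
      ≈⟨ +-cong (trans (*-congʳ (*-identityˡ _)) (*-distribˡ-sum (v zero) first))
                (trans (sum-cong-≋ {suc n} (λ j → distribˡ (sign (suc j) * v (suc j)) (1# * v zero * D (suc ∘ punchIn j))
                    (rest j)))
                       (∑-distrib-+ second third)) ⟩
    sum (λ k → v zero * first k) + (sum second + sum third)
      ≈⟨ +-assoc _ _ _ ⟨
    (sum (λ k → v zero * first k) + sum second) + sum third
      ≈⟨ +-cong (trans (sym (∑-distrib-+ (λ k → v zero * first k) second)) (sum-zero _ opposite)) (third≈0 n v D D-cong) ⟩
    0# + 0#  ≈⟨ +-identityˡ 0# ⟩
    0#  ∎
    where
    first : Fin (suc n) → Carrier
    first k = sign k * v (suc k) * D (suc ∘ punchIn k)
    second : Fin (suc n) → Carrier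
    second j = sign (suc j) * v (suc j) * (1# * v zero * D (suc ∘ punchIn j))
    rest third : Fin (suc n) → Carrier
    rest j = sum (λ k → sign (suc k) * v (suc (punchIn j k)) * D (punchIn (suc j) ∘ punchIn (suc k)))
    third j = sign (suc j) * v (suc j) * rest j
    opposite : ∀ k → v zero * first k + second k ≈ 0#
    opposite k = solve 4 (λ a s b d → a :* (s :* b :* d) :+ (:- con :1 :* s) :* b :* (con :1 :* a :* d) := con :0) refl
      (v zero) (sign k) (v (suc k)) (D (suc ∘ punchIn k))
    -- What remains are the terms in which neither chosen column is the first. The two extra signs
    -- cancel, and the sum becomes the original one for `v ∘ suc`, with `D` always keeping the first
    -- column.
    third≈0 : ∀ n (v : Row (suc (suc n))) (D : (Fin n → Fin (suc (suc n))) → Carrier) → (∀ {s t} → s ≗ t → D s ≈ D t) →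
      sum (λ j → sign (suc j) * v (suc j) *
        sum (λ k → sign (suc k) * v (suc (punchIn j k)) * D (punchIn (suc j) ∘ punchIn (suc k)))) ≈ 0#
    third≈0 zero    v D D-cong = sum-zero {1} _ (λ j → zeroʳ (sign (suc j) * v (suc j)))
    third≈0 (suc n) v D D-cong = trans (sum-cong-≋ {suc (suc n)} λ j → begin
      (- 1# * sign j) * v (suc j) * sum (λ k → (- 1# * sign k) * v (suc (punchIn j k)) * D (punchIn (suc j) ∘ punchIn (suc k)))
        ≈⟨ *-congˡ (sum-cong-≋ {suc n} (λ k → *-congˡ {sign (suc k) * v (suc (punchIn j k))} (D-cong (commute j k)))) ⟩
      (- 1# * sign j) * v (suc j) * sum (λ k → (- 1# * sign k) * v (suc (punchIn j k)) * D′ (punchIn j ∘ punchIn k))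
        ≈⟨ *-congˡ (sum-cong-≋ {suc n} (λ k → *-assoc³ (sign k) (v (suc (punchIn j k))) (D′ (punchIn j ∘ punchIn k)))) ⟩
      (- 1# * sign j) * v (suc j) * sum (λ k → - 1# * (sign k * v (suc (punchIn j k)) * D′ (punchIn j ∘ punchIn k)))
        ≈⟨ *-congˡ (*-distribˡ-sum (- 1#) (λ k → sign k * v (suc (punchIn j k)) * D′ (punchIn j ∘ punchIn k))) ⟨
      (- 1# * sign j) * v (suc j) * (- 1# * sum (λ k → sign k * v (suc (punchIn j k)) * D′ (punchIn j ∘ punchIn k)))
        ≈⟨ solve 3 (λ s a b → (:- con :1 :* s) :* a :* (:- con :1 :* b) := s :* a :* b) refl (sign j) (v (suc j)) _ ⟩
      sign j * v (suc j) * sum (λ k → sign k * v (suc (punchIn j k)) * D′ (punchIn j ∘ punchIn k)) ∎)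
      (expansion-cancel n (v ∘ suc) D′ (λ e → D-cong λ { zero → ≡.refl ; (suc i) → ≡.cong suc (e i) }))
      where
      D′ : (Fin n → Fin (suc (suc n))) → Carrier
      D′ s = D (zero V.∷ (suc ∘ s))
      commute : ∀ j k → punchIn (suc j) ∘ punchIn (suc k) ≗ (zero V.∷ (suc ∘ punchIn j ∘ punchIn k))
      commute j k zero    = ≡.refl
      commute j k (suc c) = ≡.refl
      *-assoc³ : ∀ s a d → (- 1# * s) * a * d ≈ - 1# * (s * a * d)
      *-assoc³ s a d = solve 3 (λ s a d → (:- con :1 :* s) :* a :* d := :- con :1 :* (s :* a :* d)) refl s a d

  minor-linear : (j : Fin (suc N)) → LinearMap {suc N} {N} (λ v k → v (punchIn j k))
  minor-linear j = linearMap (λ k → Linear-coordinate (punchIn j k))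

  det-alternating : ∀ n → Alternating n (det {n})
  det-alternating zero    = _
  det-alternating (suc n) =
    (λ M → Linear-sum (λ j → Linear-resp (λ v → rearrange j (v j) _)
      (Linear-* (sign j * det (λ i k → M i (punchIn j k))) (Linear-coordinate j)))) ,
    head n ,
    λ v → Alternating-sum n (λ j → Alternating-* n (sign j * v j)
      (Alternating-∘ n det-cong (det-alternating n) (minor-linear j)))
    where
    rearrange : ∀ (j : Fin (suc n)) a d → sign j * d * a ≈ sign j * a * d
    rearrange j a d = solve 3 (λ s a d → s :* d :* a := s :* a :* d) refl (sign j) a d
    head : ∀ n → HeadAlternating n (det {suc n})
    head zero    = _
    head (suc n) v M = expansion-cancel n v (λ s → det (λ i k → M i (s k)))
      (λ e → det-cong (λ i k → reflexive (≡.cong (M i) (e k))))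

  swap-rows : {F : Form (suc (suc n)) N} → Congruent F → Alternating (suc (suc n)) F →
    ∀ v w M → F (v V.∷ w V.∷ M) ≈ - F (w V.∷ v V.∷ M)
  swap-rows {F = F} c (l , h , r) v w M = begin
    F (v V.∷ w V.∷ M)  ≈⟨ solve 2 (λ a b → a := (a :+ b) :- b) refl _ _ ⟩
    (F (v V.∷ w V.∷ M) + F (w V.∷ v V.∷ M)) - F (w V.∷ v V.∷ M) ≈⟨ +-congʳ sum≈0 ⟩
    0# - F (w V.∷ v V.∷ M)  ≈⟨ +-identityˡ _ ⟩
    - F (w V.∷ v V.∷ M)  ∎
    where
    v+w : Row _
    v+w j = v j + w j
    second : ∀ u → F (u V.∷ v+w V.∷ M) ≈ F (u V.∷ v V.∷ M) + F (u V.∷ w V.∷ M)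
    second u = Linear.add (proj₁ (r u) M) v w
    sum≈0 : F (v V.∷ w V.∷ M) + F (w V.∷ v V.∷ M) ≈ 0#
    sum≈0 = begin
      F (v V.∷ w V.∷ M) + F (w V.∷ v V.∷ M)  ≈⟨ +-cong (+-identityˡ _) (+-identityʳ _) ⟨
      (0# + F (v V.∷ w V.∷ M)) + (F (w V.∷ v V.∷ M) + 0#) ≈⟨ +-cong (+-congʳ (h v M)) (+-congˡ (h w M)) ⟨
      (F (v V.∷ v V.∷ M) + F (v V.∷ w V.∷ M)) + (F (w V.∷ v V.∷ M) + F (w V.∷ w V.∷ M)) ≈⟨ +-cong (second v) (second w) ⟨
      F (v V.∷ v+w V.∷ M) + F (w V.∷ v+w V.∷ M) ≈⟨ Linear.add (l (v+w V.∷ M)) v w ⟨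
      F (v+w V.∷ v+w V.∷ M)  ≈⟨ h v+w M ⟩
      0#  ∎

  repeated-row : ∀ n {F : Form (suc n) N} → Congruent F → Alternating (suc n) F →
    ∀ v M (i : Fin n) → M i ≈ᵣ v → F (v V.∷ M) ≈ 0#
  repeated-row (suc n) {F} c alt@(l , h , r) v M zero e =
    trans (c λ { zero → ≈ᵣ-refl ; (suc zero) → e ; (suc (suc i)) → ≈ᵣ-refl }) (h v (M ∘ suc))
  repeated-row (suc n) {F} c alt@(l , h , r) v M (suc i) e = begin
    F (v V.∷ M)  ≈⟨ c (∷-cong ≈ᵣ-refl (head∷tail M)) ⟩
    F (v V.∷ M zero V.∷ M ∘ suc)  ≈⟨ swap-rows c alt v (M zero) (M ∘ suc) ⟩
    - F (M zero V.∷ v V.∷ M ∘ suc)  ≈⟨ -‿cong (repeated-row n (fix-head c (M zero)) (r (M zero)) v (M ∘ suc) i e) ⟩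
    - 0#  ≈⟨ -0#≈0# ⟩
    0#  ∎

  move-row : ∀ n {F : Form (suc n) N} → Congruent F → Alternating (suc n) F →
    ∀ M (j : Fin (suc n)) → F (M j V.∷ M ∘ punchIn j) ≈ sign j * F M
  move-row n {F} c alt M zero = trans (c λ i → λ k → sym (head∷tail M i k)) (sym (*-identityˡ _))
  move-row (suc n) {F} c alt@(l , h , r) M (suc j) = begin
    F (M (suc j) V.∷ M ∘ punchIn (suc j))  ≈⟨ c (∷-cong ≈ᵣ-refl (head∷tail _)) ⟩
    F (M (suc j) V.∷ M zero V.∷ M ∘ suc ∘ punchIn j)  ≈⟨ swap-rows c alt _ _ _ ⟩
    - F (M zero V.∷ M (suc j) V.∷ M ∘ suc ∘ punchIn j)  ≈⟨ -‿cong (move-row n (fix-head c (M zero)) (r (M zero)) (M ∘ suc) j) ⟩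
    - (sign j * F (M zero V.∷ M ∘ suc))  ≈⟨ -‿cong (*-congˡ (c (head∷tail M))) ⟨
    - (sign j * F M)  ≈⟨ solve 2 (λ s x → :- (s :* x) := (:- con :1 :* s) :* x) refl _ _ ⟩
    sign (suc j) * F M  ∎

  insert-zero : Fin (suc N) → Row N → Row (suc N)
  insert-zero j v = V.insertAt v j 0#

  insert-zero-linear : (j : Fin (suc N)) → LinearMap (insert-zero {N} j)
  insert-zero-linear j = linearMap (coordinate j)
    where
    coordinate : ∀ {N} j k → Linear {N} (λ v → V.insertAt v j 0# k)
    coordinate {N}     zero    zero    = Linear-0
    coordinate {N}     zero    (suc k) = Linear-coordinate k
    coordinate {suc N} (suc j) zero    = Linear-coordinate zero
    coordinate {suc N} (suc j) (suc k) = Linear-∘ (coordinate j k) (linearMap (λ i → Linear-coordinate (suc i)))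

  insert-zero-basis : ∀ (j : Fin (suc N)) k → insert-zero j (basis k) ≈ᵣ basis (punchIn j k)
  insert-zero-basis {N}     zero    k       zero    = refl
  insert-zero-basis {N}     zero    k       (suc i) = refl
  insert-zero-basis {suc N} (suc j) zero    zero    = refl
  insert-zero-basis {suc N} (suc j) zero    (suc i) = insert-0 j i
    where
    insert-0 : ∀ {N} (j : Fin (suc N)) i → V.insertAt {n = N} (λ _ → 0#) j 0# i ≈ 0#
    insert-0 {N}     zero    zero    = refl
    insert-0 {N}     zero    (suc i) = refl
    insert-0 {suc N} (suc j) zero    = refl
    insert-0 {suc N} (suc j) (suc i) = insert-0 j i
  insert-zero-basis {suc N} (suc j) (suc k) zero    = refl
  insert-zero-basis {suc N} (suc j) (suc k) (suc i) = insert-zero-basis j k i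

  -- The scalar, 0 or a permutation sign, is found before the form is given, so one scalar serves
  -- all alternating forms and any form can be compared with `det`. A repetition of `σ zero` gives
  -- 0; otherwise the first row is fixed, its column is removed by `punchOut`, and `move-row`
  -- supplies the sign. Other repetitions surface in the recursion.
  basis-value : ∀ n (σ : Fin n → Fin n) → Σ[ c ∈ Carrier ]
    (∀ {F : Form n n} → Congruent F → Alternating n F → F (basis ∘ σ) ≈ c * F basis)
  basis-value zero    σ = 1# , λ c _ → trans (c λ ()) (sym (*-identityˡ _))
  basis-value (suc n) σ with Fin.any? (λ i → σ (suc i) Fin.≟ σ zero)
  ... | yes (i , e) = 0# , λ {F} c alt → trans (c (head∷tail (basis ∘ σ)))
        (trans (repeated-row n c alt _ _ i (λ k → reflexive (≡.cong (λ s → basis s k) e))) (sym (zeroˡ _)))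
  ... | no distinct = proj₁ IH * sign j , value
    where
    j : Fin (suc n)
    j = σ zero
    j≢ : ∀ i → ¬ j ≡ σ (suc i)
    j≢ i e = distinct (i , ≡.sym e)
    τ : Fin n → Fin n
    τ i = punchOut (j≢ i)
    IH : Σ[ c ∈ Carrier ] (∀ {F : Form n n} → Congruent F → Alternating n F → F (basis ∘ τ) ≈ c * F basis)
    IH = basis-value n τ
    value : ∀ {F : Form (suc n) (suc n)} → Congruent F → Alternating (suc n) F → F (basis ∘ σ) ≈ (proj₁ IH * sign j) * F basis
    value {F} c alt@(l , h , r) = begin
      F (basis ∘ σ)  ≈⟨ c rows ⟩
      F (basis j V.∷ insert-zero j ∘ basis ∘ τ)  ≈⟨ proj₂ IH restricted-cong
          (Alternating-∘ n (fix-head c (basis j)) (r (basis j)) (insert-zero-linear j)) ⟩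
      proj₁ IH * F (basis j V.∷ insert-zero j ∘ basis) ≈⟨ *-congˡ (c (∷-cong ≈ᵣ-refl (insert-zero-basis j))) ⟩
      proj₁ IH * F (basis j V.∷ basis ∘ punchIn j)  ≈⟨ *-congˡ (move-row n c alt basis j) ⟩
      proj₁ IH * (sign j * F basis)  ≈⟨ *-assoc _ _ _ ⟨
      (proj₁ IH * sign j) * F basis  ∎
      where
      restricted-cong : Congruent (λ M → F (basis j V.∷ insert-zero j ∘ M))
      restricted-cong e = c (∷-cong ≈ᵣ-refl (λ i → LinearMap.cong (insert-zero-linear j) (e i)))
      rows : (basis ∘ σ) ≈ₘ (basis j V.∷ insert-zero j ∘ basis ∘ τ)
      rows zero    = ≈ᵣ-refl
      rows (suc i) k = sym (trans (insert-zero-basis j (τ i) k)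
        (reflexive (≡.cong (λ s → basis s k) (Fin.punchIn-punchOut (j≢ i)))))

  det-zero-column : ∀ n (M : Fin (suc n) → Row (suc n)) → (∀ i → M i zero ≈ 0#) → det M ≈ 0#
  det-zero-column n M e = trans (+-cong (trans (*-congʳ (trans (*-congˡ (e zero)) (zeroʳ _))) (zeroˡ _)) (rest n M e))
      (+-identityˡ 0#)
    where
    rest : ∀ n (M : Fin (suc n) → Row (suc n)) → (∀ i → M i zero ≈ 0#) →
      sum (λ j → sign (suc j) * M zero (suc j) * det (λ i k → M (suc i) (punchIn (suc j) k))) ≈ 0#
    rest zero    M e = refl
    rest (suc n) M e = sum-zero {suc n} _ λ j → trans (*-congˡ (det-zero-column n (λ i k → M (suc i) (punchIn (suc j) k))
        (λ i → e (suc i))))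
      (zeroʳ (sign (suc j) * M zero (suc j)))

  -- The expansion runs along the first row; each minor other than the first loses the top row but
  -- keeps the first column, which has become zero.
  det-first-column : ∀ (M : Fin (suc n) → Row (suc n)) → (∀ i → M (suc i) zero ≈ 0#) →
    det M ≈ M zero zero * det (λ i k → M (suc i) (suc k))
  det-first-column {n} M e = trans (+-cong (*-congʳ (*-identityˡ _)) (rest n M e)) (+-identityʳ _)
    where
    rest : ∀ n (M : Fin (suc n) → Row (suc n)) → (∀ i → M (suc i) zero ≈ 0#) →
      sum (λ j → sign (suc j) * M zero (suc j) * det (λ i k → M (suc i) (punchIn (suc j) k))) ≈ 0#
    rest zero    M e = refl
    rest (suc n) M e = sum-zero {suc n} _ λ j → trans (*-congˡ (det-zero-column n (λ i k → M (suc i) (punchIn (suc j) k)) e))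
      (zeroʳ (sign (suc j) * M zero (suc j)))

  det-first-row : ∀ (M : Fin (suc n) → Row (suc n)) → (∀ k → M zero (suc k) ≈ 0#) →
    det M ≈ M zero zero * det (λ i k → M (suc i) (suc k))
  det-first-row {n} M e = trans (+-cong (*-congʳ (*-identityˡ _))
    (sum-zero _ λ j → trans (*-congʳ (trans (*-congˡ (e j)) (zeroʳ _))) (zeroˡ _))) (+-identityʳ _)

  det-basis : ∀ n → det {n} basis ≈ 1#
  det-basis zero    = refl
  det-basis (suc n) = trans (det-first-row {n} basis (λ k → refl)) (trans (*-identityˡ _) (det-basis n))

  alternating-unique : ∀ {n} {F : Form n n} → Congruent F → Alternating n F → ∀ M → F M ≈ det M * F basis
  alternating-unique {n} {F} c alt M =
    trans (multilinear-unique n c (λ e → *-congˡ (det-cong e)) alt (Alternating-* n (F basis) (det-alternating n)) agree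
        M) (*-comm _ _)
    where
    agree : ∀ σ → F (basis ∘ σ) ≈ F basis * det (basis ∘ σ)
    agree σ = let k , value = basis-value n σ in begin
      F (basis ∘ σ)  ≈⟨ value c alt ⟩
      k * F basis  ≈⟨ *-comm _ _ ⟩
      F basis * k  ≈⟨ *-congˡ (*-identityʳ k) ⟨
      F basis * (k * 1#)  ≈⟨ *-congˡ (*-congˡ (det-basis n)) ⟨
      F basis * (k * det {n} basis)  ≈⟨ *-congˡ (value det-cong (det-alternating n)) ⟨
      F basis * det (basis ∘ σ)  ∎

  -- Multiplicativity of the determinant. The matrix product is written as a linear map `T` applied
  -- to each row, and M ↦ det (T ∘ M) is again alternating, hence a multiple of `det`.
  det-∘ : ∀ {n} {T : Row n → Row n} → LinearMap T → ∀ M → det (T ∘ M) ≈ det M * det (T ∘ basis)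
  det-∘ {n} T M = alternating-unique (λ e → det-cong (λ i → LinearMap.cong T (e i)))
    (Alternating-∘ n det-cong (det-alternating n) T) M

module TriangularDeterminant (R : CommutativeRing 0ℓ 0ℓ) where
  open Ring R
  open Determinant R
  open Reasoning

  det-upper : ∀ n m (M : Fin (n ℕ.+ m) → Row (n ℕ.+ m)) →
    (∀ i (j : Fin n) → toℕ j ℕ.< toℕ i → M i (j ↑ˡ m) ≈ 0#) → (∀ (j : Fin n) → M (j ↑ˡ m) (j ↑ˡ m) ≈ 1#) →
    det M ≈ det (λ i k → M (n ↑ʳ i) (n ↑ʳ k))
  det-upper zero    m M below diagonal = refl
  det-upper (suc n) m M below diagonal = begin
    det M  ≈⟨ det-first-column M (λ i → below (suc i) zero (s≤s z≤n)) ⟩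
    M zero zero * det (λ i k → M (suc i) (suc k))  ≈⟨ *-congʳ (diagonal zero) ⟩
    1# * det (λ i k → M (suc i) (suc k))  ≈⟨ *-identityˡ _ ⟩
    det (λ i k → M (suc i) (suc k))  ≈⟨ det-upper n m _ (λ i j j<i → below (suc i) (suc j) (s≤s j<i)) (diagonal ∘ suc) ⟩
    det (λ i k → M (suc n ↑ʳ i) (suc n ↑ʳ k))  ∎

  det-lower : ∀ n m (M : Fin (n ℕ.+ m) → Row (n ℕ.+ m)) →
    (∀ (i : Fin n) k → toℕ i ℕ.< toℕ k → M (i ↑ˡ m) k ≈ 0#) → (∀ (j : Fin n) → M (j ↑ˡ m) (j ↑ˡ m) ≈ 1#) →
    det M ≈ det (λ i k → M (n ↑ʳ i) (n ↑ʳ k))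
  det-lower zero    m M above diagonal = refl
  det-lower (suc n) m M above diagonal = begin
    det M  ≈⟨ det-first-row M (λ k → above zero (suc k) (s≤s z≤n)) ⟩
    M zero zero * det (λ i k → M (suc i) (suc k))  ≈⟨ *-congʳ (diagonal zero) ⟩
    1# * det (λ i k → M (suc i) (suc k))  ≈⟨ *-identityˡ _ ⟩
    det (λ i k → M (suc i) (suc k))  ≈⟨ det-lower n m _ (λ i k i<k → above (suc i) (suc k) (s≤s i<k)) (diagonal ∘ suc) ⟩
    det (λ i k → M (suc n ↑ʳ i) (suc n ↑ʳ k))  ∎

  det-diagonal : ∀ n (d : Row n) → det (λ i k → basis i k * d k) ≈ prod d
  det-diagonal zero    d = refl
  det-diagonal (suc n) d = begin
    det (λ i k → basis i k * d k)  ≈⟨ det-first-row (λ i k → basis i k * d k) (λ k → zeroˡ (d (suc k))) ⟩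
    (1# * d zero) * det (λ i k → basis i k * d (suc k))  ≈⟨ *-cong (*-identityˡ _) (det-diagonal n (d ∘ suc)) ⟩
    d zero * prod (d ∘ suc)  ∎

  -- The row vector `g` times the matrix `A`; thus `combine A ∘ Z` is the matrix product Z A.
  combine : ∀ {n N} → (Fin n → Row N) → Row n → Row N
  combine A g k = sum (λ i → g i * A i k)

  combine-linear : ∀ {n N} (A : Fin n → Row N) → LinearMap (combine A)
  combine-linear A = linearMap λ k → Linear-sum λ i →
    Linear-resp (λ v → *-comm (A i k) (v i)) (Linear-* (A i k) (Linear-coordinate i))

  combine-identity : ∀ {n} (g : Row n) → combine basis g ≈ᵣ g
  combine-identity g k = sym (linear-expand (Linear-coordinate k) g)

  combine-basis : ∀ {n N} (A : Fin n → Row N) r → combine A (basis r) ≈ᵣ A r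
  combine-basis {suc n} A zero k = trans
    (+-cong (*-identityˡ _) (trans (sum-cong-≋ {n} (λ i → zeroˡ (A (suc i) k))) (sum-replicate-zero n))) (+-identityʳ _)
  combine-basis {suc n} A (suc r) k = trans (+-cong (zeroˡ (A zero k)) (combine-basis (A ∘ suc) r k)) (+-identityˡ _)

-- Evaluation and the product formula for resultants

module Horner (S : CommutativeRing 0ℓ 0ℓ) where
  open Ring S
  open Determinant S
  open Reasoning
  open Solver

  -- Reads a row as a polynomial with the highest power first, the order used in Sylvester matrices.
  horner : ∀ {N} → Carrier → Row N → Carrier
  horner {zero}  x b = 0#
  horner {suc N} x b = x ^ N * b zero + horner x (b ∘ suc)

  horner-linear : ∀ N x → Linear {N} (horner x)
  horner-linear zero    x = Linear-0
  horner-linear (suc N) x = Linear-+ (Linear-* (x ^ N) (Linear-coordinate zero))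
    (Linear-∘ (horner-linear N x) (linearMap (λ k → Linear-coordinate (suc k))))

  horner-0 : ∀ N x → horner {N} x (λ _ → 0#) ≈ 0#
  horner-0 zero    x = refl
  horner-0 (suc N) x = trans (+-cong (zeroʳ _) (horner-0 N x)) (+-identityˡ 0#)

  horner-basis : ∀ {m} x (i : Fin m) → horner x (basis i) ≈ x ^ (m ℕ.∸ suc (toℕ i))
  horner-basis {suc m} x zero    = trans (+-cong (*-identityʳ _) (horner-0 m x)) (+-identityʳ _)
  horner-basis {suc m} x (suc i) = trans (+-congʳ (zeroʳ _)) (trans (+-identityˡ _) (horner-basis x i))

  horner-basis-↑ʳ : ∀ n {m} x (i : Fin m) → horner x (basis (n ↑ʳ i)) ≈ horner x (basis i)
  horner-basis-↑ʳ zero    x i = refl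
  horner-basis-↑ʳ (suc n) x i = trans (+-congʳ (zeroʳ _)) (trans (+-identityˡ _) (horner-basis-↑ʳ n x i))

  partial : Carrier → (ℕ → Carrier) → ℕ → Carrier
  partial x c zero    = c 0
  partial x c (suc t) = c 0 + x * partial x (c ∘ suc) t

  partial-last : ∀ x c t → partial x c (suc t) ≈ x ^ suc t * c (suc t) + partial x c t
  partial-last x c zero    = trans (+-comm _ _) (+-congʳ (*-congʳ (sym (*-identityʳ x))))
  partial-last x c (suc t) = trans (+-congˡ (*-congˡ (partial-last x (c ∘ suc) t)))
    (solve 5 (λ a x y b p → a :+ x :* (y :* b :+ p) := (x :* y) :* b :+ (a :+ x :* p)) refl _ _ _ _ _)

  -- The shape of a Sylvester row: `t` is the column of the constant coefficient, and the columns to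
  -- its right are zero.
  reversed : (ℕ → Carrier) → ℕ → ℕ → Carrier
  reversed c t j = if j ≤ᵇ t then c (t ℕ.∸ j) else 0#

  horner-reversed : ∀ {N} x c t → t ℕ.< N →
    horner {N} x (reversed c t ∘ toℕ) ≈ x ^ (N ℕ.∸ suc t) * partial x c t
  horner-reversed {suc N} x c zero    _ = trans (+-congˡ (horner-0 N x)) (+-identityʳ _)
  horner-reversed {suc N} x c (suc t) (s≤s t<N) = begin
    x ^ N * c (suc t) + horner {N} x (reversed c (suc t) ∘ suc ∘ toℕ)
      ≈⟨ +-cong (*-congʳ split) (trans (Linear.cong (horner-linear N x) (shift ∘ toℕ)) (horner-reversed x c t t<N)) ⟩
    (x ^ (N ℕ.∸ suc t) * x ^ suc t) * c (suc t) + x ^ (N ℕ.∸ suc t) * partial x c t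
      ≈⟨ solve 4 (λ y z a p → (y :* z) :* a :+ y :* p := y :* (z :* a :+ p)) refl _ _ _ _ ⟩
    x ^ (N ℕ.∸ suc t) * (x ^ suc t * c (suc t) + partial x c t)
      ≈⟨ *-congˡ (partial-last x c t) ⟨
    x ^ (N ℕ.∸ suc t) * partial x c (suc t) ∎
    where
    split : x ^ N ≈ x ^ (N ℕ.∸ suc t) * x ^ suc t
    split = trans (^-congʳ x (≡.sym (ℕ.m∸n+n≡m t<N))) (^-homo-* x (N ℕ.∸ suc t) (suc t))
    shift : ∀ j → reversed c (suc t) (suc j) ≈ reversed c t j
    shift zero    = refl
    shift (suc j) = refl

module Evaluation (R : DecRawRing) (S : CommutativeRing 0ℓ 0ℓ) (φ : DecRawRing.Carrier R → CommutativeRing.Carrier S)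
  (φ-hom : IsRingHomomorphism (DecRawRing.rawRing R) (CommutativeRing.rawRing S) φ) where
  private
    module R = DecRawRing R
  open Polynomial R hiding (det; _[X])
  open Ring S
  open Reasoning
  open Solver
  open Horner S
  open IsRingHomomorphism φ-hom

  deg-bound : ∀ p k → deg p ℕ.< k → coeff p k R.≈ R.0#
  deg-bound []      k       _ = IsDecEquivalence.refl R.isDecEquivalence
  deg-bound (a ∷ p) (suc k) lt with p ≋? []
  ... | yes p≋0 = p≋0 k
  ... | no  _   = deg-bound p k (ℕ.s≤s⁻¹ lt)

  deg-unique : ∀ p n → ¬ (coeff p n R.≈ R.0#) → (∀ k → n ℕ.< k → coeff p k R.≈ R.0#) → deg p ≡ n
  deg-unique []      n       nonzero _ = contradiction (IsDecEquivalence.refl R.isDecEquivalence) nonzero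
  deg-unique (a ∷ p) zero    nonzero above with p ≋? []
  ... | yes _   = ≡.refl
  ... | no p≋̸0 = contradiction (λ k → above (suc k) (s≤s z≤n)) p≋̸0
  deg-unique (a ∷ p) (suc n) nonzero above with p ≋? []
  ... | yes p≋0 = contradiction (p≋0 n) nonzero
  ... | no _    = ≡.cong suc (deg-unique p n nonzero (λ k n<k → above (suc k) (s≤s n<k)))

  eval : Carrier → Poly → Carrier
  eval x []      = 0#
  eval x (a ∷ p) = φ a + x * eval x p

  eval-0 : ∀ x p → p ≋ [] → eval x p ≈ 0#
  eval-0 x []      e = refl
  eval-0 x (a ∷ p) e = trans (+-cong (trans (⟦⟧-cong (e 0)) 0#-homo) (trans (*-congˡ (eval-0 x p (e ∘ suc))) (zeroʳ x)))
      (+-identityˡ 0#)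

  -- Row i of a band starts with i zeros, read as coefficients beyond the degree, so `t` will be deg
  -- p + i rather than deg p.
  eval-partial : ∀ x p t → (∀ k → t ℕ.< k → coeff p k R.≈ R.0#) → partial x (φ ∘ coeff p) t ≈ eval x p
  eval-partial x []      zero    _ = 0#-homo
  eval-partial x []      (suc t) _ = trans (+-cong 0#-homo (trans (*-congˡ (eval-partial x [] t
    (λ _ _ → IsDecEquivalence.refl R.isDecEquivalence))) (zeroʳ x))) (+-identityˡ 0#)
  eval-partial x (a ∷ p) zero    above = sym (trans (+-congˡ (trans (*-congˡ (eval-0 x p (λ k → above (suc k) (s≤s z≤n))))
      (zeroʳ x))) (+-identityʳ _))
  eval-partial x (a ∷ p) (suc t) above = +-congˡ (*-congˡ (eval-partial x p t (λ k t<k → above (suc k) (s≤s t<k))))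

  eval-⊕ : ∀ x p q → eval x (p ⊕ q) ≈ eval x p + eval x q
  eval-⊕ x []      q       = sym (+-identityˡ _)
  eval-⊕ x (a ∷ p) []      = sym (+-identityʳ _)
  eval-⊕ x (a ∷ p) (b ∷ q) = trans (+-cong (+-homo a b) (*-congˡ (eval-⊕ x p q)))
    (solve 5 (λ a b x p q → (a :+ b) :+ x :* (p :+ q) := (a :+ x :* p) :+ (b :+ x :* q)) refl _ _ x _ _)

  eval-scale : ∀ x a p → eval x (List.map (a R.*_) p) ≈ φ a * eval x p
  eval-scale x a []      = sym (zeroʳ _)
  eval-scale x a (b ∷ p) = trans (+-cong (*-homo a b) (*-congˡ (eval-scale x a p)))
    (solve 4 (λ a b x p → a :* b :+ x :* (a :* p) := a :* (b :+ x :* p)) refl _ _ x _)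

  eval-⊛ : ∀ x p q → eval x (p ⊛ q) ≈ eval x p * eval x q
  eval-⊛ x []      q = sym (zeroˡ _)
  eval-⊛ x (a ∷ p) q = begin
    eval x (List.map (a R.*_) q ⊕ (R.0# ∷ p ⊛ q))  ≈⟨ eval-⊕ x (List.map (a R.*_) q) (R.0# ∷ p ⊛ q) ⟩
    eval x (List.map (a R.*_) q) + (φ R.0# + x * eval x (p ⊛ q)) ≈⟨ +-cong (eval-scale x a q)
        (+-cong 0#-homo (*-congˡ (eval-⊛ x p q))) ⟩
    φ a * eval x q + (0# + x * (eval x p * eval x q))  ≈⟨ solve 4 (λ a x p q → a :* q :+ (con :0 :+ x :* (p :* q)) :=
        (a :+ x :* p) :* q) refl _ x _ _ ⟩
    (φ a + x * eval x p) * eval x q  ∎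

  eval-neg : ∀ x p → eval x (List.map R.-_ p) ≈ - eval x p
  eval-neg x []      = sym -0#≈0#
  eval-neg x (a ∷ p) = trans (+-cong (-‿homo a) (*-congˡ (eval-neg x p)))
    (solve 3 (λ a x p → :- a :+ x :* :- p := :- (a :+ x :* p)) refl _ x _)

  eval-const : ∀ x a → eval x (const a) ≈ φ a
  eval-const x a = trans (+-congˡ (zeroʳ x)) (+-identityʳ _)

  eval-X : ∀ x → eval x X ≈ x
  eval-X x = trans (+-cong 0#-homo (*-congˡ (trans (eval-const x R.1#) 1#-homo))) (trans (+-identityˡ _) (*-identityʳ x))

  eval-cong : ∀ x {p q} → p ≋ q → eval x p ≈ eval x q
  eval-cong x {[]}    {q}     e = sym (eval-0 x q (λ k → ≈.sym (e k)))
    where module ≈ = IsDecEquivalence R.isDecEquivalence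
  eval-cong x {a ∷ p} {[]}    e = eval-0 x (a ∷ p) e
  eval-cong x {a ∷ p} {b ∷ q} e = +-cong (⟦⟧-cong (e 0)) (*-congˡ (eval-cong x {p} {q} (e ∘ suc)))

  eval-hom : ∀ x → IsRingHomomorphism (DecRawRing.rawRing (R [X])) rawRing (eval x)
  eval-hom x = ringHomomorphism (λ {p} {q} → eval-cong x {p} {q}) (eval-⊕ x) refl (eval-⊛ x)
    (trans (eval-const x R.1#) 1#-homo) (eval-neg x)

  eval-binomial : ∀ x c n → eval x (Q (R [X]) (const c) X n) ≈ x ^ n - φ c ^ n
  eval-binomial x c n = trans (eval-⊕ x (X ^ₚ n) (-ₚ (const c ^ₚ n))) (+-cong
    (trans (H.^-homo X n) (^-congˡ n (eval-X x)))
    (trans (eval-neg x (const c ^ₚ n)) (-‿cong (trans (H.^-homo (const c) n) (^-congˡ n (eval-const x c))))))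
    where
    open DecRawRing (R [X]) using () renaming (_^_ to _^ₚ_; -_ to -ₚ_)
    module H = Homomorphism (DecRawRing.rawRing (R [X])) S (eval x) (eval-hom x)

module ResultantProduct (R : DecRawRing) (S : CommutativeRing 0ℓ 0ℓ) (φ : DecRawRing.Carrier R → CommutativeRing.Carrier S)
  (φ-hom : IsRingHomomorphism (DecRawRing.rawRing R) (CommutativeRing.rawRing S) φ) where
  private
    module R = DecRawRing R
    module ≈R = IsDecEquivalence R.isDecEquivalence
    module P = Polynomial R
  open P using (Poly; coeff; deg; band; sylvester; Res)
  open Evaluation R S φ φ-hom using (deg-bound; eval; eval-partial)
  open Ring S
  open Determinant S
  open TriangularDeterminant S
  open Horner S
  open Homomorphism R.rawRing S φ φ-hom
  open IsRingHomomorphism φ-hom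
  open Reasoning

  det-homo : ∀ {n} (M : P.Matrix n) → φ (P.det M) ≈ det (λ i j → φ (M i j))
  det-homo {zero}  M = 1#-homo
  det-homo {suc n} M = trans (sum-homo {suc n} (λ j → (R.- R.1#) R.^ toℕ j R.* M zero j R.* P.det (minor j)))
    (sum-cong-≋ {suc n} term)
    where
    minor : Fin (suc n) → P.Matrix n
    minor j i k = M (suc i) (punchIn j k)
    term : ∀ j → φ ((R.- R.1#) R.^ toℕ j R.* M zero j R.* P.det (minor j)) ≈
                 sign j * φ (M zero j) * det (λ i k → φ (minor j i k))
    term j = begin
      φ ((R.- R.1#) R.^ toℕ j R.* M zero j R.* P.det (minor j))  ≈⟨ *-homo _ _ ⟩
      φ ((R.- R.1#) R.^ toℕ j R.* M zero j) * φ (P.det (minor j))  ≈⟨ *-cong (*-homo _ _) (det-homo (minor j)) ⟩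
      φ ((R.- R.1#) R.^ toℕ j) * φ (M zero j) * det (λ i k → φ (minor j i k))
        ≈⟨ *-congʳ (*-congʳ (trans (^-homo (R.- R.1#) (toℕ j)) (^-congˡ (toℕ j) (trans (-‿homo R.1#) (-‿cong 1#-homo))))) ⟩
      sign j * φ (M zero j) * det (λ i k → φ (minor j i k))  ∎

  private
    φ-band : ∀ p i j → φ (band p i j) ≈ reversed (φ ∘ coeff p) (deg p ℕ.+ i) j
    φ-band p i j with j ≤ᵇ deg p ℕ.+ i
    ... | true  = refl
    ... | false = 0#-homo

  horner-band : ∀ {N} x p i → deg p ℕ.+ i ℕ.< N →
    horner {N} x (λ j → φ (band p i (toℕ j))) ≈ x ^ (N ℕ.∸ suc (deg p ℕ.+ i)) * eval x p
  horner-band {N} x p i lt = begin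
    horner {N} x (λ j → φ (band p i (toℕ j)))  ≈⟨ Linear.cong (horner-linear N x) (λ j → φ-band p i (toℕ j)) ⟩
    horner {N} x (reversed (φ ∘ coeff p) (deg p ℕ.+ i) ∘ toℕ)  ≈⟨ horner-reversed x (φ ∘ coeff p) (deg p ℕ.+ i) lt ⟩
    x ^ (N ℕ.∸ suc (deg p ℕ.+ i)) * partial x (φ ∘ coeff p) (deg p ℕ.+ i)
      ≈⟨ *-congˡ (eval-partial x p (deg p ℕ.+ i) (λ k lt → deg-bound p k (ℕ.≤-trans (s≤s (ℕ.m≤m+n (deg p) i)) lt))) ⟩
    x ^ (N ℕ.∸ suc (deg p ℕ.+ i)) * eval x p ∎

  module _ (p q : Poly) (monic : φ (coeff p (deg p)) ≈ 1#) (α : Fin (deg p) → Carrier)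
    (roots : ∀ c → eval (α c) p ≈ 0#) where
    private
      m n : ℕ
      m = deg p
      n = deg q

      vandermonde : Fin m → Row m
      vandermonde i c = α c ^ (m ℕ.∸ suc (toℕ i))

      Syl : Fin (n ℕ.+ m) → Row (n ℕ.+ m)
      Syl i j = φ (sylvester p q i j)

      top : ∀ r j → Syl (r ↑ˡ m) j ≡ φ (band p (toℕ r) (toℕ j))
      top r j rewrite Fin.splitAt-↑ˡ n r m = ≡.refl

      bottom : ∀ r j → Syl (n ↑ʳ r) j ≡ φ (band q (toℕ r) (toℕ j))
      bottom r j rewrite Fin.splitAt-↑ʳ n m r = ≡.refl

      -- Keeps the first n coefficients of a row and replaces the other m by the values at the
      -- roots. In the monomial basis this is block triangular with an identity block and the
      -- Vandermonde block, so its determinant is that of the latter.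
      evaluate : Row (n ℕ.+ m) → Row (n ℕ.+ m)
      evaluate g = (λ c → g (c ↑ˡ m)) V.++ (λ c → horner (α c) g)

      evaluate-linear : LinearMap evaluate
      evaluate-linear = linearMap coordinate
        where
        coordinate : ∀ k → Linear (λ g → evaluate g k)
        coordinate k with splitAt n k
        ... | inj₁ c = Linear-coordinate (c ↑ˡ m)
        ... | inj₂ c = horner-linear (n ℕ.+ m) (α c)

      evaluate-↑ˡ : ∀ g c → evaluate g (c ↑ˡ m) ≡ g (c ↑ˡ m)
      evaluate-↑ˡ g = V.lookup-++ˡ (λ c → g (c ↑ˡ m)) (λ c → horner (α c) g)

      evaluate-↑ʳ : ∀ g c → evaluate g (n ↑ʳ c) ≡ horner (α c) g
      evaluate-↑ʳ g = V.lookup-++ʳ (λ c → g (c ↑ˡ m)) (λ c → horner (α c) g)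

      det-evaluate : det (evaluate ∘ basis) ≈ det vandermonde
      det-evaluate = trans
        (det-upper n m (evaluate ∘ basis)
          (λ i j j<i → trans (reflexive (evaluate-↑ˡ (basis i) j)) (basis-off-diagonal i (j ↑ˡ m)
            λ { ≡.refl → ℕ.<-irrefl ≡.refl (≡.subst (toℕ j ℕ.<_) (Fin.toℕ-↑ˡ j m) j<i) }))
          (λ j → trans (reflexive (evaluate-↑ˡ (basis (j ↑ˡ m)) j)) (basis-diagonal (j ↑ˡ m))))
        (det-cong λ i k → trans (reflexive (evaluate-↑ʳ (basis (n ↑ʳ i)) k))
          (trans (horner-basis-↑ʳ n (α k) i) (horner-basis (α k) i)))

      -- Because p vanishes at the α c, the matrix evaluate ∘ Syl is block lower triangular and
      -- equals the product Z A, where Z is unitriangular.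
      Z A : Fin (n ℕ.+ m) → Row (n ℕ.+ m)
      Z = (λ r → evaluate (Syl (r ↑ˡ m))) V.++ (λ r → basis (n ↑ʳ r))
      A = (λ r → basis (r ↑ˡ m)) V.++ (λ r → evaluate (Syl (n ↑ʳ r)))

      Z-↑ˡ : ∀ r → Z (r ↑ˡ m) ≡ evaluate (Syl (r ↑ˡ m))
      Z-↑ˡ = V.lookup-++ˡ (λ r → evaluate (Syl (r ↑ˡ m))) (λ r → basis (n ↑ʳ r))
      Z-↑ʳ : ∀ r → Z (n ↑ʳ r) ≡ basis (n ↑ʳ r)
      Z-↑ʳ = V.lookup-++ʳ (λ r → evaluate (Syl (r ↑ˡ m))) (λ r → basis (n ↑ʳ r))
      A-↑ˡ : ∀ r → A (r ↑ˡ m) ≡ basis (r ↑ˡ m)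
      A-↑ˡ = V.lookup-++ˡ (λ r → basis (r ↑ˡ m)) (λ r → evaluate (Syl (n ↑ʳ r)))
      A-↑ʳ : ∀ r → A (n ↑ʳ r) ≡ evaluate (Syl (n ↑ʳ r))
      A-↑ʳ = V.lookup-++ʳ (λ r → basis (r ↑ˡ m)) (λ r → evaluate (Syl (n ↑ʳ r)))

      data Split : Fin (n ℕ.+ m) → Set where
        left  : ∀ r → Split (r ↑ˡ m)
        right : ∀ r → Split (n ↑ʳ r)

      split : ∀ i → Split i
      split i with splitAt n i in eq
      ... | inj₁ r = ≡.subst Split (Fin.splitAt⁻¹-↑ˡ eq) (left r)
      ... | inj₂ r = ≡.subst Split (Fin.splitAt⁻¹-↑ʳ eq) (right r)

      top-roots : ∀ r c → evaluate (Syl (r ↑ˡ m)) (n ↑ʳ c) ≈ 0#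
      top-roots r c = begin
        evaluate (Syl (r ↑ˡ m)) (n ↑ʳ c)  ≡⟨ evaluate-↑ʳ (Syl (r ↑ˡ m)) c ⟩
        horner (α c) (Syl (r ↑ˡ m))  ≈⟨ Linear.cong (horner-linear (n ℕ.+ m) (α c)) (λ j → reflexive (top r j)) ⟩
        horner {n ℕ.+ m} (α c) (λ j → φ (band p (toℕ r) (toℕ j)))  ≈⟨ horner-band (α c) p (toℕ r) bound ⟩
        α c ^ (n ℕ.+ m ℕ.∸ suc (m ℕ.+ toℕ r)) * eval (α c) p  ≈⟨ *-congˡ (roots c) ⟩
        α c ^ (n ℕ.+ m ℕ.∸ suc (m ℕ.+ toℕ r)) * 0#  ≈⟨ zeroʳ _ ⟩
        0#  ∎
        where
        bound : m ℕ.+ toℕ r ℕ.< n ℕ.+ m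
        bound = ≡.subst (m ℕ.+ toℕ r ℕ.<_) (ℕ.+-comm m n) (ℕ.+-monoʳ-< m (Fin.toℕ<n r))

      combine-Z : ∀ i → combine A (Z i) ≈ᵣ evaluate (Syl i)
      combine-Z i k with split i
      ... | right r = begin
        combine A (Z (n ↑ʳ r)) k  ≡⟨ ≡.cong (λ z → combine A z k) (Z-↑ʳ r) ⟩
        combine A (basis (n ↑ʳ r)) k  ≈⟨ combine-basis A (n ↑ʳ r) k ⟩
        A (n ↑ʳ r) k  ≡⟨ ≡.cong (λ a → a k) (A-↑ʳ r) ⟩
        evaluate (Syl (n ↑ʳ r)) k  ∎
      ... | left r = begin
        combine A (Z (r ↑ˡ m)) k  ≡⟨ ≡.cong (λ z → combine A z k) (Z-↑ˡ r) ⟩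
        combine A g k  ≈⟨ sum-cong-≋ {n ℕ.+ m} term ⟩
        combine basis g k  ≈⟨ combine-identity g k ⟩
        g k  ∎
        where
        g : Row (n ℕ.+ m)
        g = evaluate (Syl (r ↑ˡ m))
        term : ∀ i → g i * A i k ≈ g i * basis i k
        term i with split i
        ... | left s  = *-congˡ (reflexive (≡.cong (λ a → a k) (A-↑ˡ s)))
        ... | right s = trans (trans (*-congʳ (top-roots r s)) (zeroˡ _)) (sym (trans (*-congʳ (top-roots r s)) (zeroˡ _)))

      det-Z : det Z ≈ 1#
      det-Z = trans (det-upper n m Z below diagonal)
        (trans (det-cong (λ i k → trans (reflexive (≡.cong (λ z → z (n ↑ʳ k)) (Z-↑ʳ i))) (shifted n i k))) (det-basis m))
        where
        shifted : ∀ n {m} (i k : Fin m) → basis (n ↑ʳ i) (n ↑ʳ k) ≈ basis i k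
        shifted zero    i k = refl
        shifted (suc n) i k = shifted n i k
        entry : ∀ r c → Z (r ↑ˡ m) (c ↑ˡ m) ≈ reversed (φ ∘ coeff p) (m ℕ.+ toℕ r) (toℕ c)
        entry r c = begin
          Z (r ↑ˡ m) (c ↑ˡ m)  ≡⟨ ≡.cong (λ z → z (c ↑ˡ m)) (Z-↑ˡ r) ⟩
          evaluate (Syl (r ↑ˡ m)) (c ↑ˡ m)  ≡⟨ evaluate-↑ˡ (Syl (r ↑ˡ m)) c ⟩
          Syl (r ↑ˡ m) (c ↑ˡ m)  ≡⟨ top r (c ↑ˡ m) ⟩
          φ (band p (toℕ r) (toℕ (c ↑ˡ m)))  ≡⟨ ≡.cong (φ ∘ band p (toℕ r)) (Fin.toℕ-↑ˡ c m) ⟩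
          φ (band p (toℕ r) (toℕ c))  ≈⟨ φ-band p (toℕ r) (toℕ c) ⟩
          reversed (φ ∘ coeff p) (m ℕ.+ toℕ r) (toℕ c) ∎
        reversed-≤ : ∀ (c : ℕ → Carrier) t j → j ℕ.≤ t → reversed c t j ≡ c (t ℕ.∸ j)
        reversed-≤ c t j j≤t with j ≤ᵇ t | ℕ.≤⇒≤ᵇ j≤t
        ... | true | _ = ≡.refl
        below : ∀ i (j : Fin n) → toℕ j ℕ.< toℕ i → Z i (j ↑ˡ m) ≈ 0#
        below i j j<i with split i
        -- Left of the diagonal the entry is the coefficient of p at m + r - j, an index beyond the
        -- degree m; on the diagonal it is the leading coefficient.
        ... | left r = trans (entry r j) (trans (reflexive (reversed-≤ (φ ∘ coeff p) (m ℕ.+ toℕ r) (toℕ j)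
            (ℕ.≤-trans (ℕ.<⇒≤ j<r) (ℕ.m≤n+m _ m))))
            (trans (⟦⟧-cong (deg-bound p _ (≡.subst (m ℕ.<_) (≡.sym (ℕ.+-∸-assoc m (ℕ.<⇒≤ j<r)))
                (ℕ.m<m+n m (ℕ.m<n⇒0<n∸m j<r))))) 0#-homo))
          where
          j<r : toℕ j ℕ.< toℕ r
          j<r = ≡.subst (toℕ j ℕ.<_) (Fin.toℕ-↑ˡ r m) j<i
        ... | right r = trans (reflexive (≡.cong (λ z → z (j ↑ˡ m)) (Z-↑ʳ r))) (basis-off-diagonal (n ↑ʳ r) (j ↑ˡ m)
          λ e → ℕ.<-irrefl (≡.trans (≡.sym (Fin.toℕ-↑ˡ j m)) (≡.cong toℕ (≡.sym e))) j<i)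
        diagonal : ∀ (j : Fin n) → Z (j ↑ˡ m) (j ↑ˡ m) ≈ 1#
        diagonal j = trans (entry j j) (trans (reflexive (≡.trans (reversed-≤ (φ ∘ coeff p) (m ℕ.+ toℕ j) (toℕ j) (ℕ.m≤n+m _ m))
          (≡.cong (φ ∘ coeff p) (ℕ.m+n∸n≡m m (toℕ j))))) monic)

      det-A : det A ≈ det vandermonde * prod (λ c → eval (α c) q)
      det-A = begin
        det A  ≈⟨ det-lower n m A above diagonal ⟩
        det (λ i k → A (n ↑ʳ i) (n ↑ʳ k))  ≈⟨ det-cong values ⟩
        det (scale-columns ∘ vandermonde)  ≈⟨ det-∘ scale-linear vandermonde ⟩
        det vandermonde * det (scale-columns ∘ basis)  ≈⟨ *-congˡ (det-diagonal m (λ c → eval (α c) q)) ⟩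
        det vandermonde * prod (λ c → eval (α c) q)  ∎
        where
        scale-columns : Row m → Row m
        scale-columns v c = v c * eval (α c) q
        scale-linear : LinearMap scale-columns
        scale-linear = linearMap λ k → Linear-resp (λ v → *-comm _ (v k)) (Linear-* (eval (α k) q) (Linear-coordinate k))
        above : ∀ (i : Fin n) k → toℕ i ℕ.< toℕ k → A (i ↑ˡ m) k ≈ 0#
        above i k i<k = trans (reflexive (≡.cong (λ a → a k) (A-↑ˡ i))) (basis-off-diagonal (i ↑ˡ m) k
          λ { ≡.refl → ℕ.<-irrefl (≡.sym (Fin.toℕ-↑ˡ i m)) i<k })
        diagonal : ∀ (j : Fin n) → A (j ↑ˡ m) (j ↑ˡ m) ≈ 1#
        diagonal j = trans (reflexive (≡.cong (λ a → a (j ↑ˡ m)) (A-↑ˡ j))) (basis-diagonal (j ↑ˡ m))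
        values : ∀ i k → A (n ↑ʳ i) (n ↑ʳ k) ≈ vandermonde i k * eval (α k) q
        values i k = begin
          A (n ↑ʳ i) (n ↑ʳ k)  ≡⟨ ≡.cong (λ a → a (n ↑ʳ k)) (A-↑ʳ i) ⟩
          evaluate (Syl (n ↑ʳ i)) (n ↑ʳ k)  ≡⟨ evaluate-↑ʳ (Syl (n ↑ʳ i)) k ⟩
          horner (α k) (Syl (n ↑ʳ i))  ≈⟨ Linear.cong (horner-linear (n ℕ.+ m) (α k)) (λ j → reflexive (bottom i j)) ⟩
          horner {n ℕ.+ m} (α k) (λ j → φ (band q (toℕ i) (toℕ j))) ≈⟨ horner-band (α k) q (toℕ i) (ℕ.+-monoʳ-< n (Fin.toℕ<n i)) ⟩
          α k ^ (n ℕ.+ m ℕ.∸ suc (n ℕ.+ toℕ i)) * eval (α k) q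
            ≡⟨ ≡.cong (λ e → α k ^ e * eval (α k) q) (≡.trans (≡.cong (n ℕ.+ m ℕ.∸_) (≡.sym (ℕ.+-suc n (toℕ i))))
                (ℕ.[m+n]∸[m+o]≡n∸o n m (suc (toℕ i)))) ⟩
          vandermonde i k * eval (α k) q  ∎

    -- Multiplying `Syl` by `evaluate` brings in the Vandermonde determinant, and the factorisation
    -- through `Z` and `A` produces it a second time; `u` cancels it. The matrix is built from the
    -- degree of `q` before `φ` is applied: a leading coefficient of `q` killed by `φ` does no harm,
    -- since `p` stays monic.
    resultant-product : (∃ λ u → u * det (λ (i c : Fin (deg p)) → α c ^ (deg p ℕ.∸ suc (toℕ i))) ≈ 1#) →
      φ (Res p q) ≈ prod (λ c → eval (α c) q)
    resultant-product (u , u-inverse) = begin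
      φ (Res p q)  ≈⟨ det-homo (sylvester p q) ⟩
      det Syl  ≈⟨ cancel _ ⟨
      u * (det vandermonde * det Syl)  ≈⟨ *-congˡ (*-comm _ _) ⟩
      u * (det Syl * det vandermonde)  ≈⟨ *-congˡ (*-congˡ det-evaluate) ⟨
      u * (det Syl * det (evaluate ∘ basis))  ≈⟨ *-congˡ (det-∘ evaluate-linear Syl) ⟨
      u * det (evaluate ∘ Syl)  ≈⟨ *-congˡ (det-cong combine-Z) ⟨
      u * det (combine A ∘ Z)  ≈⟨ *-congˡ (det-∘ (combine-linear A) Z) ⟩
      u * (det Z * det (combine A ∘ basis))  ≈⟨ *-congˡ (trans (*-congʳ det-Z) (*-identityˡ _)) ⟩
      u * det (combine A ∘ basis)  ≈⟨ *-congˡ (det-cong (combine-basis A)) ⟩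
      u * det A  ≈⟨ *-congˡ det-A ⟩
      u * (det vandermonde * prod (λ c → eval (α c) q)) ≈⟨ cancel _ ⟩
      prod (λ c → eval (α c) q)  ∎
      where
      cancel : ∀ x → u * (det vandermonde * x) ≈ x
      cancel x = trans (sym (*-assoc _ _ _)) (trans (*-congʳ u-inverse) (*-identityˡ x))

  resultant-product-deg : ∀ (p q : Poly) m → deg p ≡ m → φ (coeff p m) ≈ 1# → (α : Fin m → Carrier) → (∀ c → eval (α c) p ≈ 0#) →
    (∃ λ u → u * det (λ (i c : Fin m) → α c ^ (m ℕ.∸ suc (toℕ i))) ≈ 1#) →
    φ (Res p q) ≈ prod (λ c → eval (α c) q)
  resultant-product-deg p q _ ≡.refl = resultant-product p q

-- The spectral determinant

module SeriesEmbedding (R : DecRawRing) (S : CommutativeRing 0ℓ 0ℓ) (ψ : DecRawRing.Carrier R → CommutativeRing.Carrier S)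
  (ψ-hom : IsRingHomomorphism (DecRawRing.rawRing R) (CommutativeRing.rawRing S) ψ) where
  private
    module R = DecRawRing R
    module S = Ring S
    module P = Polynomial R
    module ψ = IsRingHomomorphism ψ-hom
  open Series S using (Series; constant; var; var-*-suc; constant-hom; Monic; Monic-cong; Monic-+; Monic-var^;
    Below-neg; Below-≤; Below-cong; Below-constant) renaming (ring to series; module S to T)

  constant-ψ-hom : IsRingHomomorphism R.rawRing T.rawRing (constant ∘ ψ)
  constant-ψ-hom = Composition.isRingHomomorphism (λ {f} {g} {h} → T.trans {f} {g} {h}) ψ-hom constant-hom

  open Evaluation R series (constant ∘ ψ) constant-ψ-hom using (eval; eval-hom; eval-binomial; eval-const; eval-X; deg-unique) public

  -- Evaluating at the variable itself maps list polynomials to series, so the homomorphism property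
  -- is a case of `eval-hom`, and injectivity can be checked coefficientwise.
  expand : P.Poly → Series
  expand = eval var

  expand-hom : IsRingHomomorphism (DecRawRing.rawRing (R [X])) T.rawRing expand
  expand-hom = eval-hom var

  expand-coeff : ∀ p k → expand p k S.≈ ψ (P.coeff p k)
  expand-coeff []      k       = S.sym ψ.0#-homo
  expand-coeff (a ∷ p) zero    = S.trans (S.+-congˡ (S.zeroˡ _)) (S.+-identityʳ _)
  expand-coeff (a ∷ p) (suc k) = S.trans (S.+-identityˡ _) (S.trans (var-*-suc (expand p) k) (expand-coeff p k))

  module _ (injective : ∀ {x y} → ψ x S.≈ ψ y → x R.≈ y) where

    expand-injective : ∀ {p q} → expand p T.≈ expand q → p P.≋ q
    expand-injective {p} {q} e k = injective (S.trans (S.sym (expand-coeff p k)) (S.trans (e k) (expand-coeff q k)))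

    module _ (c : R.Carrier) (n : ℕ) where
      private
        module C = Homomorphism S.rawRing series constant constant-hom
        binomial : P.Poly
        binomial = Q (R [X]) (P.const c) P.X (suc n)

        binomial-monic : Monic (suc n) (expand binomial)
        binomial-monic = Monic-cong (T.sym expansion)
          (Monic-+ (Monic-var^ (suc n)) (Below-neg (Below-≤ (s≤s z≤n) (Below-constant (ψ c S.^ suc n)))))
          where
          expansion : expand binomial T.≈ var T.^ suc n T.- constant (ψ c S.^ suc n)
          expansion = T.trans (eval-binomial var c (suc n)) (T.+-congˡ (T.-‿cong (T.sym (C.^-homo (ψ c) (suc n)))))

      -- The power computed by list arithmetic is not unfolded: its leading coefficient is read off
      -- from the monic series that it expands to.
      binomial-leading : P.coeff binomial (suc n) R.≈ R.1#
      binomial-leading = injective (S.trans (S.sym (expand-coeff binomial (suc n)))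
          (S.trans (proj₁ binomial-monic) (S.sym ψ.1#-homo)))

      binomial-deg : ¬ S.1# S.≈ S.0# → P.deg binomial ≡ suc n
      binomial-deg 1≉0 = deg-unique binomial (suc n)
        (λ e → 1≉0 (S.trans (S.sym (proj₁ binomial-monic)) (S.trans (expand-coeff binomial (suc n))
            (S.trans (ψ.⟦⟧-cong e) ψ.0#-homo))))
        (λ k n<k → injective (S.trans (S.sym (expand-coeff binomial k)) (S.trans (proj₂ binomial-monic k n<k) (S.sym ψ.0#-homo))))

-- Each level of the tower ℚ(i)[w][u][v] is embedded in iterated power series over ℚ(i), where
-- degree and leading coefficient of the two binomials are visible.
module Defining (n : ℕ) where
  private
    module G = Ring Gaussian.ring
    module E₀ = SeriesEmbedding ℚ⟨i⟩-ring Gaussian.ring id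
      (ringHomomorphism id (λ _ _ → ≡.refl) ≡.refl (λ _ _ → ≡.refl) ≡.refl (λ _ → ≡.refl))
    module E₁ = SeriesEmbedding Rw (Series.ring Gaussian.ring) E₀.expand E₀.expand-hom
    module E₂ = SeriesEmbedding Ru (Series.ring (Series.ring Gaussian.ring)) E₁.expand E₁.expand-hom
    1≢0 : ¬ G.1# ≡ G.0#
    1≢0 ()

  iᵤ : DecRawRing.Carrier Rw
  iᵤ = Pw.const 𝕚
  iᵥ : DecRawRing.Carrier Ru
  iᵥ = Pu.const iᵤ

  Qᵤ : Pu.Poly
  Qᵤ = Q Ru (Pu.const iᵤ) Pu.X (suc n)
  Qᵥ : Pv.Poly
  Qᵥ = Q Rv (Pv.const iᵥ) Pv.X (suc n)

  leadingᵤ : Pu.coeff Qᵤ (suc n) Pw.≋ Pw.const G.1#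
  leadingᵤ = E₁.binomial-leading (λ {p} {q} → E₀.expand-injective id {p} {q}) iᵤ n
  degᵤ : Pu.deg Qᵤ ≡ suc n
  degᵤ = E₁.binomial-deg (λ {p} {q} → E₀.expand-injective id {p} {q}) iᵤ n (λ e → 1≢0 (e 0))

  leadingᵥ : Pv.coeff Qᵥ (suc n) Pu.≋ Pu.const (Pw.const G.1#)
  leadingᵥ = E₂.binomial-leading (λ {p} {q} → E₁.expand-injective (λ {p} {q} → E₀.expand-injective id {p} {q}) {p} {q}) iᵥ n
  degᵥ : Pv.deg Qᵥ ≡ suc n
  degᵥ = E₂.binomial-deg (λ {p} {q} → E₁.expand-injective (λ {p} {q} → E₀.expand-injective id {p} {q}) {p} {q}) iᵥ n
      (λ e → 1≢0 (e 0 0))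

-- Residues modulo m, roots of unity and the resultant as a product

module Cyclic (m-1 : ℕ) where
  m : ℕ
  m = suc m-1

  private
    ∣a+b⇒a≡b : ∀ x (a b : Fin m) → toℕ a ℕ.≤ toℕ b → m ℕ.∣ x ℕ.+ toℕ a → m ℕ.∣ x ℕ.+ toℕ b → toℕ a ≡ toℕ b
    ∣a+b⇒a≡b x a b a≤b m∣x+a m∣x+b = ≡.trans (≡.sym (ℕ.+-identityʳ _))
        (≡.trans (≡.cong (toℕ a ℕ.+_) (≡.sym (d≡0 _ d<m m∣d))) (ℕ.m+[n∸m]≡n a≤b))
      where
      d : ℕ
      d = toℕ b ℕ.∸ toℕ a
      d<m : d ℕ.< m
      d<m = ℕ.≤-<-trans (ℕ.m∸n≤m (toℕ b) (toℕ a)) (Fin.toℕ<n b)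
      m∣d : m ℕ.∣ d
      m∣d = ℕ.∣m+n∣m⇒∣n (≡.subst (m ℕ.∣_) (≡.trans (≡.cong (x ℕ.+_) (≡.sym (ℕ.m+[n∸m]≡n a≤b)))
          (≡.sym (ℕ.+-assoc x (toℕ a) d))) m∣x+b) m∣x+a
      d≡0 : ∀ d → d ℕ.< m → m ℕ.∣ d → d ≡ 0
      d≡0 zero    _   _   = ≡.refl
      d≡0 (suc d) d<m m∣d = contradiction m∣d (ℕ.>⇒∤ d<m)

  residue-unique : ∀ x {a b : Fin m} → m ℕ.∣ x ℕ.+ toℕ a → m ℕ.∣ x ℕ.+ toℕ b → a ≡ b
  residue-unique x {a} {b} m∣x+a m∣x+b with ℕ.≤-total (toℕ a) (toℕ b)
  ... | inj₁ a≤b = Fin.toℕ-injective (∣a+b⇒a≡b x a b a≤b m∣x+a m∣x+b)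
  ... | inj₂ b≤a = ≡.sym (Fin.toℕ-injective (∣a+b⇒a≡b x b a b≤a m∣x+b m∣x+a))

  -- The representative of - (a + b).
  third : Fin m → Fin m → Fin m
  third a b = fromℕ< (ℕ.m%n<n ((toℕ a ℕ.+ toℕ b) ℕ.* m-1) m)

  Zero-sum : Fin m → Fin m → Fin m → Set
  Zero-sum a b c = m ℕ.∣ toℕ a ℕ.+ toℕ b ℕ.+ toℕ c

  third-zero-sum : ∀ a b → Zero-sum a b (third a b)
  third-zero-sum a b = ≡.subst (λ r → m ℕ.∣ s ℕ.+ r) (≡.sym (Fin.toℕ-fromℕ< _))
    (ℕ.∣m+n∣m⇒∣n {n = s ℕ.+ k ℕ.% m} (≡.subst (m ℕ.∣_) total (ℕ.m∣m*n s)) (ℕ.n∣m*n (k ℕ./ m)))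
    where
    s k : ℕ
    s = toℕ a ℕ.+ toℕ b
    k = s ℕ.* m-1
    open ≡.≡-Reasoning
    total : m ℕ.* s ≡ (k ℕ./ m) ℕ.* m ℕ.+ (s ℕ.+ k ℕ.% m)
    total = begin
      m ℕ.* s  ≡⟨ ≡.cong (s ℕ.+_) (ℕ.*-comm m-1 s) ⟩
      s ℕ.+ k  ≡⟨ ≡.cong (s ℕ.+_) (ℕ.m≡m%n+[m/n]*n k m) ⟩
      s ℕ.+ (k ℕ.% m ℕ.+ (k ℕ./ m) ℕ.* m)  ≡⟨ ≡.sym (ℕ.+-assoc s _ _) ⟩
      (s ℕ.+ k ℕ.% m) ℕ.+ (k ℕ./ m) ℕ.* m  ≡⟨ ℕ.+-comm (s ℕ.+ k ℕ.% m) _ ⟩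
      (k ℕ./ m) ℕ.* m ℕ.+ (s ℕ.+ k ℕ.% m)  ∎

  third-unique : ∀ a b {c} → Zero-sum a b c → third a b ≡ c
  third-unique a b m∣ = residue-unique (toℕ a ℕ.+ toℕ b) (third-zero-sum a b) m∣

  rotate : ∀ {a b c} → Zero-sum a b c → Zero-sum b c a
  rotate {a} {b} {c} = ≡.subst (m ℕ.∣_) (≡.trans (ℕ.+-assoc (toℕ a) _ _) (ℕ.+-comm (toℕ a) _))

  swap : ∀ {a b c} → Zero-sum a b c → Zero-sum b a c
  swap {a} {b} {c} = ≡.subst (λ s → m ℕ.∣ s ℕ.+ toℕ c) (ℕ.+-comm (toℕ a) (toℕ b))

  module ThirdPart (k : ℕ) (m≡k*3 : m ≡ k ℕ.* 3) where
    k≢0 : ¬ k ≡ 0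
    k≢0 ≡.refl = contradiction m≡k*3 λ ()

    2k<m : k ℕ.+ k ℕ.< m
    2k<m = ≡.subst (k ℕ.+ k ℕ.<_) (≡.sym (≡.trans m≡k*3 k*3≡)) (ℕ.m<m+n (k ℕ.+ k) (ℕ.n≢0⇒n>0 k≢0))
      where
      k*3≡ : k ℕ.* 3 ≡ k ℕ.+ k ℕ.+ k
      k*3≡ = ≡.trans (ℕ.*-comm k 3) (≡.trans (≡.cong (λ z → k ℕ.+ (k ℕ.+ z)) (ℕ.+-identityʳ k)) (≡.sym (ℕ.+-assoc k k k)))

    k<m : k ℕ.< m
    k<m = ℕ.≤-<-trans (ℕ.m≤m+n k k) 2k<m

module RootsOfUnity (m-1 : ℕ) (S : CommutativeRing 0ℓ 0ℓ) (φ : ℚ⟨i⟩ → CommutativeRing.Carrier S)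
  (φ-hom : IsRingHomomorphism (DecRawRing.rawRing ℚ⟨i⟩-ring) (CommutativeRing.rawRing S) φ)
  (ζ : CommutativeRing.Carrier S) (principal : Geometric.Principal S (suc m-1) ζ) where
  open Ring S
  open Geometric S
  open Principal principal
  open Determinant S
  open TriangularDeterminant S
  open Cyclic m-1
  open IsRingHomomorphism φ-hom
  open Reasoning
  open Solver

  ı ζ̄ : Carrier
  ı = φ 𝕚
  ζ̄ = ζ ^ m-1

  ı² : ı * ı ≈ - 1#
  ı² = trans (sym (*-homo 𝕚 𝕚)) (trans (-‿homo _) (-‿cong 1#-homo))

  ζ*ζ̄ : ζ * ζ̄ ≈ 1#
  ζ*ζ̄ = root

  ζ^*ζ̄^ : ∀ k → ζ ^ k * ζ̄ ^ k ≈ 1#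
  ζ^*ζ̄^ k = trans (sym (^-distrib-* ζ ζ̄ k)) (trans (^-congˡ k ζ*ζ̄) (1^n≈1 k))

  α : Fin m → Carrier
  α c = ı * ζ ^ toℕ c

  α^m : ∀ c → α c ^ m ≈ ı ^ m
  α^m c = begin
    α c ^ m  ≈⟨ ^-distrib-* ı (ζ ^ toℕ c) m ⟩
    ı ^ m * (ζ ^ toℕ c) ^ m  ≈⟨ *-congˡ (swap-exponents ζ (toℕ c) m) ⟩
    ı ^ m * (ζ ^ m) ^ toℕ c  ≈⟨ *-congˡ (trans (^-congˡ (toℕ c) root) (1^n≈1 (toℕ c))) ⟩
    ı ^ m * 1#  ≈⟨ *-identityʳ _ ⟩
    ı ^ m  ∎

  private
    -- Up to the factor m, the inverse of the Vandermonde matrix; - ı stands for 1 / ı.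
    dual : Fin m → Row m
    dual c k = (- ı) ^ (m ℕ.∸ suc (toℕ k)) * (ζ ^ toℕ c) ^ suc (toℕ k)

    exponent : Fin m → Fin m → ℕ
    exponent i k = (m ℕ.∸ suc (toℕ i)) ℕ.+ suc (toℕ k)

    entry : ∀ i c k → α c ^ (m ℕ.∸ suc (toℕ i)) * dual c k ≈
      (ı ^ (m ℕ.∸ suc (toℕ i)) * (- ı) ^ (m ℕ.∸ suc (toℕ k))) * (ζ ^ exponent i k) ^ toℕ c
    entry i c k = begin
      (ı * z) ^ e * ((- ı) ^ e′ * z ^ suc (toℕ k))  ≈⟨ *-congʳ (^-distrib-* ı z e) ⟩
      (ı ^ e * z ^ e) * ((- ı) ^ e′ * z ^ suc (toℕ k))  ≈⟨ solve 4 (λ a b c d → (a :* b) :* (c :* d) := (a :* c) :*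
          (b :* d)) refl _ _ _ _ ⟩
      (ı ^ e * (- ı) ^ e′) * (z ^ e * z ^ suc (toℕ k))  ≈⟨ *-congˡ (^-homo-* z e (suc (toℕ k))) ⟨
      (ı ^ e * (- ı) ^ e′) * (ζ ^ toℕ c) ^ exponent i k  ≈⟨ *-congˡ (swap-exponents ζ (toℕ c) (exponent i k)) ⟩
      (ı ^ e * (- ı) ^ e′) * (ζ ^ exponent i k) ^ toℕ c  ∎
      where
      z : Carrier
      z = ζ ^ toℕ c
      e e′ : ℕ
      e = m ℕ.∸ suc (toℕ i)
      e′ = m ℕ.∸ suc (toℕ k)

    -- Up to the full period m, the exponent of ζ is k - i, so the sum over c is geometric in a
    -- power of ζ and vanishes for i ≠ k. The powers of `ı` and `- ı` have to cancel only on the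
    -- diagonal.
    orthogonality : ∀ i k → combine dual (λ c → α c ^ (m ℕ.∸ suc (toℕ i))) k ≈ basis i k * (m · 1#)
    orthogonality i k = begin
      sum {m} (λ c → α c ^ e * dual c k)  ≈⟨ sum-cong-≋ {m} (λ c → entry i c k) ⟩
      sum {m} (λ c → u * (ζ ^ exponent i k) ^ toℕ c)  ≈⟨ *-distribˡ-sum u (λ (c : Fin m) → (ζ ^ exponent i k) ^ toℕ c) ⟨
      u * geometric (ζ ^ exponent i k) m  ≈⟨ cases (i Fin.≟ k) ⟩
      basis i k * (m · 1#)  ∎
      where
      e : ℕ
      e = m ℕ.∸ suc (toℕ i)
      u : Carrier
      u = ı ^ e * (- ı) ^ (m ℕ.∸ suc (toℕ k))
      e+i : e ℕ.+ suc (toℕ i) ≡ m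
      e+i = ℕ.m∸n+n≡m (Fin.toℕ<n i)
      cases : Dec (i ≡ k) → u * geometric (ζ ^ exponent i k) m ≈ basis i k * (m · 1#)
      cases (yes ≡.refl) = *-cong unit (trans (geometric-cong m (trans (^-congʳ ζ e+i) root)) geometric-1)
        where
        unit : u ≈ basis i i
        unit = trans (sym (^-distrib-* ı (- ı) e)) (trans (^-congˡ e (trans (sym (-‿distribʳ-* ı ı))
            (trans (-‿cong ı²) (solve 1 (λ x → :- (:- x) := x) refl 1#))))
          (trans (1^n≈1 e) (sym (basis-diagonal i))))
        geometric-1 : geometric 1# m ≈ m · 1#
        geometric-1 = trans (sum-cong-≋ {m} (λ j → 1^n≈1 (toℕ j))) (SemiringSum.sum-replicate semiring m)
      cases (no i≢k) = trans (*-congˡ (orthogonal (exponent i k) λ m∣ → i≢k (residue-unique (suc e)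
          (≡.subst (m ℕ.∣_) (≡.trans (≡.sym e+i) (ℕ.+-suc e (toℕ i))) ℕ.∣-refl)
          (≡.subst (m ℕ.∣_) (ℕ.+-suc e (toℕ k)) m∣))))
        (trans (zeroʳ _) (sym (trans (*-congʳ (basis-off-diagonal i k i≢k)) (zeroˡ _))))

  -- The Vandermonde matrix times its dual is m times the identity, so the product of the
  -- determinants is m^m, and the integer m is invertible in a ℚ(i)-algebra.
  vandermonde-unit : ∃ λ u → u * det (λ (i c : Fin m) → α c ^ (m ℕ.∸ suc (toℕ i))) ≈ 1#
  vandermonde-unit = r^m * det (combine dual ∘ basis) , (begin
    (r^m * det (combine dual ∘ basis)) * det V  ≈⟨ solve 3 (λ a b c → (a :* b) :* c := a :* (c :* b)) refl _ _ _ ⟩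
    r^m * (det V * det (combine dual ∘ basis))  ≈⟨ *-congˡ (det-∘ (combine-linear dual) V) ⟨
    r^m * det (combine dual ∘ V)  ≈⟨ *-congˡ (det-cong orthogonality) ⟩
    r^m * det {m} (λ i k → basis i k * (m · 1#))  ≈⟨ *-congˡ (det-diagonal m (λ _ → m · 1#)) ⟩
    r^m * prod {m} (λ _ → m · 1#)  ≈⟨ prod-distrib-* {m} (λ _ → r) (λ _ → m · 1#) ⟨
    prod {m} (λ _ → r * (m · 1#))  ≈⟨ prod-cong {m} (λ _ → r-inverse) ⟩
    prod {m} (λ _ → 1#)  ≈⟨ prod-1 m ⟩
    1#  ∎)
    where
    V : Fin m → Row m
    V i c = α c ^ (m ℕ.∸ suc (toℕ i))
    r : Carrier
    r = proj₁ (ScalarInverse.inverse S φ φ-hom m)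
    r-inverse : r * (m · 1#) ≈ 1#
    r-inverse = proj₂ (ScalarInverse.inverse S φ φ-hom m)
    r^m : Carrier
    r^m = prod {m} (λ _ → r)

module SpectralProduct (m-1 : ℕ) (S : CommutativeRing 0ℓ 0ℓ) (φ : ℚ⟨i⟩ → CommutativeRing.Carrier S)
  (φ-hom : IsRingHomomorphism (DecRawRing.rawRing ℚ⟨i⟩-ring) (CommutativeRing.rawRing S) φ)
  (ζ : CommutativeRing.Carrier S) (principal : Geometric.Principal S (suc m-1) ζ) (w : CommutativeRing.Carrier S) where
  open Ring S
  open Geometric S
  open Principal principal
  open Cyclic m-1
  open RootsOfUnity m-1 S φ φ-hom ζ principal
  open Defining m-1
  open Reasoning
  open Solver
  private
    module φ = IsRingHomomorphism φ-hom
    module Eᵤ = Evaluation ℚ⟨i⟩-ring S φ φ-hom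
    module Eᵥ = Evaluation Rw S (Eᵤ.eval w) (Eᵤ.eval-hom w)

  evalᵤ : Pw.Poly → Carrier
  evalᵤ = Eᵤ.eval w

  evalᵤ-hom : IsRingHomomorphism (DecRawRing.rawRing Rw) rawRing evalᵤ
  evalᵤ-hom = Eᵤ.eval-hom w

  ½ı : Carrier
  ½ı = φ (0ℚ +i ½)

  -- 2 i sin (2 π k / m)
  2isin : ℕ → Carrier
  2isin k = ζ ^ k - ζ̄ ^ k

  -- Since (i/2)(2 i) = -1, this is minus the sum of the three sines.
  eigenvalue : ℕ → ℕ → ℕ → Carrier
  eigenvalue a b c = ½ı * (2isin a + 2isin b + 2isin c)

  factor : Fin m → Fin m → Carrier
  factor a b = w - eigenvalue (toℕ a) (toℕ b) (toℕ (third a b))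

  ½ı+½ı : ½ı + ½ı ≈ ı
  ½ı+½ı = trans (sym (φ.+-homo (0ℚ +i ½) (0ℚ +i ½))) (φ.⟦⟧-cong ≡.refl)

  private
    module At (u : Carrier) where
      module Eₓ = Evaluation Ru S (Eᵥ.eval u) (Eᵥ.eval-hom u)

      module _ (v : Carrier) where
        open DecRawRing Rv using () renaming (Carrier to Rᵥ; _+_ to _+ᵥ_; _*_ to _*ᵥ_; -_ to -ᵥ_; _^_ to _^ᵥ_; 1# to 1ᵥ)
        θ : Rᵥ → Carrier
        θ = Eₓ.eval v
        module θ = IsRingHomomorphism (Eₓ.eval-hom v)

        infixl 6 _⟨+⟩_
        infixl 7 _⟨*⟩_
        _⟨+⟩_ : ∀ {p q x y} → θ p ≈ x → θ q ≈ y → θ (p +ᵥ q) ≈ x + y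
        _⟨+⟩_ {p} {q} e f = trans (θ.+-homo p q) (+-cong e f)
        _⟨*⟩_ : ∀ {p q x y} → θ p ≈ x → θ q ≈ y → θ (p *ᵥ q) ≈ x * y
        _⟨*⟩_ {p} {q} e f = trans (θ.*-homo p q) (*-cong e f)
        ⟨-⟩_ : ∀ {p x} → θ p ≈ x → θ (-ᵥ p) ≈ - x
        ⟨-⟩_ {p} e = trans (θ.-‿homo p) (-‿cong e)
        _² : ∀ {p x} → θ p ≈ x → θ (p ^ᵥ 2) ≈ x * x
        _² {p} e = trans (Homomorphism.^-homo (DecRawRing.rawRing Rv) S θ (Eₓ.eval-hom v) p 2)
          (trans (^-congˡ 2 e) (*-congˡ (*-identityʳ _)))

        θi : θ (Pv.const iᵥ) ≈ ı
        θi = trans (Eₓ.eval-const v iᵥ) (trans (Eᵥ.eval-const u iᵤ) (Eᵤ.eval-const w 𝕚))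
        θw : θ (Pv.const (Pu.const Pw.X)) ≈ w
        θw = trans (Eₓ.eval-const v (Pu.const Pw.X)) (trans (Eᵥ.eval-const u Pw.X) (Eᵤ.eval-X w))
        θu : θ (Pv.const Pu.X) ≈ u
        θu = trans (Eₓ.eval-const v Pu.X) (Eᵥ.eval-X u)
        θv : θ Pv.X ≈ v
        θv = Eₓ.eval-X v

        eval-W : θ W ≈ ı * (u * u) * (v * v) + u * u * v + u * (v * v) + - ((1# + 1#) * w * u * v) + u + v + - ı
        eval-W = _⟨+⟩_ {Wᵤᵥ +ᵥ V} { -ᵥ i} (_⟨+⟩_ {Wᵤᵥ} {V} (_⟨+⟩_ {W₃ +ᵥ -ᵥ W₄} {U}
          (_⟨+⟩_ {W₃} { -ᵥ W₄} (_⟨+⟩_ {W₁ +ᵥ W₂} {U *ᵥ V ^ᵥ 2} (_⟨+⟩_ {W₁} {W₂} e₁ e₂) e₃) (⟨-⟩_ {W₄} e₄)) θu) θv) (⟨-⟩_ {i} θi)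
          where
          i U V w′ W₁ W₂ W₃ W₄ Wᵤᵥ : Rᵥ
          i = Pv.const iᵥ
          U = Pv.const Pu.X
          V = Pv.X
          w′ = Pv.const (Pu.const Pw.X)
          W₁ = i *ᵥ U ^ᵥ 2 *ᵥ V ^ᵥ 2
          W₂ = U ^ᵥ 2 *ᵥ V
          W₃ = W₁ +ᵥ W₂ +ᵥ U *ᵥ V ^ᵥ 2
          W₄ = (1ᵥ +ᵥ 1ᵥ) *ᵥ w′ *ᵥ U *ᵥ V
          Wᵤᵥ = W₃ +ᵥ -ᵥ W₄ +ᵥ U
          e₁ : θ W₁ ≈ ı * (u * u) * (v * v)
          e₁ = _⟨*⟩_ {i *ᵥ U ^ᵥ 2} {V ^ᵥ 2} (_⟨*⟩_ {i} {U ^ᵥ 2} θi (_² {U} θu)) (_² {V} θv)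
          e₂ : θ W₂ ≈ u * u * v
          e₂ = _⟨*⟩_ {U ^ᵥ 2} {V} (_² {U} θu) θv
          e₃ : θ (U *ᵥ V ^ᵥ 2) ≈ u * (v * v)
          e₃ = _⟨*⟩_ {U} {V ^ᵥ 2} θu (_² {V} θv)
          e₄ : θ W₄ ≈ (1# + 1#) * w * u * v
          e₄ = _⟨*⟩_ {(1ᵥ +ᵥ 1ᵥ) *ᵥ w′ *ᵥ U} {V} (_⟨*⟩_ {(1ᵥ +ᵥ 1ᵥ) *ᵥ w′} {U}
              (_⟨*⟩_ {1ᵥ +ᵥ 1ᵥ} {w′} (_⟨+⟩_ {1ᵥ} {1ᵥ} θ.1#-homo θ.1#-homo) θw) θu) θv

  ζ^third : ∀ a b → ζ ^ toℕ (third a b) ≈ ζ̄ ^ toℕ a * ζ̄ ^ toℕ b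
  ζ^third a b = begin
    z  ≈⟨ *-identityˡ z ⟨
    1# * z  ≈⟨ *-congʳ (trans (*-cong (ζ^*ζ̄^ (toℕ a)) (ζ^*ζ̄^ (toℕ b))) (*-identityʳ 1#)) ⟨
    ((x * x̄) * (y * ȳ)) * z  ≈⟨ solve 5 (λ x x̄ y ȳ z → ((x :* x̄) :* (y :* ȳ)) :* z := ((x :* y) :* z) :* (x̄ :* ȳ))
        refl x x̄ y ȳ z ⟩
    ((x * y) * z) * (x̄ * ȳ)  ≈⟨ *-congʳ xyz≈1 ⟩
    1# * (x̄ * ȳ)  ≈⟨ *-identityˡ _ ⟩
    x̄ * ȳ  ∎
    where
    x = ζ ^ toℕ a ; y = ζ ^ toℕ b ; z = ζ ^ toℕ (third a b) ; x̄ = ζ̄ ^ toℕ a ; ȳ = ζ̄ ^ toℕ b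
    xyz≈1 : (x * y) * z ≈ 1#
    xyz≈1 = trans (*-congʳ (sym (^-homo-* ζ (toℕ a) (toℕ b)))) (trans (sym (^-homo-* ζ (toℕ a ℕ.+ toℕ b) _))
        (^∣≈1 root (third-zero-sum a b)))

  ζ̄^third : ∀ a b → ζ̄ ^ toℕ (third a b) ≈ ζ ^ toℕ a * ζ ^ toℕ b
  ζ̄^third a b = begin
    z̄  ≈⟨ *-identityˡ z̄ ⟨
    1# * z̄  ≈⟨ *-congʳ (trans (*-cong (ζ^*ζ̄^ (toℕ a)) (ζ^*ζ̄^ (toℕ b))) (*-identityʳ 1#)) ⟨
    ((x * x̄) * (y * ȳ)) * z̄  ≈⟨ solve 5 (λ x x̄ y ȳ z̄ → ((x :* x̄) :* (y :* ȳ)) :* z̄ := (x :* y) :* ((x̄ :* ȳ) :* z̄))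
        refl x x̄ y ȳ z̄ ⟩
    (x * y) * ((x̄ * ȳ) * z̄)  ≈⟨ *-congˡ (*-congʳ (ζ^third a b)) ⟨
    (x * y) * (ζ ^ toℕ (third a b) * z̄)  ≈⟨ *-congˡ (ζ^*ζ̄^ (toℕ (third a b))) ⟩
    (x * y) * 1#  ≈⟨ *-identityʳ _ ⟩
    x * y  ∎
    where
    x = ζ ^ toℕ a ; y = ζ ^ toℕ b ; z̄ = ζ̄ ^ toℕ (third a b) ; x̄ = ζ̄ ^ toℕ a ; ȳ = ζ̄ ^ toℕ b

  private
    W-at-roots : ∀ a b → At.θ (α a) (α b) W ≈ (1# + 1#) * ((ζ ^ toℕ a * ζ ^ toℕ b) * factor a b)
    W-at-roots a b = begin
      At.θ (α a) (α b) W
        ≈⟨ At.eval-W (α a) (α b) ⟩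
      ı * (u * u) * (v * v) + u * u * v + u * (v * v) + - ((1# + 1#) * w * u * v) + u + v + - ı
        -- The solver knows no relations, so `form` isolates the places where they enter: ı² becomes
        -- -1, suitable ones become x x̄ and y ȳ, and the outer ı becomes twice `½ı`. Then x y and 2
        -- can be extracted as common factors by a plain ring identity.
        ≈⟨ solve 4 (λ ı x y w →
             ı :* ((ı :* x) :* (ı :* x)) :* ((ı :* y) :* (ı :* y)) :+ (ı :* x) :* (ı :* x) :* (ı :* y) :+ (ı :* x) :*
                 ((ı :* y) :* (ı :* y))
               :+ :- ((con :1 :+ con :1) :* w :* (ı :* x) :* (ı :* y)) :+ ı :* x :+ ı :* y :+ :- ı
             := form ı x y w (ı :* ı) (con :1) (con :1)) refl ı x y w ⟩
      ı * ((ı * ı) * (ı * ı) * (x * x * (y * y)) + (ı * ı) * (x * x * y) + (ı * ı) * (x * (y * y)) + x * 1# + y * 1# - 1#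
          * 1#) - (1# + 1#) * (w * ((ı * ı) * (x * y)))
        ≈⟨ +-cong (*-congˡ (+-cong (+-cong (+-cong (+-cong (+-cong (*-congʳ (*-cong ı² ı²)) (*-congʳ ı²)) (*-congʳ ı²))
            (*-congˡ (sym yȳ))) (*-congˡ (sym xx̄)))
             (-‿cong (*-cong (sym xx̄) (sym yȳ))))) (-‿cong (*-congˡ (*-congˡ (*-congʳ ı²)))) ⟩
      ı * ((- 1#) * (- 1#) * (x * x * (y * y)) + (- 1#) * (x * x * y) + (- 1#) * (x * (y * y)) + x * (y * ȳ) + y *
          (x * x̄) - (x * x̄) * (y * ȳ)) - (1# + 1#) * (w * ((- 1#) * (x * y)))
        ≈⟨ +-congʳ (*-congʳ ½ı+½ı) ⟨
      (½ı + ½ı) * ((- 1#) * (- 1#) * (x * x * (y * y)) + (- 1#) * (x * x * y) + (- 1#) * (x * (y * y)) + x * (y * ȳ) + y *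
          (x * x̄) - (x * x̄) * (y * ȳ)) - (1# + 1#) * (w * ((- 1#) * (x * y)))
        ≈⟨ solve 6 (λ h x y x̄ ȳ w → form (h :+ h) x y w (:- con :1) (x :* x̄) (y :* ȳ)
             := (con :1 :+ con :1) :* ((x :* y) :* (w :- h :* ((x :- x̄) :+ (y :- ȳ) :+ (x̄ :* ȳ :- x :* y))))) refl ½ı x
                 y x̄ ȳ w ⟩
      (1# + 1#) * ((x * y) * (w - ½ı * ((x - x̄) + (y - ȳ) + (x̄ * ȳ - x * y))))
        ≈⟨ *-congˡ (*-congˡ (+-congˡ (-‿cong (*-congˡ (+-congˡ (+-cong (ζ^third a b) (-‿cong (ζ̄^third a b)))))))) ⟨
      (1# + 1#) * ((x * y) * factor a b) ∎
      where
      x = ζ ^ toℕ a ; y = ζ ^ toℕ b ; x̄ = ζ̄ ^ toℕ a ; ȳ = ζ̄ ^ toℕ b ; u = α a ; v = α b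
      xx̄ : x * x̄ ≈ 1#
      xx̄ = ζ^*ζ̄^ (toℕ a)
      yȳ : y * ȳ ≈ 1#
      yȳ = ζ^*ζ̄^ (toℕ b)
      -- k, p, q stand for ı², x x̄, y ȳ
      form : ∀ {n} (ı x y w k p q : Expression n) → Expression n
      form ı x y w k p q = ı :* (k :* k :* (x :* x :* (y :* y)) :+ k :* (x :* x :* y) :+ k :* (x :* (y :* y)) :+ x :* q :+
          y :* p :- p :* q)
        :- (con :1 :+ con :1) :* (w :* (k :* (x :* y)))

  private
    module Rᵤ = ResultantProduct Rw S evalᵤ evalᵤ-hom

    module Rᵥ (a : Fin m) = ResultantProduct Ru S (Eᵥ.eval (α a)) (Eᵥ.eval-hom (α a))

    α-root : ∀ {c} → c ≈ ı → ∀ a → α a ^ m - c ^ m ≈ 0#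
    α-root e a = trans (+-cong (α^m a) (-‿cong (^-congˡ m e))) (-‿inverseʳ _)

    rootᵤ : ∀ a → Eᵥ.eval (α a) Qᵤ ≈ 0#
    rootᵤ a = trans (Eᵥ.eval-binomial (α a) iᵤ m) (α-root (Eᵤ.eval-const w 𝕚) a)

    rootᵥ : ∀ a b → At.θ (α a) (α b) Qᵥ ≈ 0#
    rootᵥ a b = trans (At.Eₓ.eval-binomial (α a) (α b) iᵥ m)
      (α-root (trans (Eᵥ.eval-const (α a) iᵤ) (Eᵤ.eval-const w 𝕚)) b)

    leading : ∀ {R : DecRawRing} {ψ : DecRawRing.Carrier R → Carrier} →
      IsRingHomomorphism (DecRawRing.rawRing R) rawRing ψ → ∀ {x} → DecRawRing._≈_ R x (DecRawRing.1# R) → ψ x ≈ 1#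
    leading ψ-hom e = trans (ψ.⟦⟧-cong e) ψ.1#-homo
      where module ψ = IsRingHomomorphism ψ-hom

    prod₂ : (Fin m → Fin m → Carrier) → Carrier
    prod₂ f = prod λ a → prod λ b → f a b

    prod₂-cong : ∀ {f g : Fin m → Fin m → Carrier} → (∀ a b → f a b ≈ g a b) → prod₂ f ≈ prod₂ g
    prod₂-cong e = prod-cong {m} λ a → prod-cong {m} (e a)

    prod₂-* : ∀ f g → prod₂ (λ a b → f a b * g a b) ≈ prod₂ f * prod₂ g
    prod₂-* f g = trans (prod-cong {m} λ a → prod-distrib-* (f a) (g a)) (prod-distrib-* (prod ∘ f) (prod ∘ g))

    prod₂-const : ∀ c → prod₂ (λ _ _ → c) ≈ c ^ (m ℕ.^ 2)
    prod₂-const c = begin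
      prod₂ (λ _ _ → c)  ≈⟨ prod-cong {m} (λ _ → prod-replicate m {c}) ⟩
      prod {m} (λ _ → c ^ m)  ≈⟨ prod-replicate m {c ^ m} ⟩
      (c ^ m) ^ m  ≈⟨ ^-assocʳ c m m ⟩
      c ^ (m ℕ.* m)  ≡⟨ ≡.cong (λ k → c ^ (m ℕ.* k)) (ℕ.*-identityʳ m) ⟨
      c ^ (m ℕ.^ 2)  ∎

    -- Each ζ^a occurs once for every b, hence contributes (ζ^a)^m = 1.
    ∏ζ≈1 : prod₂ (λ a b → ζ ^ toℕ a * ζ ^ toℕ b) ≈ 1#
    ∏ζ≈1 = begin
      prod₂ (λ a b → ζ ^ toℕ a * ζ ^ toℕ b)  ≈⟨ prod₂-* (λ a _ → ζ ^ toℕ a) (λ _ b → ζ ^ toℕ b) ⟩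
      prod₂ (λ a _ → ζ ^ toℕ a) * prod₂ (λ _ b → ζ ^ toℕ b)  ≈⟨ *-cong rows (trans (prod-comm {m} {m} (λ _ b → ζ ^ toℕ b)) rows) ⟩
      1# * 1#  ≈⟨ *-identityˡ 1# ⟩
      1#  ∎
      where
      rows : prod₂ (λ a _ → ζ ^ toℕ a) ≈ 1#
      rows = trans (prod-cong {m} λ a → trans (prod-replicate m {ζ ^ toℕ a}) (trans (swap-exponents ζ (toℕ a) m)
        (trans (^-congˡ (toℕ a) root) (1^n≈1 (toℕ a))))) (prod-1 m)

  -- The product formula is applied twice, to the outer resultant at w and to the inner one at each
  -- root `α a`. Both binomials are monic, so it does not matter how the degree of the other
  -- argument behaves under these specialisations.
  resultant-at-roots : evalᵤ (resultant m) ≈ prod₂ (λ a b → (1# + 1#) * ((ζ ^ toℕ a * ζ ^ toℕ b) * factor a b))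
  resultant-at-roots = trans
    (Rᵤ.resultant-product-deg Qᵤ (Pv.Res Qᵥ W) m degᵤ (leading {Rw} evalᵤ-hom {Pu.coeff Qᵤ m} leadingᵤ) α rootᵤ vandermonde-unit)
    (prod-cong {m} λ a → trans
      (Rᵥ.resultant-product-deg a Qᵥ W m degᵥ (leading {Ru} (Eᵥ.eval-hom (α a)) {Pv.coeff Qᵥ m} leadingᵥ) α (rootᵥ a)
          vandermonde-unit)
      (prod-cong {m} (W-at-roots a)))

  spectral-product : evalᵤ (DecRawRing._*_ Rw (Pw.const (embed (DecRawRing._^_ ℚ-ring ½ (m ℕ.^ 2)))) (resultant m)) ≈ prod₂ factor
  spectral-product = begin
    evalᵤ (DecRawRing._*_ Rw (Pw.const (embed (DecRawRing._^_ ℚ-ring ½ (m ℕ.^ 2)))) (resultant m))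
      ≈⟨ IsRingHomomorphism.*-homo evalᵤ-hom (Pw.const (embed (DecRawRing._^_ ℚ-ring ½ (m ℕ.^ 2)))) (resultant m) ⟩
    evalᵤ (Pw.const (embed (DecRawRing._^_ ℚ-ring ½ (m ℕ.^ 2)))) * evalᵤ (resultant m)
      ≈⟨ *-cong (trans (Eᵤ.eval-const w _) (κ.^-homo ½ (m ℕ.^ 2))) resultant-at-roots ⟩
    κ ½ ^ (m ℕ.^ 2) * prod₂ (λ a b → (1# + 1#) * ((ζ ^ toℕ a * ζ ^ toℕ b) * factor a b))
      ≈⟨ *-cong (sym (prod₂-const (κ ½))) (trans (prod₂-* (λ _ _ → 1# + 1#)
          (λ a b → (ζ ^ toℕ a * ζ ^ toℕ b) * factor a b)) (*-congˡ (prod₂-* (λ a b → ζ ^ toℕ a * ζ ^ toℕ b) factor))) ⟩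
    prod₂ (λ _ _ → κ ½) * (prod₂ (λ _ _ → 1# + 1#) * (prod₂ (λ a b → ζ ^ toℕ a * ζ ^ toℕ b) * prod₂ factor))
      ≈⟨ *-assoc _ _ _ ⟨
    (prod₂ (λ _ _ → κ ½) * prod₂ (λ _ _ → 1# + 1#)) * (prod₂ (λ a b → ζ ^ toℕ a * ζ ^ toℕ b) * prod₂ factor)
      ≈⟨ *-cong halves (*-congʳ ∏ζ≈1) ⟩
    1# * (1# * prod₂ factor)
      ≈⟨ trans (*-identityˡ _) (*-identityˡ _) ⟩
    prod₂ factor ∎
    where
    κ : ℚ → Carrier
    κ = φ ∘ embed
    κ-hom : IsRingHomomorphism Gaussian.rawRing-ℚ rawRing κ
    κ-hom = Composition.isRingHomomorphism trans Gaussian.embed-hom φ-hom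
    module κ where
      open IsRingHomomorphism κ-hom public
      open Homomorphism Gaussian.rawRing-ℚ S κ κ-hom public
    ½*2≈1 : κ ½ * (1# + 1#) ≈ 1#
    ½*2≈1 = begin
      κ ½ * (1# + 1#)  ≈⟨ solve 1 (λ h → h :* (con :1 :+ con :1) := h :+ h) refl (κ ½) ⟩
      κ ½ + κ ½  ≈⟨ κ.+-homo ½ ½ ⟨
      κ (½ ℚ.+ ½)  ≈⟨ κ.⟦⟧-cong ≡.refl ⟩
      κ 1ℚ  ≈⟨ κ.1#-homo ⟩
      1#  ∎
    halves : prod₂ (λ _ _ → κ ½) * prod₂ (λ _ _ → 1# + 1#) ≈ 1#
    halves = trans (sym (prod₂-* (λ _ _ → κ ½) (λ _ _ → 1# + 1#))) (trans (prod₂-cong (λ _ _ → ½*2≈1))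
      (trans (prod₂-const 1#) (1^n≈1 (m ℕ.^ 2))))

-- Orbits of (a, b) ↦ (b, - a - b)

-- The monoid is a parameter because the decomposition is used twice: multiplicatively for the
-- factors of the spectrum, and in ℕ under addition, with the function 1, to count the orbits.
module Orbits (m-1 : ℕ) (M : CommutativeMonoid 0ℓ 0ℓ) where
  open Cyclic m-1
  open CommutativeMonoid M
  open MonoidSum M using () renaming
    (sum to prod; sum-cong-≋ to prod-cong; sum-replicate-zero to prod-ε; sum-remove to prod-remove;
     ∑-distrib-+ to prod-distrib; ∑-comm to prod-comm; sum-permute to prod-permute)
  open SetoidReasoning setoid

  infix 8 _when_
  _when_ : ∀ {P : Set} → Carrier → Dec P → Carrier
  x when (yes _) = x
  x when (no _)  = ε

  when-yes : ∀ {P : Set} x (d : Dec P) → P → x when d ≈ x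
  when-yes x (yes _) p = refl
  when-yes x (no ¬p) p = contradiction p ¬p

  when-no : ∀ {P : Set} x (d : Dec P) → ¬ P → x when d ≈ ε
  when-no x (yes p) ¬p = contradiction p ¬p
  when-no x (no _)  ¬p = refl

  when-cong : ∀ {P : Set} {x y} (d : Dec P) → x ≈ y → x when d ≈ y when d
  when-cong (yes _) e = e
  when-cong (no _)  e = refl

  prod-single : ∀ {n} (h : Fin n → Carrier) i → (∀ j → ¬ j ≡ i → h j ≈ ε) → prod h ≈ h i
  prod-single {suc n} h i e = trans (prod-remove {i = i} h)
    (trans (∙-congˡ (trans (prod-cong {n} (λ j → e (punchIn i j) (Fin.punchInᵢ≢i i j))) (prod-ε n))) (identityʳ _))

  -- Among the rotations of a triple which is not constant exactly one starts with its minimum,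
  -- followed by something larger.
  First : ℕ → ℕ → ℕ → Set
  First a b c = a ℕ.< b × a ℕ.≤ c

  first? : ∀ a b c → Dec (First a b c)
  first? a b c = (a ℕ.<? b) ×-dec (a ℕ.≤? c)

  constant? : ∀ a b c → Dec (a ≡ b × b ≡ c)
  constant? a b c = (a ℕ.≟ b) ×-dec (b ℕ.≟ c)

  exactly-one : ∀ a b c x →
    x ≈ x when constant? a b c ∙ (x when first? a b c ∙ (x when first? b c a ∙ x when first? c a b))
  exactly-one a b c x with first? a b c | first? b c a | first? c a b | constant? a b c
  ... | yes (a<b , _) | yes (_ , b≤a) | _             | _               = contradiction b≤a (ℕ.<⇒≱ a<b)
  ... | yes (_ , a≤c) | no _          | yes (c<a , _) | _               = contradiction a≤c (ℕ.<⇒≱ c<a)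
  ... | yes (a<b , _) | no _          | no _          | yes (a≡b , _)   = contradiction a≡b (ℕ.<⇒≢ a<b)
  ... | yes _         | no _          | no _          | no _            = sym
      (trans (identityˡ _) (trans (∙-congˡ (identityˡ ε)) (identityʳ x)))
  ... | no _          | yes (b<c , _) | yes (_ , c≤b) | _               = contradiction c≤b (ℕ.<⇒≱ b<c)
  ... | no _          | yes (b<c , _) | no _          | yes (_ , b≡c)   = contradiction b≡c (ℕ.<⇒≢ b<c)
  ... | no _          | yes _         | no _          | no _            = sym
      (trans (identityˡ _) (trans (identityˡ _) (identityʳ x)))
  ... | no _          | no _          | yes (c<a , _) | yes (a≡b , b≡c) = contradiction (≡.sym (≡.trans a≡b b≡c)) (ℕ.<⇒≢ c<a)
  ... | no _          | no _          | yes _         | no _            = sym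
      (trans (identityˡ _) (trans (identityˡ _) (identityˡ x)))
  ... | no _          | no _          | no _          | yes _           = sym
      (trans (∙-congˡ (trans (identityˡ _) (identityˡ ε))) (identityʳ x))
  -- If no rotation is first, then a < b would force c < a and make the third rotation first; hence
  -- a ≥ b, and likewise b ≥ c ≥ a, so the triple is constant after all.
  ... | no ¬first₁    | no ¬first₂    | no ¬first₃    | no ¬constant with a ℕ.<? b
  ...   | yes a<b with a ℕ.≤? c
  ...     | yes a≤c = contradiction (a<b , a≤c) ¬first₁
  ...     | no  a≰c = contradiction (ℕ.≰⇒> a≰c , ℕ.≤-trans (ℕ.<⇒≤ (ℕ.≰⇒> a≰c)) (ℕ.<⇒≤ a<b)) ¬first₃
  exactly-one a b c x | no ¬first₁ | no ¬first₂ | no ¬first₃ | no ¬constant | no a≮b =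
    contradiction (ℕ.≤-antisym (ℕ.≤-trans a≤c c≤b) b≤a , ℕ.≤-antisym (ℕ.≤-trans b≤a a≤c) c≤b) ¬constant
    where
    b≤a : b ℕ.≤ a
    b≤a = ℕ.≮⇒≥ a≮b
    c≤b : c ℕ.≤ b
    c≤b = ℕ.≮⇒≥ (λ b<c → ¬first₂ (b<c , b≤a))
    a≤c : a ℕ.≤ c
    a≤c = ℕ.≮⇒≥ (λ c<a → ¬first₃ (c<a , c≤b))

  module _ (f : Fin m → Fin m → Carrier) (invariant : ∀ a b → f a b ≈ f b (third a b)) where

    first-part : Fin m → Fin m → Carrier
    first-part a b = f a b when first? (toℕ a) (toℕ b) (toℕ (third a b))

    -- In a first triple the leading entry is the minimum, so `suc a` selects precisely the
    -- nonconstant orbits without a zero entry.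
    representatives : Carrier
    representatives = prod λ a → prod λ b → first-part (suc a) b

    private
      third-rotate : ∀ a b → third b (third a b) ≡ a
      third-rotate a b = third-unique b (third a b) (rotate {a} {b} (third-zero-sum a b))

      third-rotate² : ∀ a b → third (third a b) a ≡ b
      third-rotate² a b = third-unique (third a b) a (rotate {b} {third a b} (rotate {a} {b} (third-zero-sum a b)))

      second-part : ∀ a b → f a b when first? (toℕ b) (toℕ (third a b)) (toℕ a) ≈ first-part b (third a b)
      second-part a b = trans (when-cong (first? (toℕ b) (toℕ (third a b)) (toℕ a)) (invariant a b))
        (reflexive (≡.cong (λ c → f b (third a b) when first? (toℕ b) (toℕ (third a b)) (toℕ c)) (≡.sym (third-rotate a b))))

      third-part : ∀ a b → f a b when first? (toℕ (third a b)) (toℕ a) (toℕ b) ≈ first-part (third a b) a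
      third-part a b = trans (when-cong (first? (toℕ (third a b)) (toℕ a) (toℕ b))
          (trans (invariant a b) (trans (invariant b (third a b)) (reflexive (≡.cong (f (third a b)) (third-rotate a b))))))
        (reflexive (≡.cong (λ c → f (third a b) a when first? (toℕ (third a b)) (toℕ a) (toℕ c)) (≡.sym (third-rotate² a b))))

      third-involutive : ∀ a b → third a (third a b) ≡ b
      third-involutive a b = third-unique a (third a b) (swap {third a b} {a}
          (rotate {b} {third a b} (rotate {a} {b} (third-zero-sum a b))))

      third-comm : ∀ a b → third a b ≡ third b a
      third-comm a b = third-unique a b (swap {b} {a} (third-zero-sum b a))

      permute-third : ∀ a (h : Fin m → Carrier) → prod (λ b → h (third a b)) ≈ prod h
      permute-third a h = sym (prod-permute h (Perm.permutation (third a) (third a) (third-involutive a) (third-involutive a)))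

      R : Carrier
      R = prod λ a → prod λ b → first-part a b

      -- The rotation is undone one variable at a time: for fixed b the map a ↦ `third a b` is an
      -- involution, so the inner product is merely permuted.
      second≈R : prod (λ a → prod λ b → first-part b (third a b)) ≈ R
      second≈R = trans (prod-comm {m} {m} (λ a b → first-part b (third a b))) (prod-cong {m} λ b →
        trans (prod-cong {m} λ a → reflexive (≡.cong (first-part b) (third-comm a b))) (permute-third b (first-part b)))

      third≈R : prod (λ a → prod λ b → first-part (third a b) a) ≈ R
      third≈R = trans (prod-cong {m} λ a → permute-third a (λ b → first-part b a)) (prod-comm {m} {m} (λ a b → first-part b a))

      R-split : R ≈ prod (λ b → f zero (suc b)) ∙ representatives
      R-split = ∙-congʳ (trans (identityˡ _) (prod-cong {m-1} λ b →
        when-yes (f zero (suc b)) (first? 0 (suc (toℕ b)) (toℕ (third zero (suc b)))) (s≤s z≤n , z≤n)))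

      diagonal : ∀ a → prod (λ b → f a b when constant? (toℕ a) (toℕ b) (toℕ (third a b))) ≈ f a a when (third a a Fin.≟ a)
      diagonal a = trans
        (prod-single (λ b → f a b when constant? (toℕ a) (toℕ b) (toℕ (third a b))) a
          (λ b b≢a → when-no (f a b) (constant? (toℕ a) (toℕ b) (toℕ (third a b)))
              (λ e → b≢a (≡.sym (Fin.toℕ-injective (proj₁ e))))))
        (cases (third a a Fin.≟ a))
        where
        cases : (d : Dec (third a a ≡ a)) → f a a when constant? (toℕ a) (toℕ a) (toℕ (third a a)) ≈ f a a when d
        cases (yes e) = when-yes (f a a) (constant? (toℕ a) (toℕ a) (toℕ (third a a))) (≡.refl , ≡.cong toℕ (≡.sym e))
        cases (no ≢)  = when-no (f a a) (constant? (toℕ a) (toℕ a) (toℕ (third a a)))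
            (λ e → ≢ (Fin.toℕ-injective (≡.sym (proj₂ e))))

    -- `exactly-one` splits every entry into a constant part and three rotated parts. Invariance of
    -- `f` makes the rotated parts reindexings of one another, so each equals the first. In the row
    -- of zero every b > 0 gives a first triple, and so that row splits off unconditionally.
    orbit-product : prod (λ a → prod λ b → f a b) ≈
      prod (λ a → f a a when (third a a Fin.≟ a)) ∙
      (let r = prod (λ b → f zero (suc b)) ∙ representatives in r ∙ (r ∙ r))
    orbit-product = begin
      prod (λ a → prod λ b → f a b)
        ≈⟨ prod-cong {m} (λ a → prod-cong {m} (λ b → exactly-one (toℕ a) (toℕ b) (toℕ (third a b)) (f a b))) ⟩
      prod (λ a → prod λ b → K a b ∙ (first-part a b ∙ (F₂ a b ∙ F₃ a b)))
        ≈⟨ distrib₂ K (λ a b → first-part a b ∙ (F₂ a b ∙ F₃ a b)) ⟩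
      prod (λ a → prod λ b → K a b) ∙ prod (λ a → prod λ b → first-part a b ∙ (F₂ a b ∙ F₃ a b))
        ≈⟨ ∙-cong (prod-cong {m} diagonal) (trans (distrib₂ first-part (λ a b → F₂ a b ∙ F₃ a b)) (∙-congˡ (distrib₂ F₂ F₃))) ⟩
      prod (λ a → f a a when (third a a Fin.≟ a)) ∙ (R ∙ (prod (λ a → prod (F₂ a)) ∙ prod (λ a → prod (F₃ a))))
        ≈⟨ ∙-congˡ (∙-cong R-split (∙-cong
             (trans (trans (prod-cong {m} λ a → prod-cong {m} (second-part a)) second≈R) R-split)
             (trans (trans (prod-cong {m} λ a → prod-cong {m} (third-part a)) third≈R) R-split))) ⟩
      prod (λ a → f a a when (third a a Fin.≟ a)) ∙ _ ∎
      where
      K F₂ F₃ : Fin m → Fin m → Carrier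
      K a b = f a b when constant? (toℕ a) (toℕ b) (toℕ (third a b))
      F₂ a b = f a b when first? (toℕ b) (toℕ (third a b)) (toℕ a)
      F₃ a b = f a b when first? (toℕ (third a b)) (toℕ a) (toℕ b)
      distrib₂ : ∀ g h → prod (λ a → prod λ b → g a b ∙ h a b) ≈ prod (λ a → prod (g a)) ∙ prod (λ a → prod (h a))
      distrib₂ g h = trans (prod-cong {m} λ a → prod-distrib (g a) (h a)) (prod-distrib (prod ∘ g) (prod ∘ h))

    private
      third⇒∣ : ∀ {a} → third a a ≡ a → m ℕ.∣ toℕ a ℕ.+ toℕ a ℕ.+ toℕ a
      third⇒∣ {a} e = ≡.subst (Zero-sum a a) e (third-zero-sum a a)

      x+x+x≡x*3 : ∀ x → x ℕ.+ x ℕ.+ x ≡ x ℕ.* 3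
      x+x+x≡x*3 = solve 1 (λ x → x :+ x :+ x := x :* con 3) ≡.refl
        where open Data.Nat.Solver.+-*-Solver

      coprime-3 : ¬ 3 ℕ.∣ m → Coprime.Coprime m 3
      coprime-3 3∤m (d∣m , d∣3) with prime⇒irreducible (from-yes (prime? 3)) d∣3
      ... | inj₁ d≡1    = d≡1
      ... | inj₂ ≡.refl = contradiction d∣m 3∤m

      prod-at : ∀ i → prod (λ a → f a a when (a Fin.≟ i)) ≈ f i i
      prod-at i = trans (prod-single (λ a → f a a when (a Fin.≟ i)) i (λ a a≢i → when-no (f a a) (a Fin.≟ i) a≢i))
          (when-yes (f i i) (i Fin.≟ i) ≡.refl)

    fixed-∤ : ¬ 3 ℕ.∣ m → prod (λ a → f a a when (third a a Fin.≟ a)) ≈ f zero zero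
    fixed-∤ 3∤m = trans (prod-cong {m} pointwise) (prod-at zero)
      where
      pointwise : ∀ a → f a a when (third a a Fin.≟ a) ≈ f a a when (a Fin.≟ zero)
      pointwise a with third a a Fin.≟ a | a Fin.≟ zero
      ... | yes _ | yes _ = refl
      ... | no _  | no _  = refl
      ... | no ≢a | yes ≡.refl = contradiction (third-unique zero zero (ℕ.divides 0 ≡.refl)) ≢a
      ... | yes e | no a≢0 = contradiction (residue-unique 0 (Coprime.coprime-divisor (coprime-3 3∤m)
              (≡.subst (m ℕ.∣_) (≡.trans (x+x+x≡x*3 (toℕ a)) (ℕ.*-comm (toℕ a) 3)) (third⇒∣ e))) (ℕ.divides 0 ≡.refl)) a≢0

    fixed-∣ : ∀ k (k<m : k ℕ.< m) (2k<m : k ℕ.+ k ℕ.< m) → m ≡ k ℕ.* 3 →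
      prod (λ a → f a a when (third a a Fin.≟ a)) ≈
      f zero zero ∙ (f (fromℕ< k<m) (fromℕ< k<m) ∙ f (fromℕ< 2k<m) (fromℕ< 2k<m))
    fixed-∣ k k<m 2k<m m≡k*3 = begin
      prod (λ a → f a a when (third a a Fin.≟ a))
        ≈⟨ prod-cong {m} pointwise ⟩
      prod (λ a → f a a when (a Fin.≟ zero) ∙ (f a a when (a Fin.≟ κ) ∙ f a a when (a Fin.≟ 2κ)))
        ≈⟨ trans (prod-distrib (λ a → f a a when (a Fin.≟ zero)) (λ a → f a a when (a Fin.≟ κ) ∙ f a a when (a Fin.≟ 2κ)))
            (∙-congˡ (prod-distrib (λ a → f a a when (a Fin.≟ κ)) (λ a → f a a when (a Fin.≟ 2κ)))) ⟩
      _ ≈⟨ ∙-cong (prod-at zero) (∙-cong (prod-at κ) (prod-at 2κ)) ⟩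
      f zero zero ∙ (f κ κ ∙ f 2κ 2κ) ∎
      where
      κ 2κ : Fin m
      κ = fromℕ< k<m
      2κ = fromℕ< 2k<m
      k≢0 : ¬ k ≡ 0
      k≢0 ≡.refl = contradiction m≡k*3 λ ()
      0≢κ : ¬ zero ≡ κ
      0≢κ e = k≢0 (≡.trans (≡.sym (Fin.toℕ-fromℕ< k<m)) (≡.cong toℕ (≡.sym e)))
      0≢2κ : ¬ zero ≡ 2κ
      0≢2κ e = k≢0 (ℕ.m+n≡0⇒m≡0 k (≡.trans (≡.sym (Fin.toℕ-fromℕ< 2k<m)) (≡.cong toℕ (≡.sym e))))
      κ≢2κ : ¬ κ ≡ 2κ
      κ≢2κ e = k≢0 (ℕ.+-cancelˡ-≡ k k 0 (≡.trans (≡.sym (Fin.toℕ-fromℕ< 2k<m)) (≡.trans (≡.cong toℕ (≡.sym e))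
        (≡.trans (Fin.toℕ-fromℕ< k<m) (≡.sym (ℕ.+-identityʳ k))))))
      third-multiple : ∀ q (a : Fin m) → toℕ a ≡ q ℕ.* k → third a a ≡ a
      third-multiple q a e = third-unique a a (ℕ.divides q (≡.trans (x+x+x≡x*3 (toℕ a))
        (≡.trans (≡.cong (ℕ._* 3) e) (≡.trans (ℕ.*-assoc q k 3) (≡.cong (q ℕ.*_) (≡.sym m≡k*3))))))
      classify : ∀ a → third a a ≡ a → a ≡ zero ⊎ a ≡ κ ⊎ a ≡ 2κ
      classify a e with ℕ.*-cancelʳ-∣ 3 (≡.subst₂ ℕ._∣_ m≡k*3 (x+x+x≡x*3 (toℕ a)) (third⇒∣ e))
      ... | ℕ.divides 0 a≡ = inj₁ (Fin.toℕ-injective a≡)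
      ... | ℕ.divides 1 a≡ = inj₂ (inj₁ (Fin.toℕ-injective (≡.trans a≡ (≡.trans (ℕ.*-identityˡ k) (≡.sym (Fin.toℕ-fromℕ< k<m))))))
      ... | ℕ.divides 2 a≡ = inj₂ (inj₂ (Fin.toℕ-injective (≡.trans a≡
          (≡.trans (≡.cong (k ℕ.+_) (ℕ.+-identityʳ k)) (≡.sym (Fin.toℕ-fromℕ< 2k<m))))))
      ... | ℕ.divides (suc (suc (suc q))) a≡ = contradiction (Fin.toℕ<n a)
          (ℕ.≤⇒≯ (≡.subst₂ ℕ._≤_ (≡.trans (ℕ.*-comm 3 k) (≡.sym m≡k*3)) (≡.sym a≡)
              (ℕ.*-monoˡ-≤ k {3} {3 ℕ.+ q} (ℕ.m≤m+n 3 q))))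
      pointwise : ∀ a → f a a when (third a a Fin.≟ a) ≈ f a a when (a Fin.≟ zero) ∙
          (f a a when (a Fin.≟ κ) ∙ f a a when (a Fin.≟ 2κ))
      pointwise a with third a a Fin.≟ a | a Fin.≟ zero | a Fin.≟ κ | a Fin.≟ 2κ
      ... | _     | yes ≡.refl | yes e      | _     = contradiction e 0≢κ
      ... | _     | yes ≡.refl | no _       | yes e = contradiction e 0≢2κ
      ... | _     | no _       | yes ≡.refl | yes e = contradiction e κ≢2κ
      ... | yes _ | yes _      | no _       | no _  = sym (trans (∙-congˡ (identityˡ ε)) (identityʳ _))
      ... | yes _ | no _       | yes _      | no _  = sym (trans (identityˡ _) (identityʳ _))
      ... | yes _ | no _       | no _       | yes _ = sym (trans (identityˡ _) (identityˡ _))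
      ... | no _  | no _       | no _       | no _  = sym (trans (identityˡ _) (identityˡ ε))
      ... | no ≢a | yes ≡.refl | no _       | no _  = contradiction (third-multiple 0 a ≡.refl) ≢a
      ... | no ≢a | no _       | yes e      | no _  = contradiction (third-multiple 1 a
          (≡.trans (≡.cong toℕ e) (≡.trans (Fin.toℕ-fromℕ< k<m) (≡.sym (ℕ.*-identityˡ k))))) ≢a
      ... | no ≢a | no _       | no _       | yes e = contradiction (third-multiple 2 a
          (≡.trans (≡.cong toℕ e) (≡.trans (Fin.toℕ-fromℕ< 2k<m) (≡.cong (k ℕ.+_) (≡.sym (ℕ.+-identityʳ k)))))) ≢a
      ... | yes e | no a≢0     | no a≢κ     | no a≢2κ with classify a e
      ...   | inj₁ a≡0         = contradiction a≡0 a≢0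
      ...   | inj₂ (inj₁ a≡κ)  = contradiction a≡κ a≢κ
      ...   | inj₂ (inj₂ a≡2κ) = contradiction a≡2κ a≢2κ

-- Factors belonging to zero entries and constant triples

module SpectralFactors (m-1 : ℕ) (S : CommutativeRing 0ℓ 0ℓ) (φ : ℚ⟨i⟩ → CommutativeRing.Carrier S)
  (φ-hom : IsRingHomomorphism (DecRawRing.rawRing ℚ⟨i⟩-ring) (CommutativeRing.rawRing S) φ)
  (ζ : CommutativeRing.Carrier S) (principal : Geometric.Principal S (suc m-1) ζ) (w : CommutativeRing.Carrier S) where
  open Ring S
  open Geometric S
  open Principal principal
  open Cyclic m-1
  open RootsOfUnity m-1 S φ φ-hom ζ principal
  open SpectralProduct m-1 S φ φ-hom ζ principal w
  open Reasoning
  open Solver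
  private
    module φ = IsRingHomomorphism φ-hom

  factor-invariant : ∀ a b → factor a b ≈ factor b (third a b)
  factor-invariant a b = +-congˡ (-‿cong (*-congˡ (begin
    x + y + z  ≈⟨ solve 3 (λ x y z → x :+ y :+ z := y :+ z :+ x) refl x y z ⟩
    y + z + x  ≡⟨ ≡.cong (λ c → y + z + 2isin (toℕ c)) (third-unique b (third a b) (rotate {a} {b} (third-zero-sum a b))) ⟨
    y + z + 2isin (toℕ (third b (third a b)))  ∎)))
    where
    x = 2isin (toℕ a) ; y = 2isin (toℕ b) ; z = 2isin (toℕ (third a b))

  -- The triple is (0, b, -b), and the sines of opposite entries cancel.
  factor-zero : ∀ b → factor zero b ≈ w
  factor-zero b = begin
    w - ½ı * ((1# - 1#) + (y - ȳ) + (ζ ^ toℕ (third zero b) - ζ̄ ^ toℕ (third zero b)))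
      ≈⟨ +-congˡ (-‿cong (*-congˡ (+-congˡ (+-cong (ζ^third zero b) (-‿cong (ζ̄^third zero b)))))) ⟩
    w - ½ı * ((1# - 1#) + (y - ȳ) + (1# * ȳ - 1# * y))
      ≈⟨ solve 4 (λ w h y ȳ → w :- h :* ((con :1 :- con :1) :+ (y :- ȳ) :+ (con :1 :* ȳ :- con :1 :* y)) := w) refl w ½ı y ȳ ⟩
    w ∎
    where
    y = ζ ^ toℕ b ; ȳ = ζ̄ ^ toℕ b

  private
    27/4 : ℚ
    27/4 = ℤ.+ 27 ℚ./ 4

    -- 4 (i/2)² = -1
    ½ı²*27 : (½ı * ½ı) * (27 · 1#) ≈ - φ (embed 27/4)
    ½ı²*27 = begin
      (½ı * ½ı) * (27 · 1#)  ≈⟨ *-congˡ 4c ⟨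
      (½ı * ½ı) * (c + c + (c + c))  ≈⟨ solve 2 (λ h c → (h :* h) :* (c :+ c :+ (c :+ c)) := ((h :+ h) :* (h :+ h)) :* c)
          refl ½ı c ⟩
      ((½ı + ½ı) * (½ı + ½ı)) * c  ≈⟨ *-congʳ (trans (*-cong ½ı+½ı ½ı+½ı) ı²) ⟩
      - 1# * c  ≈⟨ -1*x≈-x c ⟩
      - c  ∎
      where
      c : Carrier
      c = φ (embed 27/4)
      open import Algebra.Definitions.RawSemiring (RawRing.rawSemiring (DecRawRing.rawRing ℚ⟨i⟩-ring)) using () renaming (_×_ to _·ᵢ_)
      4c : c + c + (c + c) ≈ 27 · 1#
      4c = begin
        c + c + (c + c)  ≈⟨ +-cong (φ.+-homo _ _) (φ.+-homo _ _) ⟨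
        φ (embed (27/4 ℚ.+ 27/4)) + φ (embed (27/4 ℚ.+ 27/4)) ≈⟨ φ.+-homo _ _ ⟨
        φ (27 ·ᵢ DecRawRing.1# ℚ⟨i⟩-ring)  ≈⟨ Homomorphism.×-homo _ S φ φ-hom 27 _ ⟩
        27 · φ (DecRawRing.1# ℚ⟨i⟩-ring)  ≈⟨ SemiringMult.×-congʳ semiring 27 φ.1#-homo ⟩
        27 · 1#  ∎

  module _ (k : ℕ) (k≢0 : ¬ k ≡ 0) (m≡k*3 : m ≡ k ℕ.* 3) where
    private
      ω ω̄ : Carrier
      ω = ζ ^ k
      ω̄ = ζ̄ ^ k

      ω^3≈1 : ω ^ 3 ≈ 1#
      ω^3≈1 = trans (^-assocʳ ζ k 3) (trans (^-congʳ ζ (≡.sym m≡k*3)) root)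

      m∤k : ¬ m ℕ.∣ k
      m∤k m∣k = k≢0 (ℕ.m*n≡0⇒m≡0 k 2 (ℕ.+-cancelˡ-≡ k (k ℕ.* 2) 0 (≡.trans (≡.sym (ℕ.*-suc k 2))
        (≡.trans (≡.sym m≡k*3) (≡.trans (ℕ.∣-antisym m∣k (≡.subst (k ℕ.∣_) (≡.sym m≡k*3) (ℕ.m∣m*n 3)))
            (≡.sym (ℕ.+-identityʳ k)))))))

      -- ω - 1 cannot be cancelled from ω³ = 1 in the presence of zero divisors. The sum is fixed by
      -- ω instead, and the vanishing orthogonality sum of ζ^k over m terms annihilates everything
      -- that ω fixes.
      1+ω+ω² : 1# + (ω * 1# + (ω * (ω * 1#) + 0#)) ≈ 0#
      1+ω+ω² = fixed⇒≈0 m (ScalarInverse.regular S φ φ-hom m) (geometric-fixed ω 3 ω^3≈1) (orthogonal k m∤k)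

      -- ω̄ = ω⁻¹ = ω² = -1 - ω
      ω̄≈ : ω̄ ≈ - 1# - ω
      ω̄≈ = begin
        ω̄  ≈⟨ *-identityˡ ω̄ ⟨
        1# * ω̄  ≈⟨ *-congʳ ω^3≈1 ⟨
        (ω * (ω * (ω * 1#))) * ω̄  ≈⟨ solve 2 (λ x y → (x :* (x :* (x :* con :1))) :* y := (x :* x) :* (x :* y)) refl ω ω̄ ⟩
        (ω * ω) * (ω * ω̄)  ≈⟨ *-congˡ (ζ^*ζ̄^ k) ⟩
        (ω * ω) * 1#  ≈⟨ solve 1 (λ x → (x :* x) :* con :1 := (con :1 :+ (x :* con :1 :+ (x :* (x :* con :1) :+ con :0)))
            :- con :1 :- x) refl ω ⟩
        (1# + (ω * 1# + (ω * (ω * 1#) + 0#))) - 1# - ω ≈⟨ +-congʳ (+-congʳ 1+ω+ω²) ⟩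
        0# - 1# - ω  ≈⟨ +-congʳ (+-identityˡ _) ⟩
        - 1# - ω  ∎

      t : Carrier
      t = 2isin k

      t²≈-3 : t * t ≈ - (3 · 1#)
      t²≈-3 = begin
        t * t  ≈⟨ *-cong t≈ t≈ ⟩
        (ω - (- 1# - ω)) * (ω - (- 1# - ω))  ≈⟨ solve 1 (λ x → (x :- (:- con :1 :- x)) :* (x :- (:- con :1 :- x))
             := (con :1 :+ con :1 :+ con :1 :+ con :1) :* (con :1 :+ (x :* con :1 :+ (x :* (x :* con :1) :+ con :0))) :-
                 con (3 , 0)) refl ω ⟩
        (1# + 1# + 1# + 1#) * (1# + (ω * 1# + (ω * (ω * 1#) + 0#))) - _ ≈⟨ +-congʳ (trans (*-congˡ 1+ω+ω²) (zeroʳ _)) ⟩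
        0# - _  ≈⟨ +-identityˡ _ ⟩
        - _  ≈⟨ -‿cong (solve 0 (con (3 , 0) := con :1 :+ (con :1 :+ (con :1 :+ con :0))) refl) ⟩
        - (3 · 1#)  ∎
        where
        t≈ : t ≈ ω - (- 1# - ω)
        t≈ = +-congˡ (-‿cong ω̄≈)

      2isin-double : 2isin (k ℕ.+ k) ≈ - t
      2isin-double = begin
        ζ ^ (k ℕ.+ k) - ζ̄ ^ (k ℕ.+ k)  ≈⟨ +-cong (^-homo-* ζ k k) (-‿cong (^-homo-* ζ̄ k k)) ⟩
        ω * ω - ω̄ * ω̄  ≈⟨ solve 2 (λ x y → x :* x :- y :* y := (x :- y) :* (x :+ y)) refl ω ω̄ ⟩
        t * (ω + ω̄)  ≈⟨ *-congˡ (+-congˡ ω̄≈) ⟩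
        t * (ω + (- 1# - ω))  ≈⟨ solve 2 (λ t x → t :* (x :+ (:- con :1 :- x)) := :- t) refl t ω ⟩
        - t  ∎

    -- The constant triples of k and 2 k have the opposite eigenvalues ± 3 t i/2, where t = 2 i sin
    -- (2 π / 3) has square -3. Their common square is (-1/4) · 9 · (-3) = 27/4.
    fixed-product : ∀ {a b : Fin m} → toℕ a ≡ k → third a a ≡ a → toℕ b ≡ k ℕ.+ k → third b b ≡ b →
      factor a a * factor b b ≈ w * w - φ (embed 27/4)
    fixed-product {a} {b} a≡ a-fixed b≡ b-fixed = begin
      factor a a * factor b b
        ≈⟨ *-cong (value a-fixed (reflexive (≡.cong 2isin a≡))) (value b-fixed
            (trans (reflexive (≡.cong 2isin b≡)) 2isin-double)) ⟩
      (w - ½ı * (t + t + t)) * (w - ½ı * (- t + - t + - t))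
        ≈⟨ solve 3 (λ w h t → (w :- h :* (t :+ t :+ t)) :* (w :- h :* (:- t :+ :- t :+ :- t))
             := w :* w :- (h :* h) :* (con (9 , 0) :* (t :* t))) refl w ½ı t ⟩
      w * w - (½ı * ½ı) * (_ * (t * t))
        ≈⟨ +-congˡ (-‿cong (*-congˡ (*-congˡ t²≈-3))) ⟩
      w * w - (½ı * ½ı) * (_ * - (3 · 1#))
        ≈⟨ solve 3 (λ w hh x → w :* w :- hh :* (con (9 , 0) :* :- (con :1 :+ (con :1 :+ (con :1 :+ con :0)))) := w :* w :+
            hh :* con (27 , 0)) refl w (½ı * ½ı) 1# ⟩
      w * w + (½ı * ½ı) * _
        -- The solver renders its constant 27 as an optimised multiple, whereas `27 · 1#` is the
        -- unary one.
        ≈⟨ +-congˡ (*-congˡ (Mult′.×ᵤ≈× semiring 27 1#)) ⟨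
      w * w + (½ı * ½ı) * (27 · 1#)
        ≈⟨ +-congˡ ½ı²*27 ⟩
      w * w - φ (embed 27/4) ∎
      where
      value : ∀ {a : Fin m} {s} → third a a ≡ a → 2isin (toℕ a) ≈ s → factor a a ≈ w - ½ı * (s + s + s)
      value {a} fixed e = +-congˡ (-‿cong (*-congˡ (+-cong (+-cong e e) (trans (reflexive (≡.cong (2isin ∘ toℕ) fixed)) e))))

-- Rationality of the cube root

module RationalSeries (A : CommutativeRing 0ℓ 0ℓ) (κ : ℚ → CommutativeRing.Carrier A)
  (κ-hom : IsRingHomomorphism Gaussian.rawRing-ℚ (CommutativeRing.rawRing A) κ) where
  private
    module A = Ring A
    module κ = IsRingHomomorphism κ-hom
  open Series A

  Rational : Series → Set
  Rational f = ∀ k → ∃ λ q → f k A.≈ κ q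

  Rational-cong : ∀ {f g} → f ≈ₛ g → Rational f → Rational g
  Rational-cong e r k = let q , f≈q = r k in q , A.trans (A.sym (e k)) f≈q

  Rational-+ : ∀ {f g} → Rational f → Rational g → Rational (f S.+ g)
  Rational-+ r s k = let p , f≈p = r k ; q , g≈q = s k in p ℚ.+ q , A.trans (A.+-cong f≈p g≈q) (A.sym (κ.+-homo p q))

  Rational-neg : ∀ {f} → Rational f → Rational (S.- f)
  Rational-neg r k = let p , f≈p = r k in ℚ.- p , A.trans (A.-‿cong f≈p) (A.sym (κ.-‿homo p))

  Rational-* : ∀ {f g} → Rational f → Rational g → Rational (f S.* g)
  Rational-* r s zero    = let p , f≈p = r 0 ; q , g≈q = s 0 in p ℚ.* q , A.trans (A.*-cong f≈p g≈q) (A.sym (κ.*-homo p q))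
  Rational-* {f} {g} r s (suc k) =
    let p , f≈p = r 0 ; q , g≈q = s (suc k) ; t , rest≈t = Rational-* {tail f} {g} (r ∘ suc) s k in
    p ℚ.* q ℚ.+ t , A.trans (A.+-cong (A.trans (A.*-cong f≈p g≈q) (A.sym (κ.*-homo p q))) rest≈t) (A.sym (κ.+-homo _ t))

  Rational-constant : ∀ q → Rational (constant (κ q))
  Rational-constant q zero    = q , A.refl
  Rational-constant q (suc k) = 0ℚ , A.sym κ.0#-homo

  Rational-var : Rational var
  Rational-var zero          = 0ℚ , A.sym κ.0#-homo
  Rational-var (suc zero)    = 1ℚ , A.sym κ.1#-homo
  Rational-var (suc (suc k)) = 0ℚ , A.sym κ.0#-homo

  Rational-^ : ∀ {f} n → Rational f → Rational (f S.^ n)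
  Rational-^ zero    r = Rational-cong (λ { zero → κ.1#-homo ; (suc k) → A.refl }) (Rational-constant 1ℚ)
  Rational-^ (suc n) r = Rational-* r (Rational-^ n r)

  -- If E agrees with F above degree d, then the top coefficient of
  -- G F³ - G E³ = (F - E) G (F² + F E + E²) is three times that of F - E.
  cube-root-rational : ∀ {g n G F} → Monic g G → Rational G → Monic n F → Rational (G S.* (F S.* (F S.* F))) → Rational F
  cube-root-rational {g} {n} {G} {F} G-monic G-rational F-monic GF³-rational =
    let E , E-rational , F-E≈0 = approximate n 0 (ℕ.+-identityʳ n) in
    Rational-cong (S.sym (S.x-y≈0⇒x≈y F E (λ k → F-E≈0 k z≤n))) E-rational
    where
    approximate : ∀ e d → e ℕ.+ d ≡ n → ∃ λ E → Rational E × Below d (F S.- E)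
    approximate zero    d ≡.refl = var S.^ n , Rational-^ n Rational-var , below
      where
      below : Below n (F S.- var S.^ n)
      below k n≤k with ℕ.m≤n⇒m<n∨m≡n n≤k
      ... | inj₁ n<k    = A.trans (A.+-cong (proj₂ F-monic k n<k) (A.-‿cong (proj₂ (Monic-var^ n) k n<k))) (A.-‿inverseʳ _)
      ... | inj₂ ≡.refl = A.trans (A.+-cong (proj₁ F-monic) (A.-‿cong (proj₁ (Monic-var^ n)))) (A.-‿inverseʳ _)
    approximate (suc e) d e+d≡n with approximate e (suc d) (≡.trans (ℕ.+-suc e d) e+d≡n)
    ... | E , E-rational , Δ-below = E S.+ E′ , Rational-+ E-rational (Rational-* (Rational-constant q)
        (Rational-^ d Rational-var)) , below
      where
      open S.Solver
      Δ H : Series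
      Δ = F S.- E
      H = G S.* (F S.* F S.+ F S.* E S.+ E S.* E)
      -- The error has degree at most d < n, so `E` has the same leading term as `F`.
      E-monic : Monic n E
      E-monic = Monic-cong (solve 2 (λ f e → f :+ :- (f :- e) := e) S.refl F E)
        (Monic-+ F-monic (Below-neg (Below-≤ (ℕ.≤-trans (s≤s (ℕ.m≤n+m d e)) (ℕ.≤-reflexive e+d≡n)) Δ-below)))
      FF FE EE : Monic (n ℕ.+ n) _
      FF = Monic-* F-monic F-monic
      FE = Monic-* F-monic E-monic
      EE = Monic-* E-monic E-monic
      H-below : Below (suc (g ℕ.+ (n ℕ.+ n))) H
      H-below = Below-≤ (ℕ.≤-reflexive (ℕ.+-suc g (n ℕ.+ n))) (Below-* (proj₂ G-monic)
          (Below-+ (Below-+ (proj₂ FF) (proj₂ FE)) (proj₂ EE)))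
      3# : A.Carrier
      3# = A.1# A.+ A.1# A.+ A.1#
      H-top : H (g ℕ.+ (n ℕ.+ n)) A.≈ 3#
      H-top = A.trans (top-* (proj₂ G-monic) (Below-+ (Below-+ (proj₂ FF) (proj₂ FE)) (proj₂ EE)))
        (A.trans (A.*-cong (proj₁ G-monic) (A.+-cong (A.+-cong (proj₁ FF) (proj₁ FE)) (proj₁ EE))) (A.*-identityˡ _))
      difference : Rational (G S.* (F S.* (F S.* F)) S.- G S.* (E S.* (E S.* E)))
      difference = Rational-+ GF³-rational (Rational-neg (Rational-* G-rational
          (Rational-* E-rational (Rational-* E-rational E-rational))))
      -- The top degree d of the error plus the degree g + 2 n of `H`, whose leading coefficient is
      -- 3 because F², F E and E² are all monic. A third of the rational coefficient at `N` is the
      -- next coefficient of the error.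
      N : ℕ
      N = d ℕ.+ (g ℕ.+ (n ℕ.+ n))
      p ⅓ q : ℚ
      p = proj₁ (difference N)
      ⅓ = ℤ.+ 1 ℚ./ 3
      q = p ℚ.* ⅓
      E′ : Series
      E′ = constant (κ q) S.* var S.^ d
      3*⅓ : 3# A.* κ ⅓ A.≈ A.1#
      3*⅓ = begin
        3# A.* κ ⅓  ≈⟨ A.Solver.solve 1 (λ x → (A.Solver.con A.Solver.:1 A.Solver.:+ A.Solver.con A.Solver.:1 A.Solver.:+
            A.Solver.con A.Solver.:1) A.Solver.:* x A.Solver.:= x A.Solver.:+ x A.Solver.:+ x) A.refl (κ ⅓) ⟩
        κ ⅓ A.+ κ ⅓ A.+ κ ⅓  ≈⟨ A.trans (κ.+-homo _ _) (A.+-congʳ (κ.+-homo _ _)) ⟨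
        κ (⅓ ℚ.+ ⅓ ℚ.+ ⅓)  ≈⟨ κ.⟦⟧-cong ≡.refl ⟩
        κ 1ℚ  ≈⟨ κ.1#-homo ⟩
        A.1#  ∎
        where
        open A.Reasoning
      Δ-top : Δ d A.≈ κ q
      Δ-top = begin
        Δ d  ≈⟨ A.*-identityʳ _ ⟨
        Δ d A.* A.1#  ≈⟨ A.*-congˡ 3*⅓ ⟨
        Δ d A.* (3# A.* κ ⅓)  ≈⟨ A.*-assoc _ _ _ ⟨
        (Δ d A.* 3#) A.* κ ⅓  ≈⟨ A.*-congʳ (A.*-congˡ H-top) ⟨
        (Δ d A.* H (g ℕ.+ (n ℕ.+ n))) A.* κ ⅓  ≈⟨ A.*-congʳ (top-* {d} Δ-below H-below) ⟨
        (Δ S.* H) N A.* κ ⅓  ≈⟨ A.*-congʳ (solve 3 (λ f e g → (f :- e) :* (g :* (f :* f :+ f :* e :+ e :* e))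
                                                 := g :* (f :* (f :* f)) :- g :* (e :* (e :* e))) S.refl F E G N) ⟩
        (G S.* (F S.* (F S.* F)) S.- G S.* (E S.* (E S.* E))) N A.* κ ⅓  ≈⟨ A.*-congʳ (proj₂ (difference N)) ⟩
        κ p A.* κ ⅓  ≈⟨ κ.*-homo p ⅓ ⟨
        κ q  ∎
        where open A.Reasoning
      E′-value : ∀ k → E′ k A.≈ κ q A.* (var S.^ d) k
      E′-value = constant-* (κ q) (var S.^ d)
      below : Below d (F S.- (E S.+ E′))
      below k d≤k = A.trans (A.Solver.solve 3 (λ f e x → f A.Solver.:- (e A.Solver.:+ x) A.Solver.:= (f A.Solver.:- e)
          A.Solver.:- x) A.refl (F k) (E k) (E′ k)) (cases (ℕ.m≤n⇒m<n∨m≡n d≤k))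
        where
        cases : d ℕ.< k ⊎ d ≡ k → Δ k A.- E′ k A.≈ A.0#
        cases (inj₁ d<k) = A.trans (A.+-cong (Δ-below k d<k) (A.-‿cong
            (A.trans (E′-value k) (A.trans (A.*-congˡ (proj₂ (Monic-var^ d) k d<k)) (A.zeroʳ _)))))
          (A.-‿inverseʳ A.0#)
        cases (inj₂ ≡.refl) = A.trans (A.+-cong Δ-top (A.-‿cong (A.trans (E′-value d)
            (A.trans (A.*-congˡ (proj₁ (Monic-var^ d))) (A.*-identityʳ _)))))
          (A.-‿inverseʳ (κ q))

  open SeriesEmbedding ℚ-ring A κ κ-hom public using (expand; expand-hom; expand-coeff; eval-const; eval-X; deg-unique)

  private
    takeℕ : ℕ → (ℕ → ℚ) → Pℚ.Poly
    takeℕ zero    q = []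
    takeℕ (suc n) q = q 0 ∷ takeℕ n (q ∘ suc)

    coeff-take-< : ∀ n q k → k ℕ.< n → Pℚ.coeff (takeℕ n q) k ≡ q k
    coeff-take-< (suc n) q zero    _         = ≡.refl
    coeff-take-< (suc n) q (suc k) (s≤s k<n) = coeff-take-< n (q ∘ suc) k k<n

    coeff-take-≥ : ∀ n q k → n ℕ.≤ k → Pℚ.coeff (takeℕ n q) k ≡ 0ℚ
    coeff-take-≥ zero    q k       _         = ≡.refl
    coeff-take-≥ (suc n) q (suc k) (s≤s n≤k) = coeff-take-≥ n (q ∘ suc) k n≤k

  rational-polynomial : ¬ A.1# A.≈ A.0# → ∀ {n F} → Monic n F → Rational F →
    Σ[ E ∈ Pℚ.Poly ] expand E ≈ₛ F × Pℚ.deg E ≡ n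
  rational-polynomial 1≉0 {n} {F} (top , below) r = E , expand-E , deg-unique E n
      (λ e → 1≉0 (A.trans (A.sym top) (A.trans (A.sym (expand-E n)) (A.trans (expand-coeff E n)
          (A.trans (κ.⟦⟧-cong e) κ.0#-homo)))))
      (λ k n<k → coeff-take-≥ (suc n) q k n<k)
    where
    q : ℕ → ℚ
    q = proj₁ ∘ r
    E : Pℚ.Poly
    E = takeℕ (suc n) q
    expand-E : expand E ≈ₛ F
    expand-E k with k ℕ.<? suc n
    ... | yes k<n = A.trans (expand-coeff E k) (A.trans (κ.⟦⟧-cong (coeff-take-< (suc n) q k k<n)) (A.sym (proj₂ (r k))))
    ... | no k≮n  = A.trans (expand-coeff E k) (A.trans (κ.⟦⟧-cong (coeff-take-≥ (suc n) q k (ℕ.≮⇒≥ k≮n)))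
      (A.trans κ.0#-homo (A.sym (below k (ℕ.≮⇒≥ k≮n)))))

-- The spectrum as a cube and its invariance under conjugation

module SpectralOrbits (m-1 : ℕ) (S : CommutativeRing 0ℓ 0ℓ) (φ : ℚ⟨i⟩ → CommutativeRing.Carrier S)
  (φ-hom : IsRingHomomorphism (DecRawRing.rawRing ℚ⟨i⟩-ring) (CommutativeRing.rawRing S) φ)
  (ζ : CommutativeRing.Carrier S) (principal : Geometric.Principal S (suc m-1) ζ) (w : CommutativeRing.Carrier S) where
  open Ring S
  open Cyclic m-1
  open RootsOfUnity m-1 S φ φ-hom ζ principal using (ζ̄)
  open SpectralProduct m-1 S φ φ-hom ζ principal w using (factor; 2isin; ½ı)
  open SpectralFactors m-1 S φ φ-hom ζ principal w
  open Orbits m-1 *-commutativeMonoid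

  spectrum : Carrier
  spectrum = prod λ a → prod λ b → factor a b

  orbit-spectrum : Carrier
  orbit-spectrum = representatives factor factor-invariant

  fixed-spectrum : Carrier
  fixed-spectrum = prod λ a → factor a a when (third a a Fin.≟ a)

  private
    exponents : 1 ℕ.+ (m-1 ℕ.+ (m-1 ℕ.+ m-1)) ≡ 3 ℕ.* m ℕ.∸ 2
    exponents = ≡.sym (≡.cong (ℕ._∸ 2) (solve 1 (λ x →
      con 3 :* (con 1 :+ x) := con 2 :+ (con 1 :+ (x :+ (x :+ x)))) ≡.refl m-1))
      where open Data.Nat.Solver.+-*-Solver

    w-power : w ^ (3 ℕ.* m ℕ.∸ 2) ≈ w * (w ^ m-1 * (w ^ m-1 * w ^ m-1))
    w-power = trans (^-congʳ w (≡.sym exponents)) (*-congˡ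
      (trans (^-homo-* w m-1 (m-1 ℕ.+ m-1)) (*-congˡ (^-homo-* w m-1 m-1))))

  -- The zero triple gives w, and the row of zero gives w^(m-1), which is cubed with the rest;
  -- altogether 1 + 3 (m - 1) = 3 m - 2, the exponent in the denominator of `D`. `K` collects the
  -- other constant triples.
  spectrum-cube : ∀ {K} → fixed-spectrum ≈ w * K →
    spectrum ≈ (K * w ^ (3 ℕ.* m ℕ.∸ 2)) * (orbit-spectrum * (orbit-spectrum * orbit-spectrum))
  spectrum-cube {K} fixed≈ = begin
    spectrum  ≈⟨ orbit-product factor factor-invariant ⟩
    fixed-spectrum * (r * (r * r))  ≈⟨ *-cong fixed≈ (*-cong r≈ (*-cong r≈ r≈)) ⟩
    (w * K) * ((v * f) * ((v * f) * (v * f)))  ≈⟨ solve 4 (λ x k v f → (x :* k) :* ((v :* f) :* ((v :* f) :* (v :* f)))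
                                                            := (k :* (x :* (v :* (v :* v)))) :* (f :* (f :* f))) refl w K v f ⟩
    (K * (w * (v * (v * v)))) * (f * (f * f))  ≈⟨ *-congʳ (*-congˡ w-power) ⟨
    (K * w ^ (3 ℕ.* m ℕ.∸ 2)) * (f * (f * f))  ∎
    where
    open Reasoning
    open Solver
    v f r : Carrier
    v = w ^ m-1
    f = orbit-spectrum
    r = prod (λ b → factor zero (suc b)) * f
    r≈ : r ≈ v * f
    r≈ = *-congʳ (trans (prod-cong {m-1} (λ b → factor-zero (suc b))) (prod-replicate m-1))

  fixed-spectrum-∤ : ¬ 3 ℕ.∣ m → fixed-spectrum ≈ w * 1#
  fixed-spectrum-∤ 3∤m = trans (fixed-∤ factor factor-invariant 3∤m) (trans (factor-zero zero) (sym (*-identityʳ w)))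

  fixed-spectrum-∣ : 3 ℕ.∣ m → fixed-spectrum ≈ w * (w * w - φ (embed (ℤ.+ 27 ℚ./ 4)))
  fixed-spectrum-∣ (ℕ.divides k m≡k*3) = trans (fixed-∣ factor factor-invariant k k<m 2k<m m≡k*3)
    (*-cong (factor-zero zero) (fixed-product k k≢0 m≡k*3
      (Fin.toℕ-fromℕ< k<m) (fixed 1 k<m (≡.sym (ℕ.*-identityˡ k)))
      (Fin.toℕ-fromℕ< 2k<m) (fixed 2 2k<m (≡.cong (k ℕ.+_) (≡.sym (ℕ.*-identityˡ k))))))
    where
    open ThirdPart k m≡k*3
    fixed : ∀ q {j} (j<m : j ℕ.< m) → j ≡ q ℕ.* k → third (fromℕ< j<m) (fromℕ< j<m) ≡ fromℕ< j<m
    fixed q {j} j<m j≡qk = third-unique (fromℕ< j<m) (fromℕ< j<m) (≡.subst (λ x → m ℕ.∣ x ℕ.+ x ℕ.+ x)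
        (≡.sym (Fin.toℕ-fromℕ< j<m))
      (ℕ.divides q (≡.trans (≡.cong (λ x → x ℕ.+ x ℕ.+ x) j≡qk) (≡.trans (solve 2 (λ q k →
         q :* k :+ q :* k :+ q :* k := q :* (k :* con 3)) ≡.refl q k)
         (≡.cong (q ℕ.*_) (≡.sym m≡k*3))))))
      where open Data.Nat.Solver.+-*-Solver

-- Complex conjugation replaces i by - i and ζ by its inverse, which preserves the spectrum.
module SpectralConjugation (m-1 : ℕ) (S : CommutativeRing 0ℓ 0ℓ) (φ φ̄ : ℚ⟨i⟩ → CommutativeRing.Carrier S)
  (φ-hom : IsRingHomomorphism (DecRawRing.rawRing ℚ⟨i⟩-ring) (CommutativeRing.rawRing S) φ)
  (φ̄-hom : IsRingHomomorphism (DecRawRing.rawRing ℚ⟨i⟩-ring) (CommutativeRing.rawRing S) φ̄)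
  (conjugate : ∀ z → CommutativeRing._≈_ S (φ̄ z) (φ (Gaussian.conjugate z)))
  (ζ : CommutativeRing.Carrier S) (principal : Geometric.Principal S (suc m-1) ζ) (w : CommutativeRing.Carrier S) where
  open Ring S
  open Geometric S using (Principal; Principal-^)
  open Cyclic m-1
  open Solver

  ζ̄ : Carrier
  ζ̄ = ζ ^ m-1
  ζ̄-principal : Principal m ζ̄
  ζ̄-principal = Principal-^ principal

  private
    module U = RootsOfUnity m-1 S φ φ-hom ζ principal
    module Ū = RootsOfUnity m-1 S φ̄ φ̄-hom ζ̄ ζ̄-principal
    module P = SpectralProduct m-1 S φ φ-hom ζ principal w
    module P̄ = SpectralProduct m-1 S φ̄ φ̄-hom ζ̄ ζ̄-principal w

    ζ̿≈ζ : ζ̄ ^ m-1 ≈ ζ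
    ζ̿≈ζ = begin
      ζ̄ ^ m-1  ≈⟨ *-identityˡ _ ⟨
      1# * ζ̄ ^ m-1  ≈⟨ *-congʳ U.ζ*ζ̄ ⟨
      (ζ * ζ̄) * ζ̄ ^ m-1  ≈⟨ *-assoc ζ ζ̄ (ζ̄ ^ m-1) ⟩
      ζ * (ζ̄ * ζ̄ ^ m-1)  ≈⟨ *-congˡ Ū.ζ*ζ̄ ⟩
      ζ * 1#  ≈⟨ *-identityʳ ζ ⟩
      ζ  ∎
      where open Reasoning

  -- The scalar `½ı` and the differences `2isin` both change sign, so the eigenvalue does not.
  conjugate-factor : ∀ a b → P̄.factor a b ≈ P.factor a b
  conjugate-factor a b = +-congˡ (-‿cong (trans
    (*-cong ½ı (+-cong (+-cong (2isin (toℕ a)) (2isin (toℕ b))) (2isin (toℕ (third a b)))))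
    (solve 4 (λ h x y z → (:- h) :* ((:- x) :+ (:- y) :+ (:- z)) := h :* (x :+ y :+ z)) refl
      P.½ı (P.2isin (toℕ a)) (P.2isin (toℕ b)) (P.2isin (toℕ (third a b))))))
    where
    ½ı : P̄.½ı ≈ - P.½ı
    ½ı = trans (conjugate (0ℚ +i ½)) (IsRingHomomorphism.-‿homo φ-hom (0ℚ +i ½))
    2isin : ∀ k → P̄.2isin k ≈ - P.2isin k
    2isin k = trans (+-congˡ (-‿cong (^-congˡ k ζ̿≈ζ))) (solve 2 (λ x y → y :- x := :- (x :- y)) refl (ζ ^ k) (ζ̄ ^ k))

  conjugate-spectrum : (prod λ a → prod λ b → P̄.factor a b) ≈ (prod λ a → prod λ b → P.factor a b)
  conjugate-spectrum = prod-cong {m} λ a → prod-cong {m} (conjugate-factor a)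

-- Orbit count, descent to ℚ and conclusion

open import Defs using (module ℚi[w]; w²-27/4)

scaled-resultant : ℕ → Pw.Poly
scaled-resultant m = DecRawRing._*_ Rw (Pw.const (embed (DecRawRing._^_ ℚ-ring ½ (m ℕ.^ 2)))) (resultant m)

module _ (S : CommutativeRing 0ℓ 0ℓ) (e : Pw.Poly → CommutativeRing.Carrier S)
  (e-hom : IsRingHomomorphism (DecRawRing.rawRing Rw) (CommutativeRing.rawRing S) e) where
  open Ring S
  open Solver

  -- The conclusion is the image of `N /w^ l ≈ᴸ p /w^ 0` with `≈ᴸ` unfolded; the powers of w in the
  -- spectrum therefore reappear beside `p`.
  cross-multiply : ∀ N p l {w K F} → e Pw.X ≈ w → e N ≈ (K * w ^ l) * (F * (F * F)) → e p ≈ K * F ^ 3 →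
    e (N Pw.⊛ (Pw.X ℚi[w].^ 0)) ≈ e (p Pw.⊛ (Pw.X ℚi[w].^ l))
  cross-multiply N p l {w} {K} {F} X≈ N≈ p≈ = begin
    e (N Pw.⊛ (Pw.X ℚi[w].^ 0))  ≈⟨ E.*-homo N (Pw.X ℚi[w].^ 0) ⟩
    e N * e (Pw.X ℚi[w].^ 0)  ≈⟨ *-cong N≈ E.1#-homo ⟩
    ((K * w ^ l) * (F * (F * F))) * 1#  ≈⟨ solve 3 (λ k x f → ((k :* x) :* (f :* (f :* f))) :* con :1 :=
        (k :* (f :* (f :* (f :* con :1)))) :* x) refl K (w ^ l) F ⟩
    (K * F ^ 3) * w ^ l  ≈⟨ *-cong p≈ (trans (H.^-homo Pw.X l) (^-congˡ l X≈)) ⟨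
    e p * e (Pw.X ℚi[w].^ l)  ≈⟨ E.*-homo p (Pw.X ℚi[w].^ l) ⟨
    e (p Pw.⊛ (Pw.X ℚi[w].^ l))  ∎
    where
    open Reasoning
    module E = IsRingHomomorphism e-hom
    module H = Homomorphism (DecRawRing.rawRing Rw) S e e-hom

module OrbitCount (m-1 : ℕ) where
  open Cyclic m-1
  open Orbits m-1 ℕ.+-0-commutativeMonoid
  private
    Sum : ∀ {n} → (Fin n → ℕ) → ℕ
    Sum = MonoidSum.sum ℕ.+-0-commutativeMonoid

    1₂ : Fin m → Fin m → ℕ
    1₂ _ _ = 1

  -- The same enumeration as in the orbit product, with each factor replaced by its degree 1.
  orbit-count : ℕ
  orbit-count = representatives 1₂ (λ _ _ → ≡.refl)

  private
    Sum-const : ∀ k c → Sum {k} (λ _ → c) ≡ k ℕ.* c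
    Sum-const zero    c = ≡.refl
    Sum-const (suc k) c = ≡.cong (c ℕ.+_) (Sum-const k c)

    total : Sum {m} (λ a → Sum {m} (1₂ a)) ≡ m ℕ.* m
    total = ≡.trans (Sum-const m (Sum {m} (λ _ → 1)))
      (≡.cong (m ℕ.*_) (≡.trans (Sum-const m 1) (ℕ.*-identityʳ m)))

    count : ∀ {fixed} → Sum (λ a → 1 when (third a a Fin.≟ a)) ≡ fixed →
      m ℕ.* m ≡ fixed ℕ.+ (let r = m-1 ℕ.+ orbit-count in r ℕ.+ (r ℕ.+ r))
    count {fixed} fixed≡ = begin
      m ℕ.* m  ≡⟨ total ⟨
      Sum {m} (λ a → Sum {m} (1₂ a))  ≡⟨ orbit-product 1₂ (λ _ _ → ≡.refl) ⟩
      Sum (λ a → 1 when (third a a Fin.≟ a)) ℕ.+ r₃ (Sum {m-1} (λ _ → 1))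
        ≡⟨ ≡.cong₂ (λ f s → f ℕ.+ r₃ s) fixed≡ (≡.trans (Sum-const m-1 1) (ℕ.*-identityʳ m-1)) ⟩
      fixed ℕ.+ r₃ m-1  ∎
      where
      open ≡.≡-Reasoning
      r₃ : ℕ → ℕ
      r₃ s = (s ℕ.+ orbit-count) ℕ.+ ((s ℕ.+ orbit-count) ℕ.+ (s ℕ.+ orbit-count))

    open Data.Nat.Solver.+-*-Solver

  count-∤ : ∀ p → m-1 ≡ suc p → ¬ 3 ℕ.∣ m → suc p ℕ.* p ≡ orbit-count ℕ.* 3
  -- Here m = p + 2, and (p + 1) p + (4 + 3 p) = m². Adding 4 + 3 p on both sides avoids truncated
  -- subtraction.
  count-∤ p ≡.refl 3∤m = ℕ.+-cancelʳ-≡ (4 ℕ.+ 3 ℕ.* p) _ _ (begin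
    suc p ℕ.* p ℕ.+ (4 ℕ.+ 3 ℕ.* p)  ≡⟨ solve 1 (λ p → (con 1 :+ p) :* p :+ (con 4 :+ con 3 :* p) := (con 2 :+ p) :*
        (con 2 :+ p)) ≡.refl p ⟩
    m ℕ.* m  ≡⟨ count (fixed-∤ 1₂ (λ _ _ → ≡.refl) 3∤m) ⟩
    1 ℕ.+ (r ℕ.+ (r ℕ.+ r))  ≡⟨ solve 2 (λ p n → con 1 :+ ((con 1 :+ p :+ n) :+ ((con 1 :+ p :+ n) :+ (con 1 :+ p :+ n)))
                                              := n :* con 3 :+ (con 4 :+ con 3 :* p)) ≡.refl p orbit-count ⟩
    orbit-count ℕ.* 3 ℕ.+ (4 ℕ.+ 3 ℕ.* p) ∎)
    where
    open ≡.≡-Reasoning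
    r : ℕ
    r = suc p ℕ.+ orbit-count

  count-∣ : ∀ p → m-1 ≡ suc p → 3 ℕ.∣ m → suc p ℕ.* p ≡ 2 ℕ.+ orbit-count ℕ.* 3
  count-∣ p ≡.refl 3∣m = ℕ.+-cancelʳ-≡ (4 ℕ.+ 3 ℕ.* p) _ _ (begin
    suc p ℕ.* p ℕ.+ (4 ℕ.+ 3 ℕ.* p)  ≡⟨ solve 1 (λ p → (con 1 :+ p) :* p :+ (con 4 :+ con 3 :* p) := (con 2 :+ p) :*
        (con 2 :+ p)) ≡.refl p ⟩
    m ℕ.* m  ≡⟨ count (fixed-points 3∣m) ⟩
    3 ℕ.+ (r ℕ.+ (r ℕ.+ r))  ≡⟨ solve 2 (λ p n → con 3 :+ ((con 1 :+ p :+ n) :+ ((con 1 :+ p :+ n) :+ (con 1 :+ p :+ n)))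
                                              := (con 2 :+ n :* con 3) :+ (con 4 :+ con 3 :* p)) ≡.refl p orbit-count ⟩
    (2 ℕ.+ orbit-count ℕ.* 3) ℕ.+ (4 ℕ.+ 3 ℕ.* p) ∎)
    where
    open ≡.≡-Reasoning
    r : ℕ
    r = suc p ℕ.+ orbit-count
    fixed-points : 3 ℕ.∣ m → Sum (λ a → 1 when (third a a Fin.≟ a)) ≡ 3
    fixed-points (ℕ.divides k m≡k*3) = let open ThirdPart k m≡k*3 in fixed-∣ 1₂ (λ _ _ → ≡.refl) k k<m 2k<m m≡k*3

module SpectralRoot (m-1 : ℕ) (C : CyclotomicAlgebra (suc m-1)) where
  open Cyclic m-1
  open OrbitCount m-1 using (orbit-count)
  private
    module C = CyclotomicAlgebra C
    A : CommutativeRing 0ℓ 0ℓ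
    A = C.ring
    module A = Ring A
    κ : ℚ → A.Carrier
    κ = C.ι ∘ embed
    κ-hom : IsRingHomomorphism Gaussian.rawRing-ℚ A.rawRing κ
    κ-hom = Composition.isRingHomomorphism A.trans Gaussian.embed-hom C.ι-hom
    ι̅-hom : IsRingHomomorphism (DecRawRing.rawRing ℚ⟨i⟩-ring) A.rawRing (C.ι ∘ Gaussian.conjugate)
    ι̅-hom = Composition.isRingHomomorphism A.trans Gaussian.conjugate-hom C.ι-hom
  open Series A
  open RationalSeries A κ κ-hom
  module I = SeriesEmbedding ℚ⟨i⟩-ring A C.ι C.ι-hom
  module Ī = SeriesEmbedding ℚ⟨i⟩-ring A (C.ι ∘ Gaussian.conjugate) ι̅-hom
  private
    module G = Geometric ring
    module IE = IsRingHomomorphism I.expand-hom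

    ζ : Series
    ζ = constant C.ζ
    ζ-principal : G.Principal m ζ
    ζ-principal = GeometricHomomorphism.Principal-homo A ring constant constant-hom C.principal

    module J = SpectralConjugation m-1 ring (constant ∘ C.ι) (constant ∘ C.ι ∘ Gaussian.conjugate)
      I.constant-ψ-hom Ī.constant-ψ-hom (λ _ → S.refl) ζ ζ-principal var
    module P = SpectralProduct m-1 ring (constant ∘ C.ι) I.constant-ψ-hom ζ ζ-principal var
    module P̄ = SpectralProduct m-1 ring (constant ∘ C.ι ∘ Gaussian.conjugate) Ī.constant-ψ-hom J.ζ̄ J.ζ̄-principal var
    module F = SpectralFactors m-1 ring (constant ∘ C.ι) I.constant-ψ-hom ζ ζ-principal var
    module O = Orbits m-1 S.*-commutativeMonoid
    module Oℕ = Orbits m-1 ℕ.+-0-commutativeMonoid using (_when_)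
  open SpectralOrbits m-1 ring (constant ∘ C.ι) I.constant-ψ-hom ζ ζ-principal var

  expand-resultant : I.expand (scaled-resultant m) S.≈ spectrum
  expand-resultant = P.spectral-product

  expand-resultant-conjugate : Ī.expand (scaled-resultant m) S.≈ spectrum
  expand-resultant-conjugate = S.trans P̄.spectral-product J.conjugate-spectrum

  private
    1≉0 : ¬ A.1# A.≈ A.0#
    1≉0 e = contradiction (C.injective (A.trans (IsRingHomomorphism.1#-homo C.ι-hom)
        (A.trans e (A.sym (IsRingHomomorphism.0#-homo C.ι-hom))))) λ ()

    Below-^ : ∀ {f} n → Below 1 f → Below 1 (f S.^ n)
    Below-^ zero    b = Below-constant A.1#
    Below-^ (suc n) b = Below-* b (Below-^ n b)

    factor-monic : ∀ a b → Monic 1 (P.factor a b)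
    factor-monic a b = Monic-+ Monic-var (Below-neg (Below-* (Below-constant _)
      (Below-+ (Below-+ (2isin (toℕ a)) (2isin (toℕ b))) (2isin (toℕ (third a b))))))
      where
      2isin : ∀ k → Below 1 (P.2isin k)
      2isin k = Below-+ (Below-^ k (Below-constant C.ζ)) (Below-neg (Below-^ k (Below-^ m-1 (Below-constant C.ζ))))

  private
    -- One and the same decision `first?` selects a factor in the multiplicative monoid and a 1 in
    -- ℕ, so the degree delivered by `Monic-prod` is `orbit-count` itself.
    orbit-spectrum-monic : Monic orbit-count orbit-spectrum
    orbit-spectrum-monic = Monic-prod λ a → Monic-prod λ b →
      monic-when (O.first? (toℕ (suc a)) (toℕ b) (toℕ (third (suc a) b))) (factor-monic (suc a) b)
      where
      monic-when : ∀ {P : Set} {x} (d : Dec P) → Monic 1 x → Monic (1 Oℕ.when d) (x O.when d)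
      monic-when (yes _) mx = mx
      monic-when (no _)  mx = Monic-1

  module _ (N : Pw.Poly) (N-spectrum : I.expand N S.≈ spectrum) (N-conjugate : Ī.expand N S.≈ spectrum) where
    private
      -- The coefficients c of `N` lie in ℚ(i). Expanding `N` along `ι` and along its conjugate
      -- gives the same series, so c and its conjugate agree by injectivity.
      spectrum-rational : Rational spectrum
      spectrum-rational k = ℚ⟨i⟩.re c , A.trans (A.sym ι-c) (A.reflexive
          (≡.cong C.ι (Gaussian.conjugate-fixed c (C.injective conjugate-c))))
        where
        c : ℚ⟨i⟩
        c = Pw.coeff N k
        ι-c : C.ι c A.≈ spectrum k
        ι-c = A.trans (A.sym (I.expand-coeff N k)) (N-spectrum k)
        conjugate-c : C.ι (Gaussian.conjugate c) A.≈ C.ι c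
        conjugate-c = A.trans (A.trans (A.sym (Ī.expand-coeff N k)) (N-conjugate k)) (A.sym ι-c)

    module _ (K : Pℚ.Poly) (g : ℕ) (K-monic : Monic g (expand K)) (fixed≈ : fixed-spectrum S.≈ var S.* expand K) where
      private
        l : ℕ
        l = 3 ℕ.* m ℕ.∸ 2

        root : Σ[ E ∈ Pℚ.Poly ] (expand E S.≈ orbit-spectrum × Pℚ.deg E ≡ orbit-count)
        root = rational-polynomial 1≉0 orbit-spectrum-monic (cube-root-rational
          (Monic-* K-monic (Monic-var^ l))
          (Rational-* {expand K} (λ k → Pℚ.coeff K k , expand-coeff K k) (Rational-^ l Rational-var))
          orbit-spectrum-monic (Rational-cong (spectrum-cube fixed≈) spectrum-rational))

        expand-embed : ∀ p → I.expand (List.map embed p) S.≈ expand p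
        expand-embed []      = S.refl
        expand-embed (a ∷ p) = S.+-congˡ {constant (κ a)} (S.*-congˡ {var} {I.expand (List.map embed p)} {expand p}
            (expand-embed p))

      cube-root : Pℚ.Poly
      cube-root = proj₁ root

      cube-root-degree : Pℚ.deg cube-root ≡ orbit-count
      cube-root-degree = proj₂ (proj₂ root)

      -- Only the expansion of `p` is prescribed, so that both the bare cube and the cube times
      -- `w²-27/4` fit without ring laws for list polynomials.
      cube-root-equation : ∀ p → expand p S.≈ expand K S.* expand cube-root S.^ 3 →
        N Pw.⊛ (Pw.X ℚi[w].^ 0) Pw.≋ List.map embed p Pw.⊛ (Pw.X ℚi[w].^ l)
      cube-root-equation p p≈ = I.expand-injective C.injective {N Pw.⊛ (Pw.X ℚi[w].^ 0)} {List.map embed p Pw.⊛ (Pw.X ℚi[w].^ l)}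
        (cross-multiply ring I.expand I.expand-hom N (List.map embed p) l (I.eval-X var)
          (S.trans N-spectrum (spectrum-cube fixed≈))
          (S.trans (expand-embed p) (S.trans p≈ (S.*-congˡ {expand K} (S.^-congˡ 3 (proj₁ (proj₂ root)))))))

  open DecRawRing (ℚ-ring [X]) using () renaming (_*_ to _*ₚ_; _^_ to _^ₚ_; 1# to 1ₚ)
  private
    module E = IsRingHomomorphism expand-hom
    module H = Homomorphism (DecRawRing.rawRing (ℚ-ring [X])) ring expand expand-hom

    expand-w²-27/4 : expand w²-27/4 S.≈ var S.* var S.- constant (κ (ℤ.+ 27 ℚ./ 4))
    expand-w²-27/4 = S.trans (E.+-homo (Pℚ.X ^ₚ 2) (-ₚ Pℚ.const (ℤ.+ 27 ℚ./ 4))) (S.+-cong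
      (S.trans (H.^-homo Pℚ.X 2) (S.trans (S.^-congˡ 2 (eval-X var)) (S.*-congˡ {var} (S.*-identityʳ var))))
      (S.trans (E.-‿homo (Pℚ.const (ℤ.+ 27 ℚ./ 4))) (S.-‿cong (eval-const var (ℤ.+ 27 ℚ./ 4)))))
      where open DecRawRing (ℚ-ring [X]) using () renaming (-_ to -ₚ_)

  cube-root-∤ : ∀ N → I.expand N S.≈ spectrum → Ī.expand N S.≈ spectrum → ¬ 3 ℕ.∣ m →
    Σ[ E ∈ Pℚ.Poly ] (N Pw.⊛ (Pw.X ℚi[w].^ 0) Pw.≋ List.map embed (E ^ₚ 3) Pw.⊛ (Pw.X ℚi[w].^ (3 ℕ.* m ℕ.∸ 2)) × Pℚ.deg E
        ≡ orbit-count)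
  cube-root-∤ N N≈ N̄≈ 3∤m = E , cube-root-equation N N≈ N̄≈ 1ₚ 0 1-monic fixed≈ (E ^ₚ 3)
      (S.trans (H.^-homo E 3) (S.sym (S.trans (S.*-congʳ {expand E S.^ 3} E.1#-homo) (S.*-identityˡ (expand E S.^ 3))))) ,
    cube-root-degree N N≈ N̄≈ 1ₚ 0 1-monic fixed≈
    where
    1-monic : Monic 0 (expand 1ₚ)
    1-monic = Monic-cong (S.sym E.1#-homo) Monic-1
    fixed≈ : fixed-spectrum S.≈ var S.* expand 1ₚ
    fixed≈ = S.trans (fixed-spectrum-∤ 3∤m) (S.*-congˡ {var} (S.sym E.1#-homo))
    E : Pℚ.Poly
    E = cube-root N N≈ N̄≈ 1ₚ 0 1-monic fixed≈

  cube-root-∣ : ∀ N → I.expand N S.≈ spectrum → Ī.expand N S.≈ spectrum → 3 ℕ.∣ m →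
    Σ[ E ∈ Pℚ.Poly ] (N Pw.⊛ (Pw.X ℚi[w].^ 0) Pw.≋ List.map embed (w²-27/4 *ₚ E ^ₚ 3) Pw.⊛ (Pw.X ℚi[w].^ (3 ℕ.* m ℕ.∸ 2))
        × Pℚ.deg E ≡ orbit-count)
  cube-root-∣ N N≈ N̄≈ 3∣m = E , cube-root-equation N N≈ N̄≈ w²-27/4 2 K-monic fixed≈ (w²-27/4 *ₚ E ^ₚ 3)
      (S.trans (E.*-homo w²-27/4 (E ^ₚ 3)) (S.*-congˡ {expand w²-27/4} (H.^-homo E 3))) ,
    cube-root-degree N N≈ N̄≈ w²-27/4 2 K-monic fixed≈
    where
    K-monic : Monic 2 (expand w²-27/4)
    K-monic = Monic-cong (S.sym expand-w²-27/4)
      (Monic-+ (Monic-* Monic-var Monic-var) (Below-neg (Below-≤ (s≤s z≤n) (Below-constant (κ (ℤ.+ 27 ℚ./ 4))))))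
    fixed≈ : fixed-spectrum S.≈ var S.* expand w²-27/4
    fixed≈ = S.trans (fixed-spectrum-∣ 3∣m) (S.*-congˡ {var} (S.sym expand-w²-27/4))
    E : Pℚ.Poly
    E = cube-root N N≈ N̄≈ w²-27/4 2 K-monic fixed≈

open import Data.Nat using (ℕ; _≤_; _∸_; _*_; _/_)
open import Data.Nat.Divisibility using (_∣_; _∤_)
open import Data.Product using (Σ-syntax; _×_)
open import Relation.Binary.PropositionalEquality using (_≡_)
open import Defs

theorem1p3 : (m : ℕ) → 3 ≤ m →
    Σ[ E ∈ ℚ[w].Carrier ]
      ((3 ∤ m → D m ≈ᴸ fromℚ[w] (E ℚ[w].^ 3)
                × Pℚ.deg E ≡ (m ∸ 1) * (m ∸ 2) / 3)
      × (3 ∣ m → D m ≈ᴸ fromℚ[w] (w²-27/4 ℚ[w].* E ℚ[w].^ 3)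
                × Pℚ.deg E ≡ ((m ∸ 1) * (m ∸ 2) ∸ 2) / 3))
theorem1p3 m@(suc (suc (suc k))) (s≤s (s≤s (s≤s _))) = result (3 ℕ.∣? m)
  where
  open SpectralRoot (suc (suc k)) (cyclotomicAlgebra m)
  open OrbitCount (suc (suc k))
  result : Dec (3 ∣ m) → _
  -- `E` may be chosen after deciding 3 ∣ m, as the implication for the other case is then vacuous.
  result (no 3∤m) =
    let E , equation , degree = cube-root-∤ (scaled-resultant m) expand-resultant expand-resultant-conjugate 3∤m in
    E , (λ _ → equation , ≡.trans degree (≡.sym (≡.trans (≡.cong (_/ 3) (count-∤ (suc k) ≡.refl 3∤m)) (ℕ.m*n/n≡m orbit-count 3)))) ,
    λ 3∣m → contradiction 3∣m 3∤m
  result (yes 3∣m) =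
    let E , equation , degree = cube-root-∣ (scaled-resultant m) expand-resultant expand-resultant-conjugate 3∣m in
    E , (λ 3∤m → contradiction 3∣m 3∤m) ,
    λ _ → equation , ≡.trans degree (≡.sym (≡.trans (≡.cong (λ x → (x ∸ 2) / 3) (count-∣ (suc k) ≡.refl 3∣m)) (ℕ.m*n/n≡m orbit-count 3)))
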